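{- The graph theory $T_{\mathcal{L}_G}(\mathbb{S}_L)$ of a circle $\mathbb{S}_L$, $L>2$, determines $L$: if $L_1,L_2>2$ are distinct reals then $T_{\mathcal{L}_G}(\mathbb{S}_{L_1})\neq T_{\mathcal{L}_G}(\mathbb{S}_{L_2})$. Similarly, the graph theory $T_{\mathcal{L}_G}(S_r)$ of the sphere $S_r$ determines $r$ for $r>1/\pi$: if $r_1,r_2>1/\pi$ are distinct then $T_{\mathcal{L}_G}(S_{r_1})\neq T_{\mathcal{L}_G}(S_{r_2})$.
   Context: For real $L>2$, $\mathbb{S}_L=\mathbb{R}/L\mathbb{Z}$ with the metric $d_L(a,b)=\min\{|x-y|,L-|x-y|\}$, where $x,y\in[0,L)$ represent $a,b$. A subset $S\subseteq\mathbb{S}_L$ is integer-distance free if there are no $u\ne v$ in $S$ and $n\in\mathbb{Z}$ with $d_L(u,v)=n\pmod L$. $S_r\subseteq\mathbb{R}^3$ is the 2-sphere of radius $r$ with its geodesic metric. A (simple, undirected) graph with vertex set a dense subset $S$ of a separable metric space $(X,d)$ without isolated points is g.e.c. if (i) any two adjacent $u,v\in S$ satisfy $d(u,v)<1$; and (ii) for any $s\in S$, any disjoint finite $A,B\subseteq S$ contained in the open unit ball $B_1(s)$, and any $\epsilon>0$, there is $v\in S\setminus(A\cup B)$ with $d(s,v)<\epsilon$ adjacent to every vertex in $A$ and to no vertex in $B$. $\mathcal{L}_G=\{E\}$ is the language of graphs. $T_{\mathcal{L}_G}(\mathbb{S}_L)$ is the common complete $\mathcal{L}_G$-theory of all g.e.c.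 graphs on dense integer-distance free subsets of $\mathbb{S}_L$ (all such graphs are elementarily equivalent). $T_{\mathcal{L}_G}(S_r)$ is the common complete $\mathcal{L}_G$-theory of all g.e.c. graphs on dense independent subsets of $S_r$ (all such graphs are elementarily equivalent), where independence is with respect to the structure $M_r=(\mathbb{R},+,\cdot,0,1,<,r,\cos(1/r))$, in which $S_r\subseteq\mathbb{R}^3$ and the relation $d(x,y)<1$ are definable without parameters: $Y\subseteq S_r$ is independent if for every formula $\varphi(x,y)$ in the language of $M_r$ with $|x|=3$, $|y|=3m$, and every $\bar b\in Y^m$, if the set $\varphi(S_r,\bar b)=\{x\in S_r: M_r\models\varphi(x,\bar b)\}$ contains no non-empty open ball of $S_r$, then $Y\cap\varphi(S_r,\bar b)\subseteq\bar b$ (the set of entries of $\bar b$). -}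

module Defs where

open import Algebra.Bundles using (CommutativeRing)
import Algebra.Properties.Semiring.Exp as SemiringExp
import Algebra.Properties.Semiring.Mult as SemiringMult
open import Axiom.ExcludedMiddle using (ExcludedMiddle)
open import Data.Bool.Base using (if_then_else_)
open import Data.Empty using (⊥)
open import Data.Fin.Base using (Fin)
open import Data.Integer.Base using (ℤ; +_; -[1+_])
open import Data.List.Base using (List; _++_)
open import Data.List.Relation.Unary.All using (All)
open import Data.Nat.Base as ℕ using (ℕ; zero; suc; _!)
open import Data.Product.Base using (Σ; ∃; ∃-syntax; _×_; _,_; proj₁)
open import Data.Sum.Base using (_⊎_)
import Data.Vec.Base as Vec
open Vec using (Vec; []; _∷_)
import Data.Vec.Relation.Unary.All as VecAll
open import Level using (0ℓ) renaming (suc to lsuc)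
open import Relation.Binary.Core using (Rel)
open import Relation.Binary.Definitions
  using (Symmetric; Irreflexive; _Respects_; _Respects₂_)
open import Relation.Binary.Structures using (IsStrictTotalOrder)
open import Relation.Nullary using (¬_; yes; no; does)
open import Relation.Unary using (Pred; _≐_)

------------------------------------------------------------------------
-- First-order logic

record Language : Set₁ where
  field
    Fun : ℕ → Set
    Rl  : ℕ → Set

module Syntax (𝓛 : Language) where
  open Language 𝓛

  data Term (n : ℕ) : Set where
    var : Fin n → Term n
    fun : ∀ {k} → Fun k → Vec (Term n) k → Term n

  -- Formulas with free variables among Fin n.  The remaining connectives and ∃
  -- are classically definable; in `all φ` the bound variable has index zero.
  data Formula (n : ℕ) : Set where
    _≈'_ : Term n → Term n → Formula n
    rel  : ∀ {k} → Rl k → Vec (Term n) k → Formula n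
    ⊥'   : Formula n
    _⇒'_ : Formula n → Formula n → Formula n
    all  : Formula (suc n) → Formula n

  Sentence : Set
  Sentence = Formula 0

-- Equality symbols are interpreted by _≈_.
record Structure (𝓛 : Language) : Set₁ where
  open Language 𝓛
  field
    Carrier : Set
    _≈_     : Rel Carrier 0ℓ
    ⟦_⟧ᶠ    : ∀ {k} → Fun k → Vec Carrier k → Carrier
    ⟦_⟧ʳ    : ∀ {k} → Rl k → Vec Carrier k → Set

module Semantics {𝓛 : Language} (𝓜 : Structure 𝓛) where
  open Structure 𝓜
  open Syntax 𝓛

  mutual
    eval : ∀ {n} → Vec Carrier n → Term n → Carrier
    eval ρ (var i)    = Vec.lookup ρ i
    eval ρ (fun f ts) = ⟦ f ⟧ᶠ (evals ρ ts)

    evals : ∀ {n k} → Vec Carrier n → Vec (Term n) k → Vec Carrier k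
    evals ρ []       = []
    evals ρ (t ∷ ts) = eval ρ t ∷ evals ρ ts

  Sat : ∀ {n} → Vec Carrier n → Formula n → Set
  Sat ρ (s ≈' t)   = eval ρ s ≈ eval ρ t
  Sat ρ (rel R ts) = ⟦ R ⟧ʳ (evals ρ ts)
  Sat ρ ⊥'         = ⊥
  Sat ρ (φ ⇒' ψ)   = Sat ρ φ → Sat ρ ψ
  Sat ρ (all φ)    = ∀ a → Sat (a ∷ ρ) φ

  completeTheory : Pred Sentence 0ℓ
  completeTheory φ = Sat [] φ

data NoSymbol : ℕ → Set where

data GraphRel : ℕ → Set where
  E : GraphRel 2

𝓛G : Language
𝓛G = record { Fun = NoSymbol ; Rl = GraphRel }

GraphSentence : Set
GraphSentence = Syntax.Sentence 𝓛G

data FieldFun : ℕ → Set where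
  plus times               : FieldFun 2
  zero' one' radius cosine : FieldFun 0

data OrderRel : ℕ → Set where
  less : OrderRel 2

-- The language of (ℝ,+,·,0,1,<,r,cos(1/r)).
𝓛M : Language
𝓛M = record { Fun = FieldFun ; Rl = OrderRel }

------------------------------------------------------------------------
-- The real numbers

-- A Dedekind-complete ordered field, unique up to isomorphism in classical
-- mathematics.
record RealField : Set₁ where
  infix 4 _<_ _≤_
  infix 8 _⁻¹

  field
    commutativeRing : CommutativeRing 0ℓ 0ℓ

  open CommutativeRing commutativeRing public

  field
    _<_                : Rel Carrier 0ℓ
    isStrictTotalOrder : IsStrictTotalOrder _≈_ _<_
    0<1                : 0# < 1#
    +-monoˡ-<          : ∀ z {x y} → x < y → x + z < y + z
    *-pos              : ∀ {x y} → 0# < x → 0# < y → 0# < x * y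
    -- 0# ⁻¹ is an unspecified element.
    _⁻¹                : Carrier → Carrier
    ⁻¹-inverse         : ∀ x → ¬ x ≈ 0# → x * x ⁻¹ ≈ 1#

  open IsStrictTotalOrder isStrictTotalOrder public using (_<?_)

  _≤_ : Rel Carrier 0ℓ
  x ≤ y = x < y ⊎ x ≈ y

  UpperBound : Pred Carrier 0ℓ → Pred Carrier 0ℓ
  UpperBound P u = ∀ x → P x → x ≤ u

  field
    supremum : ∀ (P : Pred Carrier 0ℓ) → ∃ P → ∃ (UpperBound P) →
               ∃[ s ] UpperBound P s × (∀ u → UpperBound P u → s ≤ u)

-- Excluded middle is the ambient classical logic; it is used below only to turn
-- unique existence into functions.
module Reals (em : ExcludedMiddle 0ℓ) (R : RealField) where
  open RealField R public
    using (_≈_; _+_; _*_; _-_; -_; 0#; 1#; _<_; _≤_; _⁻¹; _<?_)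
    renaming (Carrier to ℝ)

  open SemiringExp (RealField.semiring R) using (_^_)
  open SemiringMult (RealField.semiring R) using () renaming (_×_ to _×ℕ_)

  -- Definite description: some element satisfying P, or 0# if there is none.
  the : Pred ℝ 0ℓ → ℝ
  the P with em {∃ P}
  ... | yes (x , _) = x
  ... | no _        = 0#

  2# : ℝ
  2# = 1# + 1#

  fromℕ : ℕ → ℝ
  fromℕ n = n ×ℕ 1#

  fromℤ : ℤ → ℝ
  fromℤ (+ n)    = fromℕ n
  fromℤ -[1+ n ] = - fromℕ (suc n)

  min : ℝ → ℝ → ℝ
  min x y = if does (x <? y) then x else y

  abs : ℝ → ℝ
  abs x = if does (x <? 0#) then - x else x

  Limit : (ℕ → ℝ) → ℝ → Set
  Limit s l = ∀ ε → 0# < ε → ∃[ N ] (∀ n → N ℕ.≤ n → abs (s n - l) < ε)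

  -- cosPartial x n = Σ_{k<n} (-1)^k x^(2k) / (2k)!
  cosPartial : ℝ → ℕ → ℝ
  cosPartial x zero    = 0#
  cosPartial x (suc k) =
    cosPartial x k + ((- 1#) ^ k) * (x ^ (2 ℕ.* k)) * (fromℕ ((2 ℕ.* k) !) ⁻¹)

  cos : ℝ → ℝ
  cos x = the (Limit (cosPartial x))

  -- π/2 is the least positive zero of cos.
  π/2 : ℝ
  π/2 = the λ h → 0# < h × cos h ≈ 0# × (∀ t → 0# < t → t < h → ¬ cos t ≈ 0#)

  π : ℝ
  π = π/2 + π/2

  arccos : ℝ → ℝ
  arccos u = the λ t → 0# ≤ t × t ≤ π × cos t ≈ u

------------------------------------------------------------------------
-- Metric spaces, graphs and their theories

module Graphs (em : ExcludedMiddle 0ℓ) (R : RealField) where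
  open Reals em R public

  -- In the manner of the library's raw bundles: the points (as a setoid) and the
  -- distance, without the laws, which play no role in the definitions below.
  record RawMetricSpace : Set₁ where
    infix 4 _≈ₚ_
    field
      Point : Set
      _≈ₚ_  : Rel Point 0ℓ
      d     : Point → Point → ℝ

  module _ (X : RawMetricSpace) where
    open RawMetricSpace X

    Dense : Pred Point 0ℓ → Set
    Dense S = ∀ x ε → 0# < ε → ∃[ s ] S s × d x s < ε

    -- A simple undirected graph whose vertex set is a subset of X.
    record Graph : Set₁ where
      field
        Vertex      : Pred Point 0ℓ
        Vertex-resp : Vertex Respects _≈ₚ_
        Adj         : Rel Point 0ℓ
        Adj-resp    : Adj Respects₂ _≈ₚ_
        Adj-vertex  : ∀ {u v} → Adj u v → Vertex u × Vertex v
        Adj-sym     : Symmetric Adj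
        Adj-irrefl  : Irreflexive _≈ₚ_ Adj

    infix 4 _∉_
    _∉_ : Point → List Point → Set
    v ∉ A = All (λ a → ¬ v ≈ₚ a) A

    module _ (Γ : Graph) where
      open Graph Γ

      graphStructure : Structure 𝓛G
      graphStructure = record
        { Carrier = Σ Point Vertex
        ; _≈_     = λ u v → proj₁ u ≈ₚ proj₁ v
        ; ⟦_⟧ᶠ    = λ ()
        ; ⟦_⟧ʳ    = λ { E (u ∷ v ∷ []) → Adj (proj₁ u) (proj₁ v) }
        }

      Th : Pred GraphSentence 0ℓ
      Th = Semantics.completeTheory graphStructure

      -- Finite sets of vertices are given by lists.
      record IsGEC : Set where
        field
          dense     : Dense Vertex
          geometric : ∀ {u v} → Adj u v → d u v < 1#
          extension : ∀ s (A B : List Point) ε →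
            Vertex s → All Vertex A → All Vertex B →
            All (_∉ B) A →
            All (λ a → d s a < 1#) A → All (λ b → d s b < 1#) B →
            0# < ε →
            ∃[ v ] Vertex v × v ∉ (A ++ B) × d s v < ε ×
                   All (Adj v) A × All (λ b → ¬ Adj v b) B

    -- T is the common complete theory of the g.e.c. graphs on dense subsets of X
    -- with property 𝒫.
    record IsCommonTheory (𝒫 : Pred Point 0ℓ → Set) (T : Pred GraphSentence 0ℓ)
           : Set₁ where
      field
        inhabited : Σ Graph λ Γ → IsGEC Γ × 𝒫 (Graph.Vertex Γ)
        common    : ∀ Γ → IsGEC Γ → 𝒫 (Graph.Vertex Γ) → T ≐ Th Γ

  ----------------------------------------------------------------------
  -- Circles

  module _ (L : ℝ) where

    infix 4 _≈modL_
    _≈modL_ : Rel ℝ 0ℓ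
    x ≈modL y = ∃[ k ] x ≈ y + fromℤ k * L

    -- The representative in [0,L).
    rep : ℝ → ℝ
    rep a = the λ x → 0# ≤ x × x < L × x ≈modL a

    circle : RawMetricSpace
    circle = record
      { Point = ℝ
      ; _≈ₚ_  = _≈modL_
      ; d     = λ a b → min (abs (rep a - rep b)) (L - abs (rep a - rep b))
      }

    IntegerDistanceFree : Pred ℝ 0ℓ → Set
    IntegerDistanceFree S =
      ∀ u v → S u → S v → ¬ u ≈modL v →
      ∀ (n : ℤ) → ¬ (RawMetricSpace.d circle u v ≈modL fromℤ n)

    IsCircleTheory : Pred GraphSentence 0ℓ → Set₁
    IsCircleTheory = IsCommonTheory circle IntegerDistanceFree

  ----------------------------------------------------------------------
  -- Spheres

  dot : Vec ℝ 3 → Vec ℝ 3 → ℝ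
  dot (x₁ ∷ x₂ ∷ x₃ ∷ []) (y₁ ∷ y₂ ∷ y₃ ∷ []) = x₁ * y₁ + x₂ * y₂ + x₃ * y₃

  module _ (r : ℝ) where

    record SpherePoint : Set where
      constructor _,_
      field
        coords   : Vec ℝ 3
        onSphere : dot coords coords ≈ r * r

    open SpherePoint

    -- The geodesic distance is r times the angle between the two vectors.
    sphere : RawMetricSpace
    sphere = record
      { Point = SpherePoint
      ; _≈ₚ_  = λ p q → ∀ i → Vec.lookup (coords p) i ≈ Vec.lookup (coords q) i
      ; d     = λ p q → r * arccos (dot (coords p) (coords q) * (r * r) ⁻¹)
      }

    open RawMetricSpace sphere

    M : Structure 𝓛M
    M = record
      { Carrier = ℝ
      ; _≈_     = _≈_
      ; ⟦_⟧ᶠ    = λ { plus (x ∷ y ∷ [])  → x + y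
                    ; times (x ∷ y ∷ []) → x * y
                    ; zero' []           → 0#
                    ; one' []            → 1#
                    ; radius []          → r
                    ; cosine []          → cos (r ⁻¹) }
      ; ⟦_⟧ʳ    = λ { less (x ∷ y ∷ []) → x < y }
      }

    open Syntax 𝓛M using (Formula)
    open Semantics M using (Sat)

    -- φ(S_r, b̄)
    DefinableSet : ∀ {m} → Formula (3 ℕ.+ m ℕ.* 3) → Vec Point m → Pred Point 0ℓ
    DefinableSet φ b x = Sat (coords x Vec.++ Vec.concat (Vec.map coords b)) φ

    ContainsBall : Pred Point 0ℓ → Set
    ContainsBall D = ∃[ p ] ∃[ ε ] 0# < ε × (∀ q → d p q < ε → D q)

    Independent : Pred Point 0ℓ → Set
    Independent Y =
      ∀ m (φ : Formula (3 ℕ.+ m ℕ.* 3)) (b : Vec Point m) → VecAll.All Y b →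
      ¬ ContainsBall (DefinableSet φ b) →
      ∀ y → Y y → DefinableSet φ b y → ∃[ i ] y ≈ₚ Vec.lookup b i

    IsSphereTheory : Pred GraphSentence 0ℓ → Set₁
    IsSphereTheory = IsCommonTheory sphere Independent

-- For numbers n and c there is a sentence saying that some n vertices are such that every vertex is
-- adjacent to fewer than c of them.  By the extension property it says of a g.e.c. graph that n points can
-- be placed so that every open unit ball contains fewer than c of them.
--
-- After rescaling, all circles (all spheres) become one homogeneous, totally bounded space, and the unit
-- balls become balls of radius θ, where θ = 1/L for circles and θ is the chord of the angle 1/r for spheres.
-- Given θ₁ < θ₂ and a small ε, let Y be an ε-net of the smallest possible size n.  Replacing the points of Y
-- in a ball about x by a moved copy of the points of Y in a slightly larger ball about y gives another net;
-- so, by minimality, every ball of radius θ₁ + ε contains fewer points of Y than any ball of radius θ₂ - ε.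
-- Let c be the least number of points of Y in a ball of the latter kind.  Points close to Y witness the
-- sentence for (n, c) at θ₁.  It fails at θ₂: the number of pairs (u, y) at distance less than θ₂, with y in
-- Y and u among n witnesses, would be at least n c and less than n c.
--
-- For spheres this needs that cos decreases strictly on [0, π].  A Cauchy product of power series gives
-- cos (x + y) + cos (x - y) = 2 cos x cos y, whence
-- (cos (x - y) - cos (x + y))² = 4 (1 - cos² x) (1 - cos² y), so that cos is injective on [0, π].
module Submission where

open import Defs
open import Axiom.ExcludedMiddle using (ExcludedMiddle)
open import Data.Product.Base using (_×_)
open import Level using (0ℓ)
open import Relation.Nullary using (¬_)
open import Relation.Unary using (Pred; _≐_)

import Algebra.Properties.AbelianGroup as AbelianGroupProperties
import Algebra.Properties.CommutativeSemigroup as CommutativeSemigroupProperties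
import Algebra.Properties.Ring as RingProperties
import Algebra.Properties.Semiring.Exp as Exp
import Algebra.Properties.Semiring.Mult as Multiple
import Algebra.Properties.Semiring.Mult.TCOptimised as Mult
import Algebra.Solver.Ring as RingSolver
open import Algebra.Solver.Ring.AlmostCommutativeRing using (fromCommutativeRing; _-Raw-AlmostCommutative⟶_)
open import Data.Bool.Base using (if_then_else_)
open import Data.Empty using (⊥-elim)
open import Data.Fin.Base using (Fin; zero; suc)
open import Data.Integer.Base as ℤ using (ℤ; -[1+_]; _⊖_; _◃_)
import Data.Integer.Properties as ℤ
open import Data.List.Base as List using (List; []; _∷_; _++_; length; filter)
open import Data.List.Membership.Propositional using (find; lose)
open import Data.List.Membership.Propositional.Properties using (∈-++⁺ˡ; ∈-++⁺ʳ; ∈-map⁺; ∈-filter⁺; ∈-cartesianProduct⁺)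
import Data.List.Properties as List
open import Data.List.Relation.Binary.Pointwise as Pointwise using (Pointwise; []; _∷_)
open import Data.List.Relation.Unary.All as All using (All; []; _∷_)
import Data.List.Relation.Unary.All.Properties as All
open import Data.List.Relation.Unary.Any as Any using (Any; here; there)
import Data.Maybe.Base as Maybe
open import Data.Nat.Base as ℕ using (ℕ; zero; suc; _!; z≤n; s≤s)
open import Data.Nat.ListAction using (sum)
import Data.Nat.Properties as ℕ
open import Data.Product.Base using (Σ; ∃; ∃-syntax; _,_; proj₁; proj₂)
import Data.Sign.Base as Sign
open import Data.Sum.Base using (_⊎_; inj₁; inj₂)
open import Data.Vec.Base as Vec using (Vec; []; _∷_)
import Data.Vec.Properties as Vec
open import Function.Base using (_∘_; id; flip)
open import Relation.Binary.Core using (Rel)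
open import Relation.Binary.Definitions using (tri<; tri≈; tri>)
open import Relation.Binary.PropositionalEquality.Core as ≡ using (_≡_)
import Relation.Binary.Reasoning.Setoid as SetoidReasoning
open import Relation.Binary.Structures using (IsStrictTotalOrder)
open import Relation.Nullary using (Dec; yes; no; does)
open import Relation.Nullary.Decidable using (dec⇒maybe; ¬?)

-- The minimal net stands in for an invariant measure: balls of equal radius ought to hold equally
-- many of its points, and the exchange argument proves this up to a change of radius. These changes
-- fix the constant 7 in `θ₁ + 7 ε = θ₂`. A neighbour in the first graph lies in `Ball 0`, and the
-- net point near it in `Ball 1`. In the exchange, a point deprived of its net point lies in
-- `Ball 2`, and the substitute comes from `Ball 3`. For strictness a net point must be gained: one
-- near a point of `Ball 5` outside `Ball 4` lies in `Ball 6` outside `Ball 3`. Passing from net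
-- points to vertices of the second graph leads to `Ball 7`. The graphs enter in opposite ways. In
-- the first, edges are short, so the neighbours of a vertex lie in a ball; in the second, the
-- listed vertices in a ball about a vertex have a common neighbour. Circles and spheres share this
-- argument through the record `Geometry`.

-- Counting in finite lists.

module Counting (em : ExcludedMiddle 0ℓ) where
  open import Data.Nat.Base using (_+_; _*_; _≤_; _<_)
  open import Relation.Binary.PropositionalEquality.Core using (refl; trans; cong)

  -- Induction on `k` in `below`: either a least element has been met before `k`, or every element
  -- is at least `k`. Just beyond a known element the second case is impossible.
  least : (P : ℕ → Set) → ∃ P → ∃[ n ] P n × (∀ m → P m → n ≤ m)
  least P (n , Pn) with below (suc n)
    where
    below : ∀ k → (∃[ n ] P n × (∀ m → P m → n ≤ m)) ⊎ (∀ m → P m → k ≤ m)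
    below zero    = inj₂ λ _ _ → z≤n
    below (suc k) with below k
    ... | inj₁ found = inj₁ found
    ... | inj₂ k≤    with em {P k}
    ...   | yes Pk = inj₁ (k , Pk , k≤)
    ...   | no ¬Pk = inj₂ λ m Pm → ℕ.≤∧≢⇒< (k≤ m Pm) λ { refl → ¬Pk Pm }
  ... | inj₁ found = found
  ... | inj₂ n<    = ⊥-elim (ℕ.<-irrefl refl (n< n Pn))

  indicator : Set → ℕ
  indicator P = if does (em {P}) then 1 else 0

  indicator-mono : ∀ {P Q : Set} → (P → Q) → indicator P ≤ indicator Q
  indicator-mono {P} {Q} P⇒Q with em {P} | em {Q}
  ... | yes p | yes _ = ℕ.≤-refl
  ... | yes p | no ¬q = ⊥-elim (¬q (P⇒Q p))
  ... | no _  | _     = z≤n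

  indicator-< : ∀ {P Q : Set} → ¬ P → Q → indicator P < indicator Q
  indicator-< {P} {Q} ¬p q with em {P} | em {Q}
  ... | yes p | _     = ⊥-elim (¬p p)
  ... | no _  | yes _ = s≤s z≤n
  ... | no _  | no ¬q = ⊥-elim (¬q q)

  private
    variable
      A B : Set

  count : (A → Set) → List A → ℕ
  count P []       = 0
  count P (x ∷ xs) = indicator (P x) + count P xs

  count-mono : ∀ {P Q : A → Set} {xs} → All (λ x → P x → Q x) xs → count P xs ≤ count Q xs
  count-mono []             = z≤n
  count-mono (P⇒Q ∷ P⇒Q-xs) = ℕ.+-mono-≤ (indicator-mono P⇒Q) (count-mono P⇒Q-xs)

  count-strict : ∀ {P Q : A → Set} {xs} → (∀ x → P x → Q x) → Any (λ x → Q x × ¬ P x) xs →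
                 count P xs < count Q xs
  count-strict {xs = _ ∷ xs} P⇒Q (here (q , ¬p)) =
    ℕ.+-mono-<-≤ (indicator-< ¬p q) (count-mono {xs = xs} (All.universal P⇒Q xs))
  count-strict P⇒Q (there any) = ℕ.+-mono-≤-< (indicator-mono (P⇒Q _)) (count-strict P⇒Q any)

  count-pointwise : ∀ {_∼_ : A → B → Set} {P : A → Set} {Q : B → Set} →
    (∀ {x y} → x ∼ y → P x → Q y) →
    ∀ {xs ys} → Pointwise _∼_ xs ys → count P xs ≤ count Q ys
  count-pointwise P⇒Q []           = z≤n
  count-pointwise P⇒Q (x∼y ∷ rest) =
    ℕ.+-mono-≤ (indicator-mono (P⇒Q x∼y)) (count-pointwise P⇒Q rest)

  count-map : ∀ (P : B → Set) (f : A → B) xs → count P (List.map f xs) ≡ count (P ∘ f) xs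
  count-map P f []       = refl
  count-map P f (x ∷ xs) = cong (indicator (P (f x)) +_) (count-map P f xs)

  decide : (P : A → Set) → ∀ x → Dec (P x)
  decide P x = em {P x}

  length-filter : ∀ (P : A → Set) xs → length (filter (decide P) xs) ≡ count P xs
  length-filter P []       = refl
  length-filter P (x ∷ xs) with em {P x}
  ... | yes _ = cong suc (length-filter P xs)
  ... | no _  = length-filter P xs

  length-filter-¬ : ∀ (P : A → Set) xs →
    length (filter (¬? ∘ decide P) xs) + count P xs ≡ length xs
  length-filter-¬ P []       = refl
  length-filter-¬ P (x ∷ xs) with em {P x}
  ... | yes _ = trans (ℕ.+-suc _ _) (cong suc (length-filter-¬ P xs))
  ... | no _  = cong suc (length-filter-¬ P xs)

  double-counting : ∀ (R : A → B → Set) xs ys →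
    sum (List.map (λ x → count (R x) ys) xs) ≡ sum (List.map (λ y → count (λ x → R x y) xs) ys)
  double-counting R [] []       = refl
  double-counting R [] (y ∷ ys) = double-counting R [] ys
  double-counting R (x ∷ xs) ys = trans (cong (count (R x) ys +_) (double-counting R xs ys)) (go ys)
    where
    go : ∀ ys → count (R x) ys + sum (List.map (λ y → count (λ x → R x y) xs) ys) ≡
                sum (List.map (λ y → count (λ x → R x y) (x ∷ xs)) ys)
    go []       = refl
    go (y ∷ ys) = trans (interchange (indicator (R x y)) _ _ _) (cong (_ +_) (go ys))
      where
      open CommutativeSemigroupProperties ℕ.+-commutativeSemigroup using (interchange)

  sum-≥ : ∀ (f : A → ℕ) {c xs} → All (λ x → c ≤ f x) xs → length xs * c ≤ sum (List.map f xs)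
  sum-≥ f []           = z≤n
  sum-≥ f (c≤ ∷ c≤-xs) = ℕ.+-mono-≤ c≤ (sum-≥ f c≤-xs)

  sum-≤ : ∀ (f : A → ℕ) {c xs} → All (λ x → f x ≤ c) xs → sum (List.map f xs) ≤ length xs * c
  sum-≤ f []           = z≤n
  sum-≤ f (≤c ∷ ≤c-xs) = ℕ.+-mono-≤ ≤c (sum-≤ f ≤c-xs)

-- The first-order sentence and what it says in a graph.

module FewNeighbours (em : ExcludedMiddle 0ℓ) where
  open import Data.Nat.Base using (_<_; s≤s⁻¹)
  open import Relation.Binary.PropositionalEquality.Core using (sym; trans; cong; subst)
  open Counting em
  open Syntax 𝓛G

  private
    variable
      n : ℕ

  ∃' : Formula (suc n) → Formula n
  ∃' φ = all (φ ⇒' ⊥') ⇒' ⊥'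

  _∧'_ : Formula n → Formula n → Formula n
  φ ∧' ψ = (φ ⇒' (ψ ⇒' ⊥')) ⇒' ⊥'

  ∃* : ∀ n → Formula n → Sentence
  ∃* zero    φ = φ
  ∃* (suc n) φ = ∃* n (∃' φ)

  -- A conjunction takes the place of a case distinction on `φ`: if `φ` holds, the first conjunct
  -- implies the second; if it fails, the first is vacuous.
  fewer : ℕ → List (Formula n) → Formula n
  fewer zero    φs       = ⊥'
  fewer (suc c) []       = ⊥' ⇒' ⊥'
  fewer (suc c) (φ ∷ φs) = (φ ⇒' fewer c φs) ∧' fewer (suc c) φs

  adjacent : Fin n → Formula (suc n)
  adjacent i = rel E (var zero ∷ var (suc i) ∷ [])

  -- There are n vertices such that every vertex is adjacent to fewer than c of them.
  fewNeighbours : ℕ → ℕ → Sentence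
  fewNeighbours n c = ∃* n (all (fewer c (List.map adjacent (Vec.toList (Vec.allFin n)))))

  module _ (𝓢 : Structure 𝓛G) where
    open Structure 𝓢
    open Semantics 𝓢

    Edge : Carrier → Carrier → Set
    Edge u v = ⟦ E ⟧ʳ (u ∷ v ∷ [])

    fewer⇒count : ∀ (ρ : Vec Carrier n) c φs → Sat ρ (fewer c φs) → count (Sat ρ) φs < c
    fewer⇒count ρ (suc c) []       _ = s≤s z≤n
    fewer⇒count ρ (suc c) (φ ∷ φs) h with em {Sat ρ φ}
    -- `∧'` is doubly negated, so its conjuncts can only be used towards a contradiction; as `<` on
    -- ℕ is decidable, the bound may be proved by refuting its opposite.
    ... | no _  = ℕ.≰⇒> λ ≥c → h λ _ rest → ℕ.<⇒≱ (fewer⇒count ρ (suc c) φs rest) ≥c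
    ... | yes p = s≤s (ℕ.≰⇒> λ ≥c → h λ first _ → ℕ.<⇒≱ (fewer⇒count ρ c φs (first p)) ≥c)

    count⇒fewer : ∀ (ρ : Vec Carrier n) c φs → count (Sat ρ) φs < c → Sat ρ (fewer c φs)
    count⇒fewer ρ (suc c) []       _ = id
    count⇒fewer ρ (suc c) (φ ∷ φs) h with em {Sat ρ φ}
    ... | no ¬p = λ k → k (λ p → ⊥-elim (¬p p)) (count⇒fewer ρ (suc c) φs h)
    ... | yes _ = λ k → k (λ _ → count⇒fewer ρ c φs (s≤s⁻¹ h))
                          (count⇒fewer ρ (suc c) φs (ℕ.m<n⇒m<1+n (s≤s⁻¹ h)))

    ∃*⇒ : ∀ n (φ : Formula n) → Sat [] (∃* n φ) → ∃[ ρ ] Sat ρ φ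
    ∃*⇒ zero    φ h = [] , h
    ∃*⇒ (suc n) φ h with ∃*⇒ n (∃' φ) h
    -- `∃'` denies only that there is no witness; excluded middle extracts one.
    ... | ρ , h′ with em {∃[ a ] Sat (a ∷ ρ) φ}
    ...   | yes (a , p) = a ∷ ρ , p
    ...   | no none     = ⊥-elim (h′ λ a p → none (a , p))

    ⇒∃* : ∀ n (φ : Formula n) → ∃[ ρ ] Sat ρ φ → Sat [] (∃* n φ)
    ⇒∃* zero    φ ([] , h)    = h
    ⇒∃* (suc n) φ (a ∷ ρ , h) = ⇒∃* n (∃' φ) (ρ , λ k → k a h)

    count-adjacent : ∀ (v : Carrier) (ρ : Vec Carrier n) →
      count (Sat (v ∷ ρ)) (List.map adjacent (Vec.toList (Vec.allFin n))) ≡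
      count (Edge v) (Vec.toList ρ)
    count-adjacent {n} v ρ = trans (count-map (Sat (v ∷ ρ)) adjacent is)
      (trans (sym (count-map (Edge v) (Vec.lookup ρ) is))
        (cong (count (Edge v)) (trans (sym (Vec.toList-map (Vec.lookup ρ) (Vec.allFin n)))
          (cong Vec.toList (Vec.map-lookup-allFin ρ)))))
      where
      is = Vec.toList (Vec.allFin n)

    fewNeighbours⇒ : ∀ n c → Sat [] (fewNeighbours n c) →
      ∃[ ys ] length ys ≡ n × (∀ v → count (Edge v) ys < c)
    fewNeighbours⇒ n c h with ∃*⇒ n _ h
    ... | ρ , h′ = Vec.toList ρ , Vec.length-toList ρ ,
      λ v → subst (_< c) (count-adjacent v ρ) (fewer⇒count (v ∷ ρ) c _ (h′ v))

    ⇒fewNeighbours : ∀ c ys → (∀ v → count (Edge v) ys < c) → Sat [] (fewNeighbours (length ys) c)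
    ⇒fewNeighbours c ys h = ⇒∃* (length ys) _ (Vec.fromList ys , λ v → count⇒fewer (v ∷ _) c _
      (subst (_< c) (sym (trans (count-adjacent v (Vec.fromList ys))
        (cong (count (Edge v)) (Vec.toList∘fromList ys)))) (h v)))

-- Comparing two radii by means of a minimal net.

module Comparison (em : ExcludedMiddle 0ℓ) where
  open import Data.Nat.Base using (_+_; _*_; _≤_; _<_; s≤s⁻¹)
  open import Relation.Binary.PropositionalEquality.Core using (refl; sym; trans; cong)
  open Counting em
  open FewNeighbours em

  -- Ball k is meant to be the relation of lying at distance less than θ + k ε, and
  -- Near that of lying at distance less than ε.
  record Geometry : Set₁ where
    field
      X         : Set
      Near      : Rel X 0ℓ
      Ball      : ℕ → Rel X 0ℓ
      centre    : X
      Near-refl : ∀ {x} → Near x x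
      Near-sym  : ∀ {x y} → Near x y → Near y x
      Ball-sym  : ∀ {k x y} → Ball k x y → Ball k y x
      Ball-Near : ∀ {k x y z} → Ball k x y → Near y z → Ball (suc k) x z
      net       : ∃[ ys ] (∀ x → Any (Near x) ys)
      move      : ∀ x y → Σ (X → X) λ g → Σ (X → X) λ h →
                                        (∀ u w → Near (h w) u → Near w (g u)) ×
                                        (∀ k w → Ball k x w → Ball k y (h w))
      shell     : ∀ x → ∃[ w ] Ball 5 x w × ¬ Ball 4 x w

  module _ (G : Geometry) where
    open Geometry G

    -- What a g.e.c. graph provides once its vertices are placed in the common space. There `∼`
    -- expresses that the original distance is less than one.
    record Model (_∼_ : Rel X 0ℓ) (𝓢 : Structure 𝓛G) : Set where
      open Structure 𝓢 using (Carrier)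
      field
        position  : Carrier → X
        geometric : ∀ {u v} → Edge 𝓢 u v → position u ∼ position v
        dense     : ∀ x → ∃[ v ] Near x (position v)
        extension : ∀ s (A : List Carrier) → All (λ a → position s ∼ position a) A →
                    ∃[ v ] All (Edge 𝓢 v) A

    Ball-suc : ∀ {k x y} → Ball k x y → Ball (suc k) x y
    Ball-suc b = Ball-Near b Near-refl

    IsNet : List X → Set
    IsNet ys = ∀ x → Any (Near x) ys

    smallest-net : ∃[ ys ] IsNet ys × (∀ zs → IsNet zs → length ys ≤ length zs)
    smallest-net with least (λ n → ∃[ ys ] IsNet ys × length ys ≡ n)
                            (_ , proj₁ net , proj₂ net , refl)
    ... | _ , (ys , ys-net , refl) , minimal =
      ys , ys-net , λ zs zs-net → minimal _ (zs , zs-net , refl)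

    module _ {ys} (ys-net : IsNet ys) (minimal : ∀ zs → IsNet zs → length ys ≤ length zs) where

      -- Exchanging the part of the net in Ball 1 x for a copy of its part in Ball 3 y
      -- gives another net, which by minimality is no smaller.
      count-Ball₁≤count-Ball₃ : ∀ x y → count (Ball 1 x) ys ≤ count (Ball 3 y) ys
      count-Ball₁≤count-Ball₃ x y = ℕ.+-cancelˡ-≤ (length outer) _ _ (begin
        length outer + count (Ball 1 x) ys  ≡⟨ length-filter-¬ (Ball 1 x) ys ⟩
        length ys                           ≤⟨ minimal zs zs-net ⟩
        length zs                           ≡⟨ List.length-++ outer ⟩
        length outer + length (List.map g inner)
          ≡⟨ cong (length outer +_) (trans (List.length-map g inner) (length-filter (Ball 3 y) ys)) ⟩
        length outer + count (Ball 3 y) ys  ∎)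
        where
        open ℕ.≤-Reasoning
        g = proj₁ (move x y)
        h = proj₁ (proj₂ (move x y))
        Near-h⇒ = proj₁ (proj₂ (proj₂ (move x y)))
        Ball-h  = proj₂ (proj₂ (proj₂ (move x y)))
        outer = filter (¬? ∘ decide (Ball 1 x)) ys
        inner = filter (decide (Ball 3 y)) ys
        zs = outer ++ List.map g inner
        zs-net : IsNet zs
        zs-net w with find (ys-net w)
        ... | u , u∈ys , w∼u with em {Ball 1 x u}
        ...   | no ¬b = lose (∈-++⁺ˡ (∈-filter⁺ (¬? ∘ decide (Ball 1 x)) u∈ys ¬b)) w∼u
        -- Here `w` has lost its net point, so `w` is in `Ball 2 x` and `h w` in `Ball 2 y`. The net
        -- point `u′` near `h w` is then in `Ball 3 y`, hence in `inner`, and `g` takes it near `w`.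
        ...   | yes b with find (ys-net (h w))
        ...     | u′ , u′∈ys , hw∼u′ = lose (∈-++⁺ʳ outer (∈-map⁺ g (∈-filter⁺ (decide (Ball 3 y)) u′∈ys
                    (Ball-Near (Ball-h 2 w (Ball-Near b (Near-sym w∼u))) hw∼u′)))) (Near-h⇒ u′ w hw∼u′)

      -- A point `w` of the shell between the radii 4 and 5 is near a net point, which lies in
      -- `Ball 6`. It does not lie in `Ball 3`, for then `w` would lie in `Ball 4`.
      count-Ball₃<count-Ball₆ : ∀ y → count (Ball 3 y) ys < count (Ball 6 y) ys
      count-Ball₃<count-Ball₆ y = count-strict (λ _ b → Ball-suc (Ball-suc (Ball-suc b)))
        (Any.map (λ w∼u → Ball-Near (proj₁ (proj₂ (shell y))) w∼u ,
                          λ b → proj₂ (proj₂ (shell y)) (Ball-Near b (Near-sym w∼u)))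
          (ys-net (proj₁ (shell y))))

    module _ {_∼₁_ _∼₂_ : Rel X 0ℓ} {𝓢₁ 𝓢₂ : Structure 𝓛G}
             (∼₁⇒Ball₀ : ∀ {x y} → x ∼₁ y → Ball 0 x y) (Ball₇⇒∼₂ : ∀ {x y} → Ball 7 x y → x ∼₂ y)
             (M₁ : Model _∼₁_ 𝓢₁) (M₂ : Model _∼₂_ 𝓢₂) where
      private
        module M₁ = Model M₁
        module M₂ = Model M₂

      approximate : ∀ {_∼_ 𝓢} (M : Model _∼_ 𝓢) (ys : List X) →
        ∃[ vs ] Pointwise (λ y v → Near y (Model.position M v)) ys vs
      approximate M []       = [] , []
      approximate M (y ∷ ys) with Model.dense M y | approximate M ys
      ... | v , y∼v | vs , ys∼vs = v ∷ vs , y∼v ∷ ys∼vs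

      ¬few : ∀ {ys} → IsNet ys → ∀ c → (∀ y → c ≤ count (Ball 6 y) ys) →
             ∀ us → length us ≡ length ys → ¬ (∀ v → count (Edge 𝓢₂ v) us < c)
      ¬few {ys} ys-net c c≤ us us-length few with approximate M₂ ys
      -- The strict inequality between the products needs a positive number of net points; an empty
      -- net would leave `centre` uncovered.
      ¬few {[]}     ys-net c c≤ us us-length few | ss , _ with () ← ys-net centre
      -- No count is less than zero, so a single vertex gives the contradiction; density supplies
      -- it.
      ¬few {y ∷ ys} ys-net zero c≤ us us-length few | ss , _ with () ← few (proj₁ (M₂.dense centre))
      ¬few {y ∷ ys} ys-net (suc c) c≤ us us-length few | ss , ys∼ss =
        ℕ.<⇒≱ (ℕ.*-monoʳ-< (suc (length ys)) (ℕ.n<1+n c)) (begin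
          suc (length ys) * suc c    ≡⟨ cong (_* suc c) us-length ⟨
          length us * suc c          ≤⟨ sum-≥ _ (All.universal many us) ⟩
          sum (List.map (λ u → count (λ s → s ∼ u) ss) us)  ≡⟨ double-counting (flip _∼_) us ss ⟩
          sum (List.map (λ s → count (λ u → s ∼ u) us) ss)  ≤⟨ sum-≤ _ (All.universal rare ss) ⟩
          length ss * c              ≡⟨ cong (_* c) (Pointwise.Pointwise-length ys∼ss) ⟨
          suc (length ys) * c        ∎)
        where
        open ℕ.≤-Reasoning
        _∼_ = λ s u → M₂.position s ∼₂ M₂.position u
        many : ∀ u → suc c ≤ count (λ s → s ∼ u) ss
        many u = ℕ.≤-trans (c≤ (M₂.position u))
          (count-pointwise (λ y∼s b → Ball₇⇒∼₂ (Ball-sym (Ball-Near b y∼s))) ys∼ss)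
        rare : ∀ s → count (λ u → s ∼ u) us ≤ c
        -- The extension property at `s` yields one `v` adjacent to all the vertices counted here,
        -- so the bound on the neighbours of `v` bounds their number.
        rare s with M₂.extension s (filter (decide (s ∼_)) us) (All.all-filter (decide (s ∼_)) us)
        ... | v , adjacent = s≤s⁻¹ (ℕ.≤-<-trans (count-mono {xs = us} (All.tabulate
                λ u∈us s∼u → All.lookup adjacent (∈-filter⁺ (decide (s ∼_)) u∈us s∼u))) (few v))

      distinguished : ¬ (∀ φ → Semantics.completeTheory 𝓢₁ φ → Semantics.completeTheory 𝓢₂ φ)
      distinguished transfer with smallest-net
      ... | ys , ys-net , minimal
          -- The minimum `c` is attained, at `y₀`. Comparison with the ball about `y₀` puts every
          -- count in the first graph below `c`, while minimality of `c` bounds the counts for the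
          -- second graph from below.
          with least (λ n → ∃[ y ] count (Ball 6 y) ys ≡ n) (_ , centre , refl)
      ...   | c , (y₀ , refl) , c-minimal with approximate M₁ ys
      ...     | vs , ys∼vs with fewNeighbours⇒ 𝓢₂ (length vs) c
                (transfer (fewNeighbours (length vs) c) (⇒fewNeighbours 𝓢₁ c vs few))
        where
        few : ∀ v → count (Edge 𝓢₁ v) vs < c
        few v = ℕ.≤-<-trans
          (count-pointwise (λ v∼y e → Ball-Near (∼₁⇒Ball₀ (M₁.geometric e)) (Near-sym v∼y))
            (Pointwise.symmetric id ys∼vs))
          (ℕ.≤-<-trans (count-Ball₁≤count-Ball₃ ys-net minimal (M₁.position v) y₀)
                       (count-Ball₃<count-Ball₆ ys-net minimal y₀))
      ...       | us , us-length , us-few = ¬few ys-net c (λ y → c-minimal _ (y , refl)) us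
                    (trans us-length (sym (Pointwise.Pointwise-length ys∼vs))) us-few

-- Ordered field arithmetic and a ring solver with integer coefficients.

module OrderedField (R : RealField) where
  open import Data.Integer.Base using (+_)
  open RealField R public hiding (zero)
  open IsStrictTotalOrder isStrictTotalOrder public
    using (compare; _≟_; <-respˡ-≈; <-respʳ-≈)
    renaming (trans to <-trans; irrefl to <-irrefl)

  open Mult semiring using (×-homo-+; ×1-homo-*; 1+×) renaming (_×_ to _⊗_)
  open AbelianGroupProperties +-abelianGroup
    using () renaming (⁻¹-∙-comm to -‿+-comm; ε⁻¹≈ε to -0≈0; ⁻¹-involutive to -‿involutive)
  open RingProperties ring using (-‿distribˡ-*; -‿distribʳ-*)
  open SetoidReasoning setoid

  -- The coefficients of the ring solver. The optimised multiple makes `embed (+ 1)` compute to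
  -- `1#`, so that `:1` and `:2` denote `1#` and `two` themselves.
  embed : ℤ → Carrier
  embed (+ n)    = n ⊗ 1#
  embed -[1+ n ] = - (suc n ⊗ 1#)

  private
    embed-⊖ : ∀ m n → embed (m ⊖ n) ≈ m ⊗ 1# + - (n ⊗ 1#)
    embed-⊖ zero    zero    = sym (trans (+-identityˡ _) -0≈0)
    embed-⊖ zero    (suc n) = sym (+-identityˡ _)
    embed-⊖ (suc m) zero    = sym (trans (+-congˡ -0≈0) (+-identityʳ _))
    embed-⊖ (suc m) (suc n) = begin
      embed (suc m ⊖ suc n)                    ≡⟨ ≡.cong embed (ℤ.[1+m]⊖[1+n]≡m⊖n m n) ⟩
      embed (m ⊖ n)                            ≈⟨ embed-⊖ m n ⟩
      m ⊗ 1# + - (n ⊗ 1#)                      ≈⟨ +-congʳ (+-identityˡ _) ⟨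
      (0# + m ⊗ 1#) + - (n ⊗ 1#)               ≈⟨ +-congʳ (+-congʳ (-‿inverseʳ 1#)) ⟨
      ((1# + - 1#) + m ⊗ 1#) + - (n ⊗ 1#)      ≈⟨ +-congʳ (+-assoc _ _ _) ⟩
      (1# + (- 1# + m ⊗ 1#)) + - (n ⊗ 1#)      ≈⟨ +-congʳ (+-congˡ (+-comm _ _)) ⟩
      (1# + (m ⊗ 1# + - 1#)) + - (n ⊗ 1#)      ≈⟨ +-congʳ (+-assoc _ _ _) ⟨
      ((1# + m ⊗ 1#) + - 1#) + - (n ⊗ 1#)      ≈⟨ +-assoc _ _ _ ⟩
      (1# + m ⊗ 1#) + (- 1# + - (n ⊗ 1#))      ≈⟨ +-cong (sym (1+× m 1#)) (-‿+-comm _ _) ⟩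
      suc m ⊗ 1# + - (1# + n ⊗ 1#)             ≈⟨ +-congˡ (-‿cong (1+× n 1#)) ⟨
      suc m ⊗ 1# + - (suc n ⊗ 1#)              ∎

    embed-+◃ : ∀ n → embed (Sign.+ ◃ n) ≈ n ⊗ 1#
    embed-+◃ zero    = refl
    embed-+◃ (suc n) = refl

    embed--◃ : ∀ n → embed (Sign.- ◃ n) ≈ - (n ⊗ 1#)
    embed--◃ zero    = sym -0≈0
    embed--◃ (suc n) = refl

  embed-+ : ∀ i j → embed (i ℤ.+ j) ≈ embed i + embed j
  embed-+ (+ m)    (+ n)    = ×-homo-+ 1# m n
  embed-+ (+ m)    -[1+ n ] = embed-⊖ m (suc n)
  embed-+ -[1+ m ] (+ n)    = trans (embed-⊖ n (suc m)) (+-comm _ _)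
  embed-+ -[1+ m ] -[1+ n ] = begin
    - (suc (suc (m ℕ.+ n)) ⊗ 1#)       ≡⟨ ≡.cong (λ k → - (suc k ⊗ 1#)) (ℕ.+-suc m n) ⟨
    - ((suc m ℕ.+ suc n) ⊗ 1#)         ≈⟨ -‿cong (×-homo-+ 1# (suc m) (suc n)) ⟩
    - (suc m ⊗ 1# + suc n ⊗ 1#)        ≈⟨ -‿+-comm _ _ ⟨
    - (suc m ⊗ 1#) + - (suc n ⊗ 1#)    ∎

  embed-* : ∀ i j → embed (i ℤ.* j) ≈ embed i * embed j
  embed-* (+ m)    (+ n)    = trans (embed-+◃ (m ℕ.* n)) (×1-homo-* m n)
  embed-* (+ m)    -[1+ n ] = begin
    embed (Sign.- ◃ (m ℕ.* suc n))     ≈⟨ embed--◃ (m ℕ.* suc n) ⟩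
    - ((m ℕ.* suc n) ⊗ 1#)             ≈⟨ -‿cong (×1-homo-* m (suc n)) ⟩
    - (m ⊗ 1# * suc n ⊗ 1#)            ≈⟨ -‿distribʳ-* _ _ ⟩
    m ⊗ 1# * - (suc n ⊗ 1#)            ∎
  embed-* -[1+ m ] (+ n)    = begin
    embed (Sign.- ◃ (suc m ℕ.* n))     ≈⟨ embed--◃ (suc m ℕ.* n) ⟩
    - ((suc m ℕ.* n) ⊗ 1#)             ≈⟨ -‿cong (×1-homo-* (suc m) n) ⟩
    - (suc m ⊗ 1# * n ⊗ 1#)            ≈⟨ -‿distribˡ-* _ _ ⟩
    - (suc m ⊗ 1#) * n ⊗ 1#            ∎
  embed-* -[1+ m ] -[1+ n ] = begin
    (suc m ℕ.* suc n) ⊗ 1#             ≈⟨ ×1-homo-* (suc m) (suc n) ⟩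
    suc m ⊗ 1# * suc n ⊗ 1#            ≈⟨ -‿involutive _ ⟨
    - - (suc m ⊗ 1# * suc n ⊗ 1#)      ≈⟨ -‿cong (-‿distribˡ-* _ _) ⟩
    - (- (suc m ⊗ 1#) * suc n ⊗ 1#)    ≈⟨ -‿distribʳ-* _ _ ⟩
    - (suc m ⊗ 1#) * - (suc n ⊗ 1#)    ∎

  embed-neg : ∀ i → embed (ℤ.- i) ≈ - embed i
  embed-neg (+ zero)   = sym -0≈0
  embed-neg (+ suc n)  = refl
  embed-neg -[1+ n ]   = sym (-‿involutive _)

  private
    embedding : ℤ.+-*-rawRing -Raw-AlmostCommutative⟶ fromCommutativeRing commutativeRing
    embedding = record
      { ⟦_⟧ = embed ; +-homo = embed-+ ; *-homo = embed-* ; -‿homo = embed-neg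
      ; 0-homo = refl ; 1-homo = refl }

  open RingSolver ℤ.+-*-rawRing (fromCommutativeRing commutativeRing) embedding
    (λ i j → Maybe.map (λ i≡j → reflexive (≡.cong embed i≡j)) (dec⇒maybe (i ℤ.≟ j))) public
    using (Polynomial; solve; _:+_; _:*_; _:-_; :-_; _:=_; con)

  :1 : ∀ {n} → Polynomial n
  :1 = con (+ 1)

  :2 : ∀ {n} → Polynomial n
  :2 = :1 :+ :1

  :0 : ∀ {n} → Polynomial n
  :0 = con (+ 0)

  opaque
    ≤-reflexive : ∀ {x y} → x ≈ y → x ≤ y
    ≤-reflexive = inj₂

    ≤-refl : ∀ {x} → x ≤ x
    ≤-refl = inj₂ refl

    <⇒≤ : ∀ {x y} → x < y → x ≤ y
    <⇒≤ = inj₁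

    ≤-<-trans : ∀ {x y z} → x ≤ y → y < z → x < z
    ≤-<-trans (inj₁ x<y) y<z = <-trans x<y y<z
    ≤-<-trans (inj₂ x≈y) y<z = <-respˡ-≈ (sym x≈y) y<z

    <-≤-trans : ∀ {x y z} → x < y → y ≤ z → x < z
    <-≤-trans x<y (inj₁ y<z) = <-trans x<y y<z
    <-≤-trans x<y (inj₂ y≈z) = <-respʳ-≈ y≈z x<y

    ≤-trans : ∀ {x y z} → x ≤ y → y ≤ z → x ≤ z
    ≤-trans (inj₁ x<y) y≤z        = inj₁ (<-≤-trans x<y y≤z)
    ≤-trans (inj₂ x≈y) (inj₁ y<z) = inj₁ (<-respˡ-≈ (sym x≈y) y<z)
    ≤-trans (inj₂ x≈y) (inj₂ y≈z) = inj₂ (trans x≈y y≈z)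

    ≤-respˡ-≈ : ∀ {x x′ y} → x ≈ x′ → x ≤ y → x′ ≤ y
    ≤-respˡ-≈ x≈x′ x≤y = ≤-trans (inj₂ (sym x≈x′)) x≤y

    ≤-respʳ-≈ : ∀ {x y y′} → y ≈ y′ → x ≤ y → x ≤ y′
    ≤-respʳ-≈ y≈y′ x≤y = ≤-trans x≤y (inj₂ y≈y′)

    <⇒≱ : ∀ {x y} → x < y → ¬ y ≤ x
    <⇒≱ x<y y≤x = <-irrefl refl (<-≤-trans x<y y≤x)

    <⇒≉ : ∀ {x y} → x < y → ¬ x ≈ y
    <⇒≉ x<y x≈y = <-irrefl x≈y x<y

    >⇒≉ : ∀ {x y} → y < x → ¬ x ≈ y
    >⇒≉ y<x x≈y = <-irrefl (sym x≈y) y<x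

    ≤-or-> : ∀ x y → x ≤ y ⊎ y < x
    ≤-or-> x y with compare x y
    ... | tri< x<y _ _ = inj₁ (inj₁ x<y)
    ... | tri≈ _ x≈y _ = inj₁ (inj₂ x≈y)
    ... | tri> _ _ y<x = inj₂ y<x

    ≮⇒≥ : ∀ {x y} → ¬ x < y → y ≤ x
    ≮⇒≥ {x} {y} x≮y with ≤-or-> y x
    ... | inj₁ y≤x = y≤x
    ... | inj₂ x<y = ⊥-elim (x≮y x<y)

    ≰⇒> : ∀ {x y} → ¬ x ≤ y → y < x
    ≰⇒> {x} {y} x≰y with ≤-or-> x y
    ... | inj₁ x≤y = ⊥-elim (x≰y x≤y)
    ... | inj₂ y<x = y<x

    ≤-antisym : ∀ {x y} → x ≤ y → y ≤ x → x ≈ y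
    ≤-antisym (inj₂ x≈y) _   = x≈y
    ≤-antisym (inj₁ x<y) y≤x = ⊥-elim (<⇒≱ x<y y≤x)

    -- Inequalities are proved by exhibiting the difference of the two sides as a
    -- combination of products of nonnegative elements.
    <⇒0<- : ∀ {x y} → x < y → 0# < y - x
    <⇒0<- {x} x<y = <-respˡ-≈ (-‿inverseʳ x) (+-monoˡ-< (- x) x<y)

    ≤⇒0≤- : ∀ {x y} → x ≤ y → 0# ≤ y - x
    ≤⇒0≤- (inj₁ x<y) = inj₁ (<⇒0<- x<y)
    ≤⇒0≤- {x} (inj₂ x≈y) = inj₂ (trans (sym (-‿inverseʳ x)) (+-congʳ x≈y))

    0<⇒< : ∀ {x y t} → 0# < t → t ≈ y - x → x < y
    0<⇒< {x} {y} 0<t t≈y-x = <-respˡ-≈ (+-identityˡ x) (<-respʳ-≈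
      (solve 2 (λ x y → (y :- x) :+ x := y) refl x y)
      (+-monoˡ-< x (<-respʳ-≈ t≈y-x 0<t)))

    0≤⇒≤ : ∀ {x y t} → 0# ≤ t → t ≈ y - x → x ≤ y
    0≤⇒≤ (inj₁ 0<t) t≈y-x = inj₁ (0<⇒< 0<t t≈y-x)
    0≤⇒≤ {x} {y} (inj₂ 0≈t) t≈y-x = inj₂ (trans (sym (+-identityˡ x))
      (trans (+-congʳ (trans 0≈t t≈y-x)) (solve 2 (λ x y → (y :- x) :+ x := y) refl x y)))

  infixl 6 _⊞_ _⊞≤_ _≤⊞_
  infixl 7 _⊠_ _⊠<_

  opaque
    _≤⊞_ : ∀ {x y} → 0# ≤ x → 0# < y → 0# < x + y
    _≤⊞_ {x} {y} 0≤x 0<y = ≤-<-trans 0≤x (0<⇒< 0<y (solve 2 (λ x y → y := (x :+ y) :- x) refl x y))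

    _⊞≤_ : ∀ {x y} → 0# < x → 0# ≤ y → 0# < x + y
    0<x ⊞≤ 0≤y = <-respʳ-≈ (+-comm _ _) (0≤y ≤⊞ 0<x)

    _⊞_ : ∀ {x y} → 0# ≤ x → 0# ≤ y → 0# ≤ x + y
    0≤x ⊞ inj₁ 0<y = inj₁ (0≤x ≤⊞ 0<y)
    _⊞_ {x} 0≤x (inj₂ 0≈y) = ≤-respʳ-≈ (trans (sym (+-identityʳ x)) (+-congˡ 0≈y)) 0≤x

    _⊠<_ : ∀ {x y} → 0# < x → 0# < y → 0# < x * y
    _⊠<_ = *-pos

    _⊠_ : ∀ {x y} → 0# ≤ x → 0# ≤ y → 0# ≤ x * y
    inj₁ 0<x ⊠ inj₁ 0<y = inj₁ (*-pos 0<x 0<y)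
    _⊠_ {x} _ (inj₂ 0≈y) = inj₂ (trans (sym (zeroʳ x)) (*-congˡ 0≈y))
    _⊠_ {y = y} (inj₂ 0≈x) _ = inj₂ (trans (sym (zeroˡ y)) (*-congʳ 0≈x))

    0≤1 : 0# ≤ 1#
    0≤1 = inj₁ 0<1

    0≤x² : ∀ x → 0# ≤ x * x
    0≤x² x with ≤-or-> 0# x
    ... | inj₁ 0≤x = 0≤x ⊠ 0≤x
    ... | inj₂ x<0 = ≤-respʳ-≈ (solve 1 (λ x → (:0 :- x) :* (:0 :- x) := x :* x) refl x)
                       (inj₁ (<⇒0<- x<0) ⊠ inj₁ (<⇒0<- x<0))

    x²≈0⇒x≈0 : ∀ {x} → x * x ≈ 0# → x ≈ 0#
    x²≈0⇒x≈0 {x} x²≈0 with compare x 0#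
    ... | tri≈ _ x≈0 _ = x≈0
    ... | tri> _ _ 0<x = ⊥-elim (>⇒≉ (*-pos 0<x 0<x) x²≈0)
    ... | tri< x<0 _ _ = ⊥-elim (>⇒≉ (*-pos (<⇒0<- x<0) (<⇒0<- x<0))
        (trans (solve 1 (λ x → (:0 :- x) :* (:0 :- x) := x :* x) refl x) x²≈0))

    x-y≈0⇒x≈y : ∀ {x y} → x - y ≈ 0# → x ≈ y
    x-y≈0⇒x≈y {x} {y} x-y≈0 = trans (solve 2 (λ x y → x := (x :- y) :+ y) refl x y)
      (trans (+-congʳ x-y≈0) (+-identityˡ y))

    ⁻¹-pos : ∀ {x} → 0# < x → 0# < x ⁻¹
    ⁻¹-pos {x} 0<x with ≤-or-> (x ⁻¹) 0#
    ... | inj₂ 0<x⁻¹ = 0<x⁻¹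
    ... | inj₁ x⁻¹≤0 = ⊥-elim (<⇒≱ 0<1 (0≤⇒≤ (inj₁ 0<x ⊠ ≤⇒0≤- x⁻¹≤0)
        (trans (solve 2 (λ x y → x :* (:0 :- y) := :0 :- x :* y) refl x (x ⁻¹))
          (+-congˡ (-‿cong (⁻¹-inverse x (>⇒≉ 0<x)))))))

    *-monoˡ-≤ : ∀ {x y z} → 0# ≤ z → x ≤ y → z * x ≤ z * y
    *-monoˡ-≤ {x} {y} {z} 0≤z x≤y = 0≤⇒≤ (0≤z ⊠ ≤⇒0≤- x≤y)
      (solve 3 (λ x y z → z :* (y :- x) := z :* y :- z :* x) refl x y z)

    *-monoˡ-< : ∀ {x y z} → 0# < z → x < y → z * x < z * y
    *-monoˡ-< {x} {y} {z} 0<z x<y = 0<⇒< (0<z ⊠< <⇒0<- x<y)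
      (solve 3 (λ x y z → z :* (y :- x) := z :* y :- z :* x) refl x y z)

    *-cancelˡ-< : ∀ {x y z} → 0# < z → z * x < z * y → x < y
    *-cancelˡ-< {x} {y} {z} 0<z zx<zy with ≤-or-> y x
    ... | inj₂ x<y = x<y
    ... | inj₁ y≤x = ⊥-elim (<⇒≱ zx<zy (*-monoˡ-≤ (inj₁ 0<z) y≤x))

    *-cancelˡ-≤ : ∀ {x y z} → 0# < z → z * x ≤ z * y → x ≤ y
    *-cancelˡ-≤ {x} {y} {z} 0<z zx≤zy with ≤-or-> x y
    ... | inj₁ x≤y = x≤y
    ... | inj₂ y<x = ⊥-elim (<⇒≱ (*-monoˡ-< 0<z y<x) zx≤zy)

    +-mono-≤ : ∀ {x y u v} → x ≤ y → u ≤ v → x + u ≤ y + v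
    +-mono-≤ {x} {y} {u} {v} x≤y u≤v = 0≤⇒≤ (≤⇒0≤- x≤y ⊞ ≤⇒0≤- u≤v)
      (solve 4 (λ x y u v → (y :- x) :+ (v :- u) := (y :+ v) :- (x :+ u)) refl x y u v)

    sq-cancel-< : ∀ {x y} → 0# ≤ y → x * x < y * y → x < y
    sq-cancel-< {x} {y} 0≤y x²<y² with ≤-or-> y x
    ... | inj₂ x<y = x<y
    ... | inj₁ y≤x = ⊥-elim (<⇒≱ x²<y² (0≤⇒≤ (≤⇒0≤- y≤x ⊠ (0≤y ⊞ 0≤y ⊞ ≤⇒0≤- y≤x))
        (solve 2 (λ x y → (x :- y) :* (y :+ y :+ (x :- y)) := x :* x :- y :* y) refl x y)))

  two : Carrier
  two = 1# + 1#

  opaque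
    0<two : 0# < two
    0<two = 0<1 ⊞≤ 0≤1

  half : Carrier
  half = two ⁻¹

  opaque
    half+half : half + half ≈ 1#
    half+half = trans (solve 1 (λ h → h :+ h := :2 :* h) refl half) (⁻¹-inverse two (>⇒≉ 0<two))

    0<half : 0# < half
    0<half = ⁻¹-pos 0<two

    halve : ∀ x → half * x + half * x ≈ x
    halve x = trans (sym (distribʳ x half half)) (trans (*-congʳ half+half) (*-identityˡ x))

    0<half* : ∀ {x} → 0# < x → 0# < half * x
    0<half* = *-pos 0<half

    half*< : ∀ {x} → 0# < x → half * x < x
    half*< {x} 0<x = 0<⇒< (0<half* 0<x)
      (trans (solve 1 (λ y → y := (y :+ y) :- y) refl (half * x)) (+-congʳ (halve x)))

-- Geometric convergence of sequences and series.

module Convergence (em : ExcludedMiddle 0ℓ) (R : RealField) where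
  open OrderedField R public renaming (Carrier to ℝ)
  open Reals em R public using (the; fromℕ; fromℤ; min; abs; Limit)
  open Exp semiring public using (_^_)

  opaque
    -- If the naturals were bounded, their supremum `s` would satisfy `n + 1 ≤ s` for all `n`, and
    -- `s - 1` would be a smaller bound.
    archimedean : ∀ x → ∃[ n ] x < fromℕ n
    archimedean x with em {∃[ n ] x < fromℕ n}
    ... | yes found = found
    ... | no none = ⊥-elim (absurd (supremum (λ t → ∃[ n ] t ≈ fromℕ n) (0# , 0 , refl) (x , bound)))
      where
      bound : UpperBound (λ t → ∃[ n ] t ≈ fromℕ n) x
      bound t (n , t≈n) = ≤-respˡ-≈ (sym t≈n) (≮⇒≥ λ x<n → none (n , x<n))
      absurd : ¬ (∃[ s ] UpperBound (λ t → ∃[ n ] t ≈ fromℕ n) s ×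
                  (∀ u → UpperBound (λ t → ∃[ n ] t ≈ fromℕ n) u → s ≤ u))
      absurd (s , s-bound , s-least) = <⇒≱ (0<⇒< 0<1 (solve 1 (λ s → :1 := s :- (s :- :1)) refl s))
        (s-least (s - 1#) λ t (n , t≈n) → ≤-respˡ-≈ (sym t≈n)
          (0≤⇒≤ (≤⇒0≤- (s-bound (fromℕ (suc n)) (suc n , refl)))
                (solve 2 (λ s n → s :- (:1 :+ n) := (s :- :1) :- n) refl s (fromℕ n))))

    0≤fromℕ : ∀ n → 0# ≤ fromℕ n
    0≤fromℕ zero    = ≤-refl
    0≤fromℕ (suc n) = 0≤1 ⊞ 0≤fromℕ n

    0<fromℕ-suc : ∀ n → 0# < fromℕ (suc n)
    0<fromℕ-suc n = 0<1 ⊞≤ 0≤fromℕ n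

    0<half^ : ∀ n → 0# < half ^ n
    0<half^ zero    = 0<1
    0<half^ (suc n) = 0<half ⊠< 0<half^ n

    half^≤1 : ∀ n → half ^ n ≤ 1#
    half^≤1 zero    = ≤-refl
    half^≤1 (suc n) = ≤-trans (<⇒≤ (half*< (0<half^ n))) (half^≤1 n)

    -- Half of `half ^ n ≤ 1` plus half of the induction hypothesis is the next case. Together with
    -- `archimedean` this makes `half ^ n` arbitrarily small without logarithms.
    n*half^n≤1 : ∀ n → fromℕ n * half ^ n ≤ 1#
    n*half^n≤1 zero    = 0≤⇒≤ 0≤1 (solve 1 (λ h → :1 := :1 :- :0 :* h) refl 1#)
    n*half^n≤1 (suc n) = 0≤⇒≤
      ((<⇒≤ 0<half ⊠ ≤⇒0≤- (half^≤1 n)) ⊞ (<⇒≤ 0<half ⊠ ≤⇒0≤- (n*half^n≤1 n)))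
      (trans (solve 3 (λ h p n → h :* (:1 :- p) :+ h :* (:1 :- n :* p) := (h :+ h) :- (:1 :+ n) :* (h :* p))
               refl half (half ^ n) (fromℕ n))
             (+-congʳ half+half))

    -- If `x` were positive, some `n` would exceed `C / x`, and then `C < x n ≤ C n half ^ n ≤ C`.
    squeeze : ∀ {x C} → (∀ n → x ≤ C * half ^ n) → x ≤ 0#
    squeeze {x} {C} x≤ with ≤-or-> x 0#
    ... | inj₁ x≤0 = x≤0
    ... | inj₂ 0<x with archimedean (C * x ⁻¹)
    ...   | n , C/x<n = ⊥-elim (<⇒≱ C<xn xn≤C)
      where
      0<C : 0# < C
      0<C = <-≤-trans 0<x (≤-respʳ-≈ (*-identityʳ C) (x≤ 0))
      C<xn : C < x * fromℕ n
      C<xn = <-respˡ-≈ (trans (solve 3 (λ x C y → x :* (C :* y) := C :* (x :* y)) refl x C (x ⁻¹))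
          (trans (*-congˡ (⁻¹-inverse x (>⇒≉ 0<x))) (*-identityʳ C))) (*-monoˡ-< 0<x C/x<n)
      xn≤C : x * fromℕ n ≤ C
      xn≤C = 0≤⇒≤ ((≤⇒0≤- (x≤ n) ⊠ 0≤fromℕ n) ⊞ (<⇒≤ 0<C ⊠ ≤⇒0≤- (n*half^n≤1 n)))
        (solve 4 (λ x C n h → (C :* h :- x) :* n :+ C :* (:1 :- n :* h) := C :- x :* n)
          refl x C (fromℕ n) (half ^ n))

  infix 4 ∣_∣≤_
  -- Two bounds instead of `abs`, whose definition by cases would have to be split in every
  -- estimate.
  ∣_∣≤_ : ℝ → ℝ → Set
  ∣ z ∣≤ b = - b ≤ z × z ≤ b

  opaque
    ∣∣-cong : ∀ {z z′ b b′} → z ≈ z′ → b ≈ b′ → ∣ z ∣≤ b → ∣ z′ ∣≤ b′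
    ∣∣-cong z≈ b≈ (l , u) = ≤-respˡ-≈ (-‿cong b≈) (≤-respʳ-≈ z≈ l) , ≤-respˡ-≈ z≈ (≤-respʳ-≈ b≈ u)

    ∣∣-≤ : ∀ {z b c} → b ≤ c → ∣ z ∣≤ b → ∣ z ∣≤ c
    ∣∣-≤ {b = b} {c} b≤c (l , u) =
      ≤-trans (0≤⇒≤ (≤⇒0≤- b≤c) (solve 2 (λ b c → c :- b := :- b :- :- c) refl b c)) l , ≤-trans u b≤c

    ∣∣⇒0≤ : ∀ {z b} → ∣ z ∣≤ b → 0# ≤ b
    ∣∣⇒0≤ {z} {b} (l , u) = *-cancelˡ-≤ 0<two (0≤⇒≤ (≤⇒0≤- l ⊞ ≤⇒0≤- u)
      (solve 2 (λ z b → (z :- :- b) :+ (b :- z) := :2 :* b :- :2 :* :0) refl z b))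

    ∣∣-+ : ∀ {z w b c} → ∣ z ∣≤ b → ∣ w ∣≤ c → ∣ z + w ∣≤ b + c
    ∣∣-+ {b = b} {c} (l , u) (l′ , u′) =
      ≤-respˡ-≈ (solve 2 (λ b c → :- b :+ :- c := :- (b :+ c)) refl b c) (+-mono-≤ l l′) , +-mono-≤ u u′

    ∣∣-neg : ∀ {z b} → ∣ z ∣≤ b → ∣ - z ∣≤ b
    ∣∣-neg {z} {b} (l , u) =
      0≤⇒≤ (≤⇒0≤- u) (solve 2 (λ z b → b :- z := :- z :- :- b) refl z b) ,
      0≤⇒≤ (≤⇒0≤- l) (solve 2 (λ z b → z :- :- b := b :- :- z) refl z b)

    -- In `(b - z) (c - w) + (b + z) (c + w)` and `(b - z) (c + w) + (b + z) (c - w)` the mixed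
    -- terms cancel, which leaves `2 (b c + z w)` and `2 (b c - z w)`.
    ∣∣-* : ∀ {z w b c} → ∣ z ∣≤ b → ∣ w ∣≤ c → ∣ z * w ∣≤ b * c
    ∣∣-* {z} {w} {b} {c} (l , u) (l′ , u′) =
      *-cancelˡ-≤ 0<two (0≤⇒≤ ((≤⇒0≤- u ⊠ ≤⇒0≤- u′) ⊞ (≤⇒0≤- l ⊠ ≤⇒0≤- l′))
        (solve 4 (λ z w b c → (b :- z) :* (c :- w) :+ (z :- :- b) :* (w :- :- c) :=
          :2 :* (z :* w) :- :2 :* :- (b :* c)) refl z w b c)) ,
      *-cancelˡ-≤ 0<two (0≤⇒≤ ((≤⇒0≤- u ⊠ ≤⇒0≤- l′) ⊞ (≤⇒0≤- l ⊠ ≤⇒0≤- u′))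
        (solve 4 (λ z w b c → (b :- z) :* (w :- :- c) :+ (z :- :- b) :* (c :- w) :=
          :2 :* (b :* c) :- :2 :* (z :* w)) refl z w b c))

    0≤⇒∣∣ : ∀ {z b} → 0# ≤ z → z ≤ b → ∣ z ∣≤ b
    0≤⇒∣∣ {z} {b} 0≤z z≤b = 0≤⇒≤ (0≤z ⊞ ≤-trans 0≤z z≤b) (solve 2 (λ z b → z :+ b := z :- :- b) refl z b) , z≤b

    ∣0∣≤ : ∀ {b} → 0# ≤ b → ∣ 0# ∣≤ b
    ∣0∣≤ = 0≤⇒∣∣ ≤-refl

    ∣∣-bounded : ∀ z → ∃[ b ] ∣ z ∣≤ b
    ∣∣-bounded z with ≤-or-> 0# z
    ... | inj₁ 0≤z = z , 0≤⇒∣∣ 0≤z ≤-refl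
    ... | inj₂ z<0 = - z , ∣∣-cong (solve 1 (λ z → :- :- z := z) refl z) refl (∣∣-neg
          (0≤⇒∣∣ (≤-respʳ-≈ (+-identityˡ (- z)) (≤⇒0≤- (<⇒≤ z<0))) ≤-refl))

  infix 4 _⇝_
  -- Convergence at a geometric rate. The cosine series has such a rate, and explicit constants
  -- combine under sums and products without any choice of thresholds.
  _⇝_ : (ℕ → ℝ) → ℝ → Set
  a ⇝ l = ∃[ C ] (∀ n → ∣ a n - l ∣≤ C * half ^ n)

  opaque
    ∣∣-squeeze : ∀ {z C} → (∀ n → ∣ z ∣≤ C * half ^ n) → z ≈ 0#
    ∣∣-squeeze {z} bound = ≤-antisym (squeeze (λ n → proj₂ (bound n)))
      (0≤⇒≤ (≤⇒0≤- (squeeze (λ n → proj₂ (∣∣-neg (bound n))))) (solve 1 (λ z → :0 :- :- z := z :- :0) refl z))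

    ⇝-unique : ∀ {a l m} → a ⇝ l → a ⇝ m → l ≈ m
    ⇝-unique {a} {l} {m} (C , a→l) (D , a→m) = x-y≈0⇒x≈y (∣∣-squeeze λ n →
      ∣∣-cong (solve 3 (λ a l m → (:- (a :- l)) :+ (a :- m) := l :- m) refl (a n) l m)
              (sym (distribʳ (half ^ n) C D)) (∣∣-+ (∣∣-neg (a→l n)) (a→m n)))

    ⇝-cong : ∀ {a b l m} → (∀ n → a n ≈ b n) → l ≈ m → a ⇝ l → b ⇝ m
    ⇝-cong a≈b l≈m (C , a→l) = C , λ n → ∣∣-cong (+-cong (a≈b n) (-‿cong l≈m)) refl (a→l n)

    ⇝-const : ∀ {l} → (λ _ → l) ⇝ l
    ⇝-const {l} = 1# , λ n → ∣∣-cong (sym (-‿inverseʳ l)) refl (∣0∣≤ (0≤1 ⊠ <⇒≤ (0<half^ n)))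

    ⇝-+ : ∀ {a b l m} → a ⇝ l → b ⇝ m → (λ n → a n + b n) ⇝ l + m
    ⇝-+ {a} {b} {l} {m} (C , a→l) (D , b→m) = C + D , λ n →
      ∣∣-cong (solve 4 (λ a b l m → (a :- l) :+ (b :- m) := (a :+ b) :- (l :+ m)) refl (a n) (b n) l m)
              (sym (distribʳ (half ^ n) C D)) (∣∣-+ (a→l n) (b→m n))

    ⇝-neg : ∀ {a l} → a ⇝ l → (λ n → - a n) ⇝ - l
    ⇝-neg {a} {l} (C , a→l) = C , λ n →
      ∣∣-cong (solve 2 (λ a l → :- (a :- l) := :- a :- :- l) refl (a n) l) refl (∣∣-neg (a→l n))

    ⇝-*ʳ : ∀ {a l} m → a ⇝ l → (λ n → a n * m) ⇝ l * m
    ⇝-*ʳ {a} {l} m (C , a→l) with ∣∣-bounded m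
    ... | b , ∣m∣≤b = C * b , λ n →
      ∣∣-cong (solve 3 (λ a l m → (a :- l) :* m := a :* m :- l :* m) refl (a n) l m)
              (solve 3 (λ C b h → (C :* h) :* b := (C :* b) :* h) refl C b (half ^ n)) (∣∣-* (a→l n) ∣m∣≤b)

    half^-suc-≤ : ∀ n → half ^ suc n ≤ half ^ n
    half^-suc-≤ n = <⇒≤ (half*< (0<half^ n))

    ⇝-suc : ∀ {a l} → a ⇝ l → (λ n → a (suc n)) ⇝ l
    ⇝-suc (C , a→l) = C , λ n → ∣∣-≤ (*-monoˡ-≤ (0≤C (a→l 0)) (half^-suc-≤ n)) (a→l (suc n))
      where
      0≤C : ∀ {z} → ∣ z ∣≤ C * 1# → 0# ≤ C
      0≤C bound = ≤-respʳ-≈ (*-identityʳ C) (∣∣⇒0≤ bound)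

  Σ< : ℕ → (ℕ → ℝ) → ℝ
  Σ< zero    f = 0#
  Σ< (suc n) f = f 0 + Σ< n (λ i → f (suc i))

  opaque
    Σ<-cong : ∀ n {f g} → (∀ i → f i ≈ g i) → Σ< n f ≈ Σ< n g
    Σ<-cong zero    f≈g = refl
    Σ<-cong (suc n) f≈g = +-cong (f≈g 0) (Σ<-cong n (λ i → f≈g (suc i)))

    Σ<-last : ∀ n f → Σ< (suc n) f ≈ Σ< n f + f n
    Σ<-last zero    f = +-comm _ _
    Σ<-last (suc n) f = trans (+-congˡ (Σ<-last n (λ i → f (suc i)))) (sym (+-assoc _ _ _))

    Σ<-+ : ∀ n f g → Σ< n (λ i → f i + g i) ≈ Σ< n f + Σ< n g
    Σ<-+ zero    f g = sym (+-identityˡ 0#)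
    Σ<-+ (suc n) f g = trans (+-congˡ (Σ<-+ n _ _))
      (solve 4 (λ a b c d → (a :+ b) :+ (c :+ d) := (a :+ c) :+ (b :+ d)) refl (f 0) (g 0) _ _)

    Σ<-* : ∀ n c f → Σ< n (λ i → c * f i) ≈ c * Σ< n f
    Σ<-* zero    c f = sym (zeroʳ c)
    Σ<-* (suc n) c f = trans (+-congˡ (Σ<-* n c _)) (sym (distribˡ c _ _))

    ⇝-tail : ∀ {f l} → (λ n → Σ< n f) ⇝ l → (λ n → Σ< n (λ i → f (suc i))) ⇝ l - f 0
    ⇝-tail {f} f→l = ⇝-cong (λ n → solve 2 (λ a s → (a :+ s) :- a := s) refl (f 0) _) refl
      (⇝-+ (⇝-suc f→l) ⇝-const)

  -- The intervals [aₙ - 2Khⁿ, aₙ + 2Khⁿ] are nested, and their lower ends have a supremum.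
  module _ {h : ℝ} {f : ℕ → ℝ} {K : ℝ} (0≤h : 0# ≤ h) (h≤half : h ≤ half)
           (f-bound : ∀ i → ∣ f i ∣≤ K * h ^ i) where

    private
      0≤h^ : ∀ n → 0# ≤ h ^ n
      0≤h^ zero    = 0≤1
      0≤h^ (suc n) = 0≤h ⊠ 0≤h^ n

      0≤K : 0# ≤ K
      0≤K = ≤-respʳ-≈ (*-identityʳ K) (∣∣⇒0≤ (f-bound 0))

      lower upper : ℕ → ℝ
      lower n = Σ< n f - two * (K * h ^ n)
      upper n = Σ< n f + two * (K * h ^ n)

      0≤1-2h : 0# ≤ 1# - two * h
      0≤1-2h = ≤⇒0≤- (≤-respʳ-≈ (⁻¹-inverse two (>⇒≉ 0<two)) (*-monoˡ-≤ (<⇒≤ 0<two) h≤half))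

      -- From `n` to `n + 1` the radius shrinks by `2 K hⁿ (1 - h)`, that is, by
      -- `K hⁿ + K hⁿ (1 - 2 h)`. This is at least the size of the added term.
      lower-suc : ∀ n → lower n ≤ lower (suc n)
      lower-suc n = 0≤⇒≤ (≤⇒0≤- (proj₁ (f-bound n)) ⊞ (0≤K ⊠ 0≤h^ n) ⊠ 0≤1-2h)
        (trans (solve 5 (λ s x K h p → (x :- :- (K :* p)) :+ (K :* p) :* (:1 :- :2 :* h) :=
            ((s :+ x) :- :2 :* (K :* (h :* p))) :- (s :- :2 :* (K :* p)))
            refl (Σ< n f) (f n) K h (h ^ n))
          (+-congʳ (+-congʳ (sym (Σ<-last n f)))))

      upper-suc : ∀ n → upper (suc n) ≤ upper n
      upper-suc n = 0≤⇒≤ (≤⇒0≤- (proj₂ (f-bound n)) ⊞ (0≤K ⊠ 0≤h^ n) ⊠ 0≤1-2h)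
        (trans (solve 5 (λ s x K h p → ((K :* p) :- x) :+ (K :* p) :* (:1 :- :2 :* h) :=
            (s :+ :2 :* (K :* p)) :- ((s :+ x) :+ :2 :* (K :* (h :* p))))
            refl (Σ< n f) (f n) K h (h ^ n))
          (+-congˡ (-‿cong (+-congʳ (sym (Σ<-last n f))))))

      lower-+ : ∀ n k → lower n ≤ lower (k ℕ.+ n)
      lower-+ n zero    = ≤-refl
      lower-+ n (suc k) = ≤-trans (lower-+ n k) (lower-suc (k ℕ.+ n))

      upper-+ : ∀ n k → upper (k ℕ.+ n) ≤ upper n
      upper-+ n zero    = ≤-refl
      upper-+ n (suc k) = ≤-trans (upper-suc (k ℕ.+ n)) (upper-+ n k)

      lower≤upper : ∀ n → lower n ≤ upper n
      lower≤upper n = 0≤⇒≤ (<⇒≤ 0<two ⊠ (<⇒≤ 0<two ⊠ (0≤K ⊠ 0≤h^ n)))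
        (solve 2 (λ s b → :2 :* (:2 :* b) :=
          (s :+ :2 :* b) :- (s :- :2 :* b)) refl (Σ< n f) (K * h ^ n))

      lower≤upper′ : ∀ m n → lower m ≤ upper n
      lower≤upper′ m n = ≤-trans (lower-+ m n) (≤-trans (lower≤upper (n ℕ.+ m))
        (≤-respˡ-≈ (reflexive (≡.cong upper (ℕ.+-comm m n))) (upper-+ n m)))

    series : ∃[ l ] (∀ n → ∣ Σ< n f - l ∣≤ two * (K * h ^ n))
    series with supremum (λ t → ∃[ n ] t ≈ lower n) (lower 0 , 0 , refl)
                  (upper 0 , λ { t (n , t≈) → ≤-respˡ-≈ (sym t≈) (lower≤upper′ n 0) })
    ... | l , l-bound , l-least = l , λ n →
      0≤⇒≤ (≤⇒0≤- (l-least (upper n) λ { t (m , t≈) → ≤-respˡ-≈ (sym t≈) (lower≤upper′ m n) }))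
        (solve 3 (λ s b l → (s :+ b) :- l := (s :- l) :- :- b) refl (Σ< n f) _ l) ,
      0≤⇒≤ (≤⇒0≤- (l-bound (lower n) (n , refl)))
        (solve 3 (λ s b l → l :- (s :- b) := b :- (s :- l)) refl (Σ< n f) _ l)

-- Cauchy products and the addition law of the cosine coefficients.

module CosineSeries (em : ExcludedMiddle 0ℓ) (R : RealField) where
  open Convergence em R public
  open Reals em R public using (cosPartial; cos)
  open SetoidReasoning setoid

  opaque
    the-satisfies : (P : Pred ℝ 0ℓ) → ∃ P → P (the P)
    the-satisfies P ∃P with em {∃ P}
    ... | yes (_ , p) = p
    ... | no ¬∃P      = ⊥-elim (¬∃P ∃P)

    fromℕ-mono : ∀ {m n} → m ℕ.≤ n → fromℕ m ≤ fromℕ n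
    fromℕ-mono {n = n} ℕ.z≤n = 0≤fromℕ n
    fromℕ-mono (ℕ.s≤s m≤n)   = +-mono-≤ ≤-refl (fromℕ-mono m≤n)

    half^-small : ∀ B {ε} → 0# < ε → ∃[ N ] (∀ n → N ℕ.≤ n → B * half ^ n < ε)
    half^-small B {ε} 0<ε with archimedean (B * ε ⁻¹)
    ... | N , B/ε<N = N , λ n N≤n → <-≤-trans
      (0<⇒< (<⇒0<- B<εN ⊠< 0<half^ n)
        (solve 3 (λ B εN h → (εN :- B) :* h := εN :* h :- B :* h) refl B (ε * fromℕ N) (half ^ n)))
      (≤-trans
        (0≤⇒≤ ((<⇒≤ 0<ε ⊠ <⇒≤ (0<half^ n)) ⊠ ≤⇒0≤- (fromℕ-mono N≤n))
          (solve 4 (λ ε h N n → (ε :* h) :* (n :- N) := (ε :* (n :* h)) :- (ε :* N) :* h)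
            refl ε (half ^ n) (fromℕ N) (fromℕ n)))
        (≤-respʳ-≈ (*-identityʳ ε) (*-monoˡ-≤ (<⇒≤ 0<ε) (n*half^n≤1 n))))
      where
      B<εN : B < ε * fromℕ N
      B<εN = <-respˡ-≈ (trans (solve 3 (λ x C y → x :* (C :* y) := C :* (x :* y)) refl ε B (ε ⁻¹))
        (trans (*-congˡ (⁻¹-inverse ε (>⇒≉ 0<ε))) (*-identityʳ B))) (*-monoˡ-< 0<ε B/ε<N)

    ∣∣⇒abs< : ∀ {z b ε} → ∣ z ∣≤ b → b < ε → abs z < ε
    ∣∣⇒abs< {z} ∣z∣≤b b<ε with z <? 0#
    ... | yes _ = ≤-<-trans (proj₂ (∣∣-neg ∣z∣≤b)) b<ε
    ... | no _  = ≤-<-trans (proj₂ ∣z∣≤b) b<ε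

    abs<⇒∣∣ : ∀ {z ε} → abs z < ε → ∣ z ∣≤ ε
    abs<⇒∣∣ {z} abs<ε with z <? 0#
    ... | yes z<0 = ∣∣-cong (solve 1 (λ z → :- :- z := z) refl z) refl (∣∣-neg
          (0≤⇒∣∣ (≤-respʳ-≈ (+-identityˡ (- z)) (≤⇒0≤- (<⇒≤ z<0))) (<⇒≤ abs<ε)))
    ... | no z≮0  = 0≤⇒∣∣ (≮⇒≥ z≮0) (<⇒≤ abs<ε)

    Limit-unique : ∀ {s l m} → Limit s l → Limit s m → l ≈ m
    Limit-unique {s} {l} {m} s→l s→m = x-y≈0⇒x≈y (∣∣-squeeze bound)
      where
      bound : ∀ n → ∣ l - m ∣≤ two * half ^ n
      bound n with s→l (half ^ n) (0<half^ n) | s→m (half ^ n) (0<half^ n)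
      ... | N , s→l′ | M , s→m′ = ∣∣-cong
        (solve 3 (λ s l m → :- (s :- l) :+ (s :- m) := l :- m) refl (s (N ℕ.⊔ M)) l m)
        (solve 1 (λ h → h :+ h := :2 :* h) refl (half ^ n))
        (∣∣-+ (∣∣-neg (abs<⇒∣∣ (s→l′ (N ℕ.⊔ M) (ℕ.m≤m⊔n N M)))) (abs<⇒∣∣ (s→m′ (N ℕ.⊔ M) (ℕ.m≤n⊔m N M))))

  -- The Cauchy product of two series with terms of order `quarter ^ n` has an error of order
  -- `n quarter ^ n`, and this is still at most `half ^ n`.
  quarter : ℝ
  quarter = half * half

  opaque
    0<quarter : 0# < quarter
    0<quarter = 0<half ⊠< 0<half

    quarter≤half : quarter ≤ half
    quarter≤half = <⇒≤ (half*< 0<half)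

    quarter^ : ∀ n → quarter ^ n ≈ half ^ n * half ^ n
    quarter^ zero    = sym (*-identityˡ 1#)
    quarter^ (suc n) = trans (*-congˡ (quarter^ n))
      (solve 2 (λ h p → (h :* h) :* (p :* p) := (h :* p) :* (h :* p)) refl half (half ^ n))

    0<quarter^ : ∀ n → 0# < quarter ^ n
    0<quarter^ n = <-respʳ-≈ (sym (quarter^ n)) (0<half^ n ⊠< 0<half^ n)

    quarter^≤half^ : ∀ n → quarter ^ n ≤ half ^ n
    quarter^≤half^ n = ≤-respˡ-≈ (sym (quarter^ n))
      (≤-respʳ-≈ (*-identityʳ _) (*-monoˡ-≤ (<⇒≤ (0<half^ n)) (half^≤1 n)))

    n*quarter^n≤half^n : ∀ n → fromℕ n * quarter ^ n ≤ half ^ n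
    n*quarter^n≤half^n n = 0≤⇒≤ (<⇒≤ (0<half^ n) ⊠ ≤⇒0≤- (n*half^n≤1 n))
      (trans (solve 2 (λ h n → h :* (:1 :- n :* h) := h :- n :* (h :* h)) refl (half ^ n) (fromℕ n))
        (+-congˡ (-‿cong (*-congˡ (sym (quarter^ n))))))

  -- Cauchy products

  private
    variable
      u u′ v v′ : ℕ → ℝ

  conv : (ℕ → ℝ) → (ℕ → ℝ) → ℕ → ℝ
  conv u v zero    = u 0 * v 0
  conv u v (suc m) = u 0 * v (suc m) + conv (u ∘ suc) v m

  opaque
    conv-cong : ∀ m → (∀ i → u i ≈ u′ i) → (∀ i → v i ≈ v′ i) → conv u v m ≈ conv u′ v′ m
    conv-cong zero    u≈ v≈ = *-cong (u≈ 0) (v≈ 0)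
    conv-cong (suc m) u≈ v≈ = +-cong (*-cong (u≈ 0) (v≈ (suc m))) (conv-cong m (u≈ ∘ suc) v≈)

    conv-+ˡ : ∀ m → conv (λ i → u i + u′ i) v m ≈ conv u v m + conv u′ v m
    conv-+ˡ zero    = distribʳ _ _ _
    conv-+ˡ {u} {u′} {v} (suc m) = trans (+-congˡ (conv-+ˡ m))
      (solve 5 (λ a b c x y → (a :+ b) :* c :+ (x :+ y) := (a :* c :+ x) :+ (b :* c :+ y)) refl
        (u 0) (u′ 0) (v (suc m)) _ _)

    conv-*ˡ : ∀ c m → conv (λ i → c * u i) v m ≈ c * conv u v m
    conv-*ˡ c zero    = *-assoc _ _ _
    conv-*ˡ {u} {v} c (suc m) = trans (+-congˡ (conv-*ˡ c m))
      (solve 4 (λ c a b x → (c :* a) :* b :+ c :* x := c :* (a :* b :+ x)) refl c (u 0) (v (suc m)) _)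

    conv-*ʳ : ∀ c m → conv u (λ i → c * v i) m ≈ c * conv u v m
    conv-*ʳ {u} {v} c zero = solve 3 (λ c a b → a :* (c :* b) := c :* (a :* b)) refl c (u 0) (v 0)
    conv-*ʳ {u} {v} c (suc m) = trans (+-congˡ (conv-*ʳ c m))
      (solve 4 (λ c a b x → a :* (c :* b) :+ c :* x := c :* (a :* b :+ x)) refl c (u 0) (v (suc m)) _)

    -- The term that vanishes is the last one, `u (suc m) * v 0`.
    conv-suc : ∀ m → v 0 ≈ 0# → conv u v (suc m) ≈ conv u (v ∘ suc) m
    conv-suc {v} {u} zero    v0≈0 = trans (+-congˡ (trans (*-congˡ v0≈0) (zeroʳ _))) (+-identityʳ _)
    conv-suc {v} {u} (suc m) v0≈0 = +-congˡ (conv-suc {v} {u ∘ suc} m v0≈0)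

  -- The operator on coefficients corresponding to t d/dt on power series.
  number : (ℕ → ℝ) → ℕ → ℝ
  number u i = fromℕ i * u i

  opaque
    -- The Leibniz rule: the weight `m` of a product `u i * v j` with `i + j = m` splits as `i + j`.
    conv-number : ∀ m → fromℕ m * conv u v m ≈ conv (number u) v m + conv u (number v) m
    conv-number {u} {v} zero =
      solve 2 (λ a b → :0 :* (a :* b) := (:0 :* a) :* b :+ a :* (:0 :* b)) refl (u 0) (v 0)
    conv-number {u} {v} (suc m) = begin
      (1# + fromℕ m) * (u 0 * v (suc m) + conv u⁺ v m)
        ≈⟨ solve 4 (λ n a b c → (:1 :+ n) :* (a :* b :+ c) :=
             ((:0 :* a) :* b :+ a :* ((:1 :+ n) :* b)) :+ (c :+ n :* c)) refl (fromℕ m) (u 0) (v (suc m)) _ ⟩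
      ((0# * u 0) * v (suc m) + u 0 * ((1# + fromℕ m) * v (suc m))) + (conv u⁺ v m + fromℕ m * conv u⁺ v m)
        ≈⟨ +-congˡ (+-congˡ (conv-number {u = u⁺} {v} m)) ⟩
      ((0# * u 0) * v (suc m) + u 0 * ((1# + fromℕ m) * v (suc m)))
        + (conv u⁺ v m + (conv (number u⁺) v m + conv u⁺ (number v) m))
        ≈⟨ solve 5 (λ a b c d e → (a :+ b) :+ (c :+ (d :+ e)) := (a :+ (c :+ d)) :+ (b :+ e)) refl _ _ _ _ _ ⟩
      ((0# * u 0) * v (suc m) + (conv u⁺ v m + conv (number u⁺) v m))
        + (u 0 * ((1# + fromℕ m) * v (suc m)) + conv u⁺ (number v) m)
        ≈⟨ +-congʳ (+-congˡ (trans (sym (conv-+ˡ m)) (conv-cong m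
             (λ i → solve 2 (λ n a → a :+ n :* a := (:1 :+ n) :* a) refl (fromℕ i) (u⁺ i)) (λ _ → refl)))) ⟩
      conv (number u) v (suc m) + conv u (number v) (suc m)  ∎
      where
      u⁺ : ℕ → ℝ
      u⁺ = u ∘ suc

    Σ<-conv : ∀ n → Σ< (suc n) (conv u v) ≈ u 0 * Σ< (suc n) v + Σ< n (conv (u ∘ suc) v)
    Σ<-conv {u} {v} n = begin
      u 0 * v 0 + Σ< n (λ m → u 0 * v (suc m) + conv (u ∘ suc) v m)
        ≈⟨ +-congˡ (trans (Σ<-+ n _ _) (+-congʳ (Σ<-* n (u 0) _))) ⟩
      u 0 * v 0 + (u 0 * Σ< n (v ∘ suc) + Σ< n (conv (u ∘ suc) v))
        ≈⟨ solve 4 (λ a b c d → a :* b :+ (a :* c :+ d) := a :* (b :+ c) :+ d) refl (u 0) (v 0) _ _ ⟩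
      u 0 * Σ< (suc n) v + Σ< n (conv (u ∘ suc) v)  ∎

    -- The difference is the sum over `i < n` of `u i` times the remainder of the series of `v`
    -- after `n - i` terms. Each of these `n` products is at most `K quarter ^ i` times
    -- `B quarter ^ (n - i)`.
    conv-error : ∀ n {u v s K B} → (∀ i → ∣ u i ∣≤ K * quarter ^ i) →
      (∀ k → ∣ Σ< k v - s ∣≤ B * quarter ^ k) →
      ∣ Σ< n u * s - Σ< n (conv u v) ∣≤ (K * B) * (fromℕ n * quarter ^ n)
    conv-error zero {s = s} {K} {B} u≤ v≤ =
      ∣∣-cong (solve 1 (λ s → :0 := :0 :* s :- :0) refl s)
              (solve 2 (λ K B → :0 := (K :* B) :* (:0 :* :1)) refl K B) (∣0∣≤ ≤-refl)
    conv-error (suc n) {u} {v} {s} {K} {B} u≤ v≤ = ∣∣-cong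
      (begin
        u 0 * - (Σ< (suc n) v - s) + (Σ< n u⁺ * s - Σ< n (conv u⁺ v))
          ≈⟨ solve 5 (λ a w s t c → a :* :- (w :- s) :+ (t :* s :- c) := (a :+ t) :* s :- (a :* w :+ c)) refl
               (u 0) _ s _ _ ⟩
        (u 0 + Σ< n u⁺) * s - (u 0 * Σ< (suc n) v + Σ< n (conv u⁺ v))
          ≈⟨ +-congˡ (-‿cong (Σ<-conv {u} {v} n)) ⟨
        Σ< (suc n) u * s - Σ< (suc n) (conv u v)  ∎)
      (solve 5 (λ K B q p n → (K :* :1) :* (B :* (q :* p)) :+ ((K :* q) :* B) :* (n :* p) :=
         (K :* B) :* ((:1 :+ n) :* (q :* p))) refl K B quarter (quarter ^ n) (fromℕ n))
      (∣∣-+ (∣∣-* (u≤ 0) (∣∣-neg (v≤ (suc n))))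
            (conv-error n (λ i → ∣∣-cong refl (sym (*-assoc K quarter (quarter ^ i))) (u≤ (suc i))) v≤))
      where
      u⁺ : ℕ → ℝ
      u⁺ = u ∘ suc

    conv-⇝ : ∀ {u v s t K B} → (∀ i → ∣ u i ∣≤ K * quarter ^ i) →
      (λ n → Σ< n u) ⇝ s → (∀ k → ∣ Σ< k v - t ∣≤ B * quarter ^ k) →
      (λ n → Σ< n (conv u v)) ⇝ s * t
    conv-⇝ {u} {v} {s} {t} {K} {B} u≤ u→s v≤ = ⇝-cong
      (λ n → solve 2 (λ a b → a :- (a :- b) := b) refl (Σ< n u * t) (Σ< n (conv u v)))
      (solve 1 (λ a → a :- :0 := a) refl (s * t))
      (⇝-+ (⇝-*ʳ t u→s) (⇝-neg (K * B , λ n → ∣∣-cong (solve 1 (λ a → a := a :- :0) refl _) refl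
        (∣∣-≤ (*-monoˡ-≤ 0≤KB (n*quarter^n≤half^n n)) (conv-error n u≤ v≤)))))
      where
      0≤KB : 0# ≤ K * B
      0≤KB = ≤-respʳ-≈ (*-identityʳ K) (∣∣⇒0≤ (u≤ 0)) ⊠ ≤-respʳ-≈ (*-identityʳ B) (∣∣⇒0≤ (v≤ 0))

  -- Divided powers and the cosine series

  e : ℝ → ℕ → ℝ
  e x zero    = 1#
  e x (suc n) = e x n * x * fromℕ (suc n) ⁻¹

  opaque
    suc-inverse : ∀ n → fromℕ (suc n) * fromℕ (suc n) ⁻¹ ≈ 1#
    suc-inverse n = ⁻¹-inverse _ (>⇒≉ (0<fromℕ-suc n))

    e-suc : ∀ x n → fromℕ (suc n) * e x (suc n) ≈ x * e x n
    e-suc x n = trans (solve 4 (λ s e x i → s :* (e :* x :* i) := (x :* e) :* (s :* i))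
        refl (fromℕ (suc n)) (e x n) x (fromℕ (suc n) ⁻¹))
      (trans (*-congˡ (suc-inverse n)) (*-identityʳ _))

    e-unique : ∀ {x n y} → fromℕ (suc n) * y ≈ x * e x n → y ≈ e x (suc n)
    e-unique {x} {n} {y} eq = trans (trans (sym (*-identityʳ y)) (*-congˡ (sym (suc-inverse n))))
      (trans (solve 3 (λ y s i → y :* (s :* i) := (s :* y) :* i) refl y _ _)
        (*-congʳ (trans eq (*-comm _ _))))

    e-cong : ∀ {x y} → x ≈ y → ∀ n → e x n ≈ e y n
    e-cong x≈y zero    = refl
    e-cong x≈y (suc n) = *-congʳ (*-cong (e-cong x≈y n) x≈y)

    -- The binomial theorem without binomial coefficients: by the Leibniz rule both sides satisfy
    -- `(m + 1) c (m + 1) = (x + y) c m`, the recursion that determines `e (x + y)`.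
    e-+ : ∀ x y m → conv (e x) (e y) m ≈ e (x + y) m
    e-+ x y zero    = *-identityˡ 1#
    e-+ x y (suc m) = e-unique {n = m} (begin
      fromℕ (suc m) * conv (e x) (e y) (suc m)
        ≈⟨ conv-number {e x} {e y} (suc m) ⟩
      conv (number (e x)) (e y) (suc m) + conv (e x) (number (e y)) (suc m)
        ≈⟨ +-cong (trans (+-congʳ (solve 2 (λ a b → (:0 :* a) :* b :=
              :0) refl 1# (e y (suc m)))) (+-identityˡ _))
                  (conv-suc {number (e y)} m (zeroˡ _)) ⟩
      conv (number (e x) ∘ suc) (e y) m + conv (e x) (number (e y) ∘ suc) m
        ≈⟨ +-cong (trans (conv-cong m (e-suc x) (λ _ → refl)) (conv-*ˡ x m))
                  (trans (conv-cong m (λ _ → refl) (e-suc y)) (conv-*ʳ y m)) ⟩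
      x * conv (e x) (e y) m + y * conv (e x) (e y) m
        ≈⟨ distribʳ _ x y ⟨
      (x + y) * conv (e x) (e y) m
        ≈⟨ *-congˡ (e-+ x y m) ⟩
      (x + y) * e (x + y) m  ∎)

  -- cos x = Σ κ m xᵐ/m! and σ m = (-1)ᵐ.
  σ κ : ℕ → ℝ
  σ zero    = 1#
  σ (suc m) = - σ m
  κ zero          = 1#
  κ (suc zero)    = 0#
  κ (suc (suc m)) = - κ m

  opaque
    e-neg : ∀ x m → e (- x) m ≈ σ m * e x m
    e-neg x zero    = sym (*-identityˡ 1#)
    e-neg x (suc m) = trans (*-congʳ (*-congʳ (e-neg x m)))
      (solve 4 (λ s e x i → (s :* e) :* :- x :* i := :- s :* (e :* x :* i)) refl (σ m) (e x m) x _)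

    -- As `κ m` is the cosine of `m` right angles, this is `2 cos a cos b = cos (a + b) + cos (a -
    -- b)` for multiples of a right angle: there `a + b` and `a -
    -- b` differ by `j` half turns, whence the sign `σ j`.
    κ-* : ∀ i j → two * (κ i * κ j) ≈ κ (i ℕ.+ j) * (1# + σ j)
    κ-* i zero = trans (solve 1 (λ a → :2 :* (a :* :1) := a :* :2) refl (κ i))
      (*-congʳ (reflexive (≡.cong κ (≡.sym (ℕ.+-identityʳ i)))))
    κ-* i (suc zero) = solve 2 (λ a b → :2 :* (a :* :0) := b :* (:1 :+ :- :1)) refl (κ i) (κ (i ℕ.+ 1))
    κ-* i (suc (suc j)) = begin
      two * (κ i * - κ j)  ≈⟨ solve 2 (λ a b → :2 :* (a :* :- b) := :- (:2 :* (a :* b))) refl _ _ ⟩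
      - (two * (κ i * κ j))  ≈⟨ -‿cong (κ-* i j) ⟩
      - (κ (i ℕ.+ j) * (1# + σ j))  ≈⟨ solve 2 (λ a b → :- (a :* (:1 :+ b)) :=
            :- a :* (:1 :+ :- :- b)) refl _ _ ⟩
      - κ (i ℕ.+ j) * (1# + - - σ j)
        ≈⟨ *-congʳ (reflexive (≡.cong κ (≡.trans (ℕ.+-suc i (suc j)) (≡.cong suc (ℕ.+-suc i j))))) ⟨
      κ (i ℕ.+ suc (suc j)) * (1# + - - σ j)  ∎

    -- The induction shifts the first factor, so `κ` is replaced there by any `a` obeying the same
    -- product rule, as the shifts of `κ` do.
    conv-κ : ∀ {a u v : ℕ → ℝ} → (∀ i j → two * (a i * κ j) ≈ a (i ℕ.+ j) * (1# + σ j)) → ∀ m →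
      two * conv (λ i → a i * u i) (λ j → κ j * v j) m ≈
      a m * (conv u v m + conv u (λ j → σ j * v j) m)
    conv-κ {a} {u} {v} a-* zero =
      solve 3 (λ a u v → :2 :* ((a :* u) :* (:1 :* v)) := a :* (u :* v :+ u :* (:1 :* v)))
        refl (a 0) (u 0) (v 0)
    conv-κ {a} {u} {v} a-* (suc m) = begin
      two * ((a 0 * u 0) * (κ (suc m) * v (suc m)) + c)
        ≈⟨ solve 5 (λ a u k v c → :2 :* ((a :* u) :* (k :* v) :+ c) :=
             (:2 :* (a :* k)) :* (u :* v) :+ :2 :* c) refl (a 0) (u 0) (κ (suc m)) (v (suc m)) c ⟩
      (two * (a 0 * κ (suc m))) * (u 0 * v (suc m)) + two * c
        ≈⟨ +-cong (*-congʳ (a-* 0 (suc m))) (conv-κ {a ∘ suc} {u ∘ suc} {v} (λ i → a-* (suc i)) m) ⟩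
      (a (suc m) * (1# + σ (suc m))) * (u 0 * v (suc m)) + a (suc m) * (d + d′)
        ≈⟨ solve 6 (λ a s u v d d′ → (a :* (:1 :+ s)) :* (u :* v) :+ a :* (d :+ d′) :=
             a :* ((u :* v :+ d) :+ (u :* (s :* v) :+ d′))) refl (a (suc m)) (σ (suc m)) (u 0) (v (suc m)) d d′ ⟩
      a (suc m) * (conv u v (suc m) + conv u (λ j → σ j * v j) (suc m))  ∎
      where
      c d d′ : ℝ
      c = conv (λ i → a (suc i) * u (suc i)) (λ j → κ j * v j) m
      d = conv (u ∘ suc) v m
      d′ = conv (u ∘ suc) (λ j → σ j * v j) m

  cosTerm : ℝ → ℕ → ℝ
  cosTerm x m = κ m * e x m

  opaque
    -- Both convolutions left by `conv-κ` are binomial sums, since the sign `σ j` turns the powers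
    -- of `y` into those of `- y`.
    cosTerm-* : ∀ x y m → two * conv (cosTerm x) (cosTerm y) m ≈ cosTerm (x + y) m + cosTerm (x - y) m
    cosTerm-* x y m = begin
      two * conv (cosTerm x) (cosTerm y) m  ≈⟨ conv-κ {κ} {e x} {e y} κ-* m ⟩
      κ m * (conv (e x) (e y) m + conv (e x) (λ j → σ j * e y j) m)
        ≈⟨ *-congˡ (+-cong (e-+ x y m)
             (trans (conv-cong m (λ _ → refl) (λ j → sym (e-neg y j))) (e-+ x (- y) m))) ⟩
      κ m * (e (x + y) m + e (x - y) m)  ≈⟨ distribˡ _ _ _ ⟩
      cosTerm (x + y) m + cosTerm (x - y) m  ∎

-- Convergence of the cosine series, d'Alembert's equation and estimates near zero.

module Cosine (em : ExcludedMiddle 0ℓ) (R : RealField) where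
  open CosineSeries em R public
  open SetoidReasoning setoid

  opaque
    0<suc⁻¹ : ∀ n → 0# < fromℕ (suc n) ⁻¹
    0<suc⁻¹ n = ⁻¹-pos (0<fromℕ-suc n)

    e-nonneg : ∀ {z} → 0# ≤ z → ∀ m → 0# ≤ e z m
    e-nonneg 0≤z zero    = 0≤1
    e-nonneg 0≤z (suc m) = e-nonneg 0≤z m ⊠ 0≤z ⊠ <⇒≤ (0<suc⁻¹ m)

    eventually-decreasing⇒bounded : ∀ M (f : ℕ → ℝ) → (∀ m → 0# ≤ f m) → (∀ m → M ℕ.≤ m → f (suc m) ≤ f m) →
                                    ∃[ K ] (∀ m → f m ≤ K)
    eventually-decreasing⇒bounded zero f 0≤f decreasing = f 0 , bound
      where
      bound : ∀ m → f m ≤ f 0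
      bound zero    = ≤-refl
      bound (suc m) = ≤-trans (decreasing m z≤n) (bound m)
    eventually-decreasing⇒bounded (suc M) f 0≤f decreasing
      with eventually-decreasing⇒bounded M (f ∘ suc) (0≤f ∘ suc) (λ m M≤m → decreasing (suc m) (s≤s M≤m))
    ... | K , bound = f 0 + K , λ where
      zero    → 0≤⇒≤ (≤-trans (0≤f 1) (bound 0)) (solve 2 (λ a K → K := (a :+ K) :- a) refl (f 0) K)
      (suc m) → ≤-trans (bound m) (0≤⇒≤ (0≤f 0) (solve 2 (λ a K → a := (a :+ K) :- K) refl (f 0) K))

    -- Consecutive terms have the ratio `z / (m + 1)`, which is at most one as soon as `m + 1`
    -- reaches `z`.
    e-bounded : ∀ {z} → 0# ≤ z → ∃[ K ] (∀ m → e z m ≤ K)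
    e-bounded {z} 0≤z with archimedean z
    ... | M , z<M = eventually-decreasing⇒bounded M (e z) (e-nonneg 0≤z) λ m M≤m →
      0≤⇒≤ (e-nonneg 0≤z m ⊠ (≤⇒0≤- (≤-trans (<⇒≤ z<M) (fromℕ-mono (ℕ.m≤n⇒m≤1+n M≤m))) ⊠ <⇒≤ (0<suc⁻¹ m)))
        (trans (solve 4 (λ E₁ z s i → E₁ :* ((s :- z) :* i) := E₁ :* (s :* i) :- E₁ :* z :* i)
                  refl (e z m) z (fromℕ (suc m)) (fromℕ (suc m) ⁻¹))
          (+-congʳ (trans (*-congˡ (suc-inverse m)) (*-identityʳ _))))

    two*half : two * half ≈ 1#
    two*half = ⁻¹-inverse two (>⇒≉ 0<two)

  four : ℝ
  four = two * two

  opaque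
    four*quarter : four * quarter ≈ 1#
    four*quarter = trans (solve 2 (λ t h → (t :* t) :* (h :* h) := (t :* h) :* (t :* h)) refl two half)
      (trans (*-cong two*half two*half) (*-identityˡ 1#))

    -- The factor `4 ^ m` in the power of `four * b` cancels `quarter ^ m`. Boundedness of the terms
    -- at `four * b` thus becomes decay of the terms at `x`.
    e-dominated : ∀ {x b} → ∣ x ∣≤ b → ∀ m → ∣ e x m ∣≤ e (four * b) m * quarter ^ m
    e-dominated ∣x∣≤b zero = 0≤⇒∣∣ 0≤1 (≤-reflexive (sym (*-identityˡ 1#)))
    e-dominated {x} {b} ∣x∣≤b (suc m) = ∣∣-cong refl
      (trans (solve 4 (λ E₁ q b i → (E₁ :* q) :* b :* i := (E₁ :* b :* i :* q) :* :1) refl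
               (e (four * b) m) (quarter ^ m) b i)
        (trans (*-congˡ (sym four*quarter))
          (solve 6 (λ E₁ f b i q p → (E₁ :* b :* i :* p) :* (f :* q) := (E₁ :* (f :* b) :* i) :* (q :* p)) refl
            (e (four * b) m) four b i quarter (quarter ^ m))))
      (∣∣-* (∣∣-* (e-dominated ∣x∣≤b m) ∣x∣≤b) (0≤⇒∣∣ (<⇒≤ (0<suc⁻¹ m)) ≤-refl))
      where
      i : ℝ
      i = fromℕ (suc m) ⁻¹

    ∣κ∣≤1 : ∀ m → ∣ κ m ∣≤ 1#
    ∣κ∣≤1 zero          = 0≤⇒∣∣ 0≤1 ≤-refl
    ∣κ∣≤1 (suc zero)    = ∣0∣≤ 0≤1
    ∣κ∣≤1 (suc (suc m)) = ∣∣-neg (∣κ∣≤1 m)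

  opaque
    cosTerm-bound : ∀ x → ∃[ K ] (∀ i → ∣ cosTerm x i ∣≤ K * quarter ^ i)
    cosTerm-bound x with ∣∣-bounded x
    ... | b , ∣x∣≤b with e-bounded {four * b} (<⇒≤ (*-pos 0<two 0<two) ⊠ ∣∣⇒0≤ ∣x∣≤b)
    ...   | K , e≤K = K , bound
      where
      bound : ∀ i → ∣ cosTerm x i ∣≤ K * quarter ^ i
      bound i = ∣∣-≤ {b = 1# * (e (four * b) i * quarter ^ i)}
        (0≤⇒≤ (≤⇒0≤- (e≤K i) ⊠ <⇒≤ (0<quarter^ i))
          (solve 3 (λ K a q → (K :- a) :* q := K :* q :- :1 :* (a :* q)) refl K (e (four * b) i) (quarter ^ i)))
        (∣∣-* (∣κ∣≤1 i) (e-dominated ∣x∣≤b i))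

    0<fromℕ : ∀ {n} → 0 ℕ.< n → 0# < fromℕ n
    0<fromℕ (s≤s {n = n} _) = 0<fromℕ-suc n

    0<fromℕ! : ∀ m → 0# < fromℕ (m !)
    0<fromℕ! m = 0<fromℕ (ℕ.1≤n! m)

  opaque
    e-! : ∀ x m → e x m * fromℕ (m !) ≈ x ^ m
    e-! x zero    = trans (*-identityˡ _) (+-identityʳ 1#)
    e-! x (suc m) = begin
      e x m * x * i * fromℕ (suc m !)        ≈⟨ *-congˡ (Multiple.×1-homo-* semiring (suc m) (m !)) ⟩
      e x m * x * i * (s * fromℕ (m !))
        ≈⟨ solve 5 (λ E₁ x i s f → E₁ :* x :* i :* (s :* f) :=
              x :* (E₁ :* f) :* (s :* i)) refl (e x m) x i s _ ⟩
      x * (e x m * fromℕ (m !)) * (s * i)    ≈⟨ *-cong (*-congˡ (e-! x m)) (suc-inverse m) ⟩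
      x * x ^ m * 1#                         ≈⟨ *-identityʳ _ ⟩
      x ^ suc m                              ∎
      where
      s : ℝ
      s = fromℕ (suc m)
      i : ℝ
      i = fromℕ (suc m) ⁻¹

    e-closed : ∀ x m → e x m ≈ x ^ m * fromℕ (m !) ⁻¹
    e-closed x m = begin
      e x m                                      ≈⟨ *-identityʳ _ ⟨
      e x m * 1#                                 ≈⟨ *-congˡ (⁻¹-inverse _ (>⇒≉ (0<fromℕ! m))) ⟨
      e x m * (fromℕ (m !) * fromℕ (m !) ⁻¹)     ≈⟨ *-assoc _ _ _ ⟨
      e x m * fromℕ (m !) * fromℕ (m !) ⁻¹       ≈⟨ *-congʳ (e-! x m) ⟩
      x ^ m * fromℕ (m !) ⁻¹                     ∎

    κ-even : ∀ k → κ (k ℕ.* 2) ≈ (- 1#) ^ k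
    κ-even zero    = refl
    κ-even (suc k) = trans (-‿cong (κ-even k)) (solve 1 (λ a → :- a := :- :1 :* a) refl _)

    κ-odd : ∀ k → κ (suc (k ℕ.* 2)) ≈ 0#
    κ-odd zero    = refl
    κ-odd (suc k) = trans (-‿cong (κ-odd k)) (solve 1 (λ a → :- :0 := :0) refl 1#)

    -- Each summand of `cosPartial` accounts for an even term of the full series and the odd one
    -- after it, which vanishes.
    cosPartial≈ : ∀ x n → cosPartial x n ≈ Σ< (n ℕ.* 2) (cosTerm x)
    cosPartial≈ x zero    = refl
    cosPartial≈ x (suc k) = begin
      cosPartial x k + (- 1#) ^ k * x ^ (2 ℕ.* k) * fromℕ ((2 ℕ.* k) !) ⁻¹
        ≡⟨ ≡.cong (λ j → cosPartial x k + (- 1#) ^ k * x ^ j * fromℕ (j !) ⁻¹) (ℕ.*-comm 2 k) ⟩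
      cosPartial x k + (- 1#) ^ k * x ^ j * fromℕ (j !) ⁻¹
        ≈⟨ +-cong (cosPartial≈ x k) (trans (*-assoc _ _ _) (*-cong (sym (κ-even k)) (sym (e-closed x j)))) ⟩
      Σ< j (cosTerm x) + cosTerm x j
        ≈⟨ Σ<-last j (cosTerm x) ⟨
      Σ< (suc j) (cosTerm x)
        ≈⟨ trans (+-congˡ (trans (*-congʳ (κ-odd k)) (zeroˡ _))) (+-identityʳ _) ⟨
      Σ< (suc j) (cosTerm x) + cosTerm x (suc j)
        ≈⟨ Σ<-last (suc j) (cosTerm x) ⟨
      Σ< (suc (suc j)) (cosTerm x)  ∎
      where
      j : ℕ
      j = k ℕ.* 2

  opaque
    cosPartial-bound : ∀ {x K l} → (∀ i → ∣ cosTerm x i ∣≤ K * quarter ^ i) →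
      (∀ n → ∣ Σ< n (cosTerm x) - l ∣≤ two * (K * quarter ^ n)) →
      ∀ n → ∣ cosPartial x n - l ∣≤ (two * K) * half ^ n
    cosPartial-bound {x} {K} {l} bound rate n = ∣∣-cong (+-congʳ (sym (cosPartial≈ x n))) refl
      (∣∣-≤ (≤-respˡ-≈ (*-assoc _ _ _) (*-monoˡ-≤ 0≤2K (≤-trans (quarter^≤half^ (n ℕ.* 2)) (half^-double n))))
        (rate (n ℕ.* 2)))
      where
      0≤2K : 0# ≤ two * K
      0≤2K = <⇒≤ 0<two ⊠ ≤-respʳ-≈ (*-identityʳ K) (∣∣⇒0≤ (bound 0))
      half^-double : ∀ n → half ^ (n ℕ.* 2) ≤ half ^ n
      half^-double zero    = ≤-refl
      half^-double (suc n) = *-monoˡ-≤ (<⇒≤ 0<half) (≤-trans (half^-suc-≤ (n ℕ.* 2)) (half^-double n))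

    cosPartial-limit : ∀ {x C l} → (∀ n → ∣ cosPartial x n - l ∣≤ C * half ^ n) → Limit (cosPartial x) l
    cosPartial-limit {x} {C} {l} bound ε 0<ε with half^-small C 0<ε
    ... | N , small = N , λ n N≤n → ∣∣⇒abs< (bound n) (small n N≤n)

    limit≈cos : ∀ {x l} → Limit (cosPartial x) l → l ≈ cos x
    limit≈cos {x} {l} limit = Limit-unique {cosPartial x} limit (the-satisfies (Limit (cosPartial x)) (l , limit))

  opaque
    -- The ratio `quarter` is recorded, and not just `half`, because `conv-⇝` asks for it in the
    -- second factor.
    cos-rate : ∀ x → ∃[ B ] (∀ n → ∣ Σ< n (cosTerm x) - cos x ∣≤ B * quarter ^ n)
    cos-rate x = two * K , λ n → ∣∣-cong (+-congˡ (-‿cong l≈cos)) (sym (*-assoc two K (quarter ^ n)))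
                           (proj₂ limit n)
      where
      K : ℝ
      K = proj₁ (cosTerm-bound x)
      limit : ∃[ l ] (∀ n → ∣ Σ< n (cosTerm x) - l ∣≤ two * (K * quarter ^ n))
      limit = series (<⇒≤ 0<quarter) quarter≤half (proj₂ (cosTerm-bound x))
      l≈cos : proj₁ limit ≈ cos x
      l≈cos = limit≈cos (cosPartial-limit (cosPartial-bound (proj₂ (cosTerm-bound x)) (proj₂ limit)))

  opaque
    cos-⇝ : ∀ x → (λ n → Σ< n (cosTerm x)) ⇝ cos x
    cos-⇝ x = B , λ n → ∣∣-≤ (*-monoˡ-≤ (≤-respʳ-≈ (*-identityʳ B) (∣∣⇒0≤ (rate 0))) (quarter^≤half^ n)) (rate n)
      where
      B : ℝ
      B = proj₁ (cos-rate x)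
      rate : ∀ n → ∣ Σ< n (cosTerm x) - cos x ∣≤ B * quarter ^ n
      rate = proj₂ (cos-rate x)

    cos-cong : ∀ {x y} → x ≈ y → cos x ≈ cos y
    cos-cong {x} {y} x≈y = ⇝-unique (cos-⇝ x)
      (⇝-cong (λ n → Σ<-cong n (λ i → *-congˡ (e-cong (sym x≈y) i))) refl (cos-⇝ y))

    cos-dAlembert : ∀ x y → cos (x + y) + cos (x - y) ≈ two * (cos x * cos y)
    cos-dAlembert x y = ⇝-unique {S} (⇝-+ (cos-⇝ (x + y)) (cos-⇝ (x - y)))
      (⇝-cong {λ n → Σ< n c * two} {S} product (*-comm _ _) (⇝-*ʳ two c⇝))
      where
      c : ℕ → ℝ
      c = conv (cosTerm x) (cosTerm y)
      S : ℕ → ℝ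
      S n = Σ< n (cosTerm (x + y)) + Σ< n (cosTerm (x - y))
      c⇝ : (λ n → Σ< n c) ⇝ cos x * cos y
      c⇝ = conv-⇝ {cosTerm x} {cosTerm y} (proj₂ (cosTerm-bound x)) (cos-⇝ x) (proj₂ (cos-rate y))
      product : ∀ n → Σ< n c * two ≈ S n
      product n = begin
        Σ< n c * two                                        ≈⟨ *-comm _ _ ⟩
        two * Σ< n c                                        ≈⟨ Σ<-* n two c ⟨
        Σ< n (λ m → two * c m)                              ≈⟨ Σ<-cong n (cosTerm-* x y) ⟩
        Σ< n (λ m → cosTerm (x + y) m + cosTerm (x - y) m)  ≈⟨ Σ<-+ n _ _ ⟩
        S n                                                 ∎

    cos-0 : cos 0# ≈ 1#
    -- `⇝-suc` removes the empty partial sum, the only one that differs from 1.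
    cos-0 = ⇝-unique (⇝-suc (cos-⇝ 0#)) (⇝-cong {λ _ → 1#} {S} (λ n → sym (constant n)) refl ⇝-const)
      where
      S : ℕ → ℝ
      S n = Σ< (suc n) (cosTerm 0#)
      constant : ∀ n → S n ≈ 1#
      constant n = begin
        1# * 1# + Σ< n (λ i → cosTerm 0# (suc i))
          ≈⟨ +-cong (*-identityˡ 1#) (Σ<-cong n {_} {λ _ → 0# * 0#} (λ i →
               solve 3 (λ k a s → k :* (a :* :0 :* s) := :0 :* :0) refl (κ (suc i)) (e 0# i) _)) ⟩
        1# + Σ< n (λ _ → 0# * 0#)  ≈⟨ +-congˡ (trans (Σ<-* n 0# _) (zeroˡ _)) ⟩
        1# + 0#                    ≈⟨ +-identityʳ 1# ⟩
        1#                         ∎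

  module _ {x} (0≤x : 0# ≤ x) (x≤1 : x ≤ 1#) where
    opaque
      -- The ratio `x / (m + 2)` is at most one half. The very first ratio is `x` itself and may be
      -- larger, hence the start at index one.
      e-decay : ∀ m → e x (suc (suc m)) ≤ half * e x (suc m)
      e-decay m = 0≤⇒≤ ((0≤e ⊠ (<⇒≤ 0<i ⊠ ≤⇒0≤- x≤1)) ⊞ (0≤e ⊠ (<⇒≤ 0<half ⊠ <⇒≤ 0<i ⊠ ≤⇒0≤- two≤s)))
        (begin
          E₁ * (i * (1# - x)) + E₁ * (half * i * (s - two))
            ≈⟨ solve 6 (λ E₁ i x h s t → E₁ :* (i :* (:1 :- x)) :+ E₁ :* (h :* i :* (s :- t)) :=
                 (E₁ :* i :* (:1 :- t :* h) :+ h :* E₁ :* (s :* i)) :- E₁ :* x :* i) refl E₁ i x half s two ⟩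
          (E₁ * i * (1# - two * half) + half * E₁ * (s * i)) - E₁ * x * i
            ≈⟨ +-congʳ (+-cong (*-congˡ (trans (+-congˡ (-‿cong two*half)) (-‿inverseʳ 1#)))
                               (*-congˡ (suc-inverse (suc m)))) ⟩
          (E₁ * i * 0# + half * E₁ * 1#) - E₁ * x * i
            ≈⟨ solve 4 (λ E₁ i x h → (E₁ :* i :* :0 :+ h :* E₁ :* :1) :- E₁ :* x :* i :=
                  h :* E₁ :- E₁ :* x :* i) refl E₁ i x half ⟩
          half * E₁ - E₁ * x * i  ∎)
        where
        E₁ s i : ℝ
        E₁ = e x (suc m)
        s = fromℕ (suc (suc m))
        i = s ⁻¹
        0≤e : 0# ≤ E₁
        0≤e = e-nonneg 0≤x (suc m)
        0<i : 0# < i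
        0<i = 0<suc⁻¹ (suc m)
        two≤s : two ≤ s
        two≤s = 0≤⇒≤ (0≤fromℕ m) (solve 1 (λ n → n := (:1 :+ (:1 :+ n)) :- :2) refl (fromℕ m))

      e-decay^ : ∀ m → e x (suc m ℕ.+ 3) ≤ e x 4 * half ^ m
      e-decay^ zero    = ≤-reflexive (sym (*-identityʳ _))
      e-decay^ (suc m) = ≤-trans (e-decay (m ℕ.+ 3)) (≤-respʳ-≈
        (solve 3 (λ h E₁ p → h :* (E₁ :* p) := E₁ :* (h :* p)) refl half (e x 4) (half ^ m))
        (*-monoˡ-≤ (<⇒≤ 0<half) (e-decay^ m)))

      -- What follows `1 - x² / 2` in the series starts with the fourth power. As the terms at least
      -- halve from there on, it is at most `2 e₄ ≤ e₃ ≤ e₂ / 2`, where `eₘ` is `e x m`.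
      cos-approx : ∣ cos x - (1# - e x 2) ∣≤ half * e x 2
      cos-approx = ∣∣-cong
        (trans (solve 1 (λ l → :- (:0 :- l) := l) refl l)
          (⇝-unique l-⇝ (⇝-cong (λ n → Σ<-cong n shift) value tail)))
        refl (∣∣-≤ 2e₄≤ (∣∣-neg (rate 0)))
        where
        bound : ∀ i → ∣ cosTerm x (suc (i ℕ.+ 3)) ∣≤ e x 4 * half ^ i
        bound i = ∣∣-cong refl (*-identityˡ _) (∣∣-* (∣κ∣≤1 (suc i ℕ.+ 3))
          (0≤⇒∣∣ (e-nonneg 0≤x (suc i ℕ.+ 3)) (e-decay^ i)))
        limit : ∃[ l ] (∀ n → ∣ Σ< n (λ i → cosTerm x (suc (i ℕ.+ 3))) - l ∣≤ two * (e x 4 * half ^ n))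
        limit = series (<⇒≤ 0<half) ≤-refl bound
        l : ℝ
        l = proj₁ limit
        rate : ∀ n → ∣ Σ< n (λ i → cosTerm x (suc (i ℕ.+ 3))) - l ∣≤ two * (e x 4 * half ^ n)
        rate = proj₂ limit
        2e₄≤ : two * (e x 4 * 1#) ≤ half * e x 2
        2e₄≤ = 0≤⇒≤ ((<⇒≤ 0<two ⊠ ≤⇒0≤- (e-decay 2)) ⊞ ≤⇒0≤- (e-decay 1))
          (trans (solve 5 (λ t h a b c → t :* (h :* b :- c) :+ (h :* a :- b) :=
                    (h :* a :- t :* (c :* :1)) :+ (t :* h :- :1) :* b) refl two half (e x 2) (e x 3) (e x 4))
            (trans (+-congˡ (trans (*-congʳ (trans (+-congʳ two*half) (-‿inverseʳ 1#))) (zeroˡ _))) (+-identityʳ _)))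
        l-⇝ : (λ n → Σ< n (λ i → cosTerm x (suc (i ℕ.+ 3)))) ⇝ l
        l-⇝ = two * e x 4 , λ n → ∣∣-cong refl (sym (*-assoc _ _ _)) (rate n)
        tail : (λ n → Σ< n (λ i → cosTerm x (suc (suc (suc (suc i)))))) ⇝
               cos x - cosTerm x 0 - cosTerm x 1 - cosTerm x 2 - cosTerm x 3
        tail = ⇝-tail (⇝-tail (⇝-tail (⇝-tail (cos-⇝ x))))
        shift : ∀ i → cosTerm x (suc (suc (suc (suc i)))) ≈ cosTerm x (suc (i ℕ.+ 3))
        shift i = reflexive (≡.cong (cosTerm x ∘ suc) (ℕ.+-comm 3 i))
        value : cos x - cosTerm x 0 - cosTerm x 1 - cosTerm x 2 - cosTerm x 3 ≈ cos x - (1# - e x 2)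
        value = solve 4 (λ c a b d → c :- :1 :* :1 :- :0 :* a :- (:- :1) :* b :- (:- :0) :* d := c :- (:1 :- b))
          refl (cos x) (e x 1) (e x 2) (e x 3)

  opaque
    two*e₂ : ∀ x → two * e x 2 ≈ x * x
    two*e₂ x = begin
      two * e x 2  ≈⟨ *-congʳ (solve 1 (λ a → :1 :+ :1 := :1 :+ (:1 :+ :0)) refl 1#) ⟩
      fromℕ 2 * e x 2  ≈⟨ e-suc x 1 ⟩
      x * (1# * x * i)  ≈⟨ solve 2 (λ x i → x :* (:1 :* x :* i) := (x :* x) :* ((:1 :+ :0) :* i)) refl x i ⟩
      (x * x) * (fromℕ 1 * i)  ≈⟨ *-congˡ (suc-inverse 0) ⟩
      (x * x) * 1#  ≈⟨ *-identityʳ _ ⟩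
      x * x  ∎
      where
      i : ℝ
      i = fromℕ 1 ⁻¹

    1-cos≤ : ∀ {x} → 0# ≤ x → x ≤ 1# → 1# - cos x ≤ x * x
    1-cos≤ {x} 0≤x x≤1 = 0≤⇒≤ (≤⇒0≤- (proj₁ (cos-approx 0≤x x≤1)) ⊞ (<⇒≤ 0<half ⊠ e-nonneg 0≤x 2))
      (begin
        (cos x - (1# - e x 2) - - (half * e x 2)) + half * e x 2
          ≈⟨ solve 3 (λ c a h → (c :- (:1 :- a) :- :- (h :* a)) :+ h :* a :=
                (a :+ (h :* a :+ h :* a)) :- (:1 :- c))
               refl (cos x) (e x 2) half ⟩
        (e x 2 + (half * e x 2 + half * e x 2)) - (1# - cos x)
          ≈⟨ +-congʳ (trans (+-congˡ (halve (e x 2))) (solve 1 (λ a → a :+ a := :2 :* a) refl (e x 2))) ⟩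
        two * e x 2 - (1# - cos x)  ≈⟨ +-congʳ (two*e₂ x) ⟩
        x * x - (1# - cos x)  ∎)

    cos<1 : ∀ {x} → 0# < x → x ≤ 1# → cos x < 1#
    cos<1 {x} 0<x x≤1 = 0<⇒< (≤⇒0≤- (proj₂ (cos-approx (<⇒≤ 0<x) x≤1)) ≤⊞ (0<half ⊠< 0<e₂))
      (begin
        (half * e x 2 - (cos x - (1# - e x 2))) + half * e x 2
          ≈⟨ solve 3 (λ c a h → (h :* a :- (c :- (:1 :- a))) :+ h :* a := (h :* a :+ h :* a) :+ (:1 :- c :- a))
               refl (cos x) (e x 2) half ⟩
        (half * e x 2 + half * e x 2) + (1# - cos x - e x 2)  ≈⟨ +-congʳ (halve (e x 2)) ⟩
        e x 2 + (1# - cos x - e x 2)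
          ≈⟨ solve 2 (λ c a → a :+ (:1 :- c :- a) := :1 :- c) refl (cos x) (e x 2) ⟩
        1# - cos x  ∎)
      where
      0<e₂ : 0# < e x 2
      0<e₂ = 0<1 ⊠< 0<x ⊠< 0<suc⁻¹ 0 ⊠< 0<x ⊠< 0<suc⁻¹ 1

-- Continuity and monotonicity of cosine, π, arccos and chords.

module Trigonometry (em : ExcludedMiddle 0ℓ) (R : RealField) where
  open Cosine em R public
  open Reals em R public using (π/2; π; arccos)
  open SetoidReasoning setoid

  Continuous : (ℝ → ℝ) → Set
  Continuous f = ∀ x ε → 0# < ε → ∃[ δ ] 0# < δ × (∀ y → ∣ y - x ∣≤ δ → ∣ f y - f x ∣≤ ε)

  FirstZero : (ℝ → ℝ) → ℝ → ℝ → Set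
  FirstZero f a h = a < h × f h ≈ 0# × (∀ t → a ≤ t → t < h → 0# < f t)

  module _ {f : ℝ → ℝ} (continuous : Continuous f) {a b} (0<fa : 0# < f a) (a≤b : a ≤ b) (fb≤0 : f b ≤ 0#)
           (f-cong : ∀ {x y} → x ≈ y → f x ≈ f y) where
    private
      Positive : ℝ → Set
      Positive t = a ≤ t × (∀ s → a ≤ s → s ≤ t → 0# < f s)

    opaque
      private
        near-positive : ∀ {h} → 0# < f h → ∃[ δ ] 0# < δ × (∀ y → ∣ y - h ∣≤ δ → 0# < f y)
        near-positive {h} 0<fh = let δ , 0<δ , near = continuous h (half * f h) (0<half* 0<fh) in
          δ , 0<δ , λ y y∼h → 0<⇒< (≤⇒0≤- (proj₁ (near y y∼h)) ≤⊞ 0<half* 0<fh)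
            (trans (solve 3 (λ y h p → ((y :- h) :- :- p) :+ p :=
                  (y :- h) :+ (p :+ p)) refl (f y) (f h) (half * f h))
              (trans (+-congˡ (halve (f h))) (solve 2 (λ y h → (y :- h) :+ h := y :- :0) refl (f y) (f h))))

        near-negative : ∀ {h} → f h < 0# → ∃[ δ ] 0# < δ × (∀ y → ∣ y - h ∣≤ δ → f y < 0#)
        near-negative {h} fh<0 = let δ , 0<δ , near = continuous h (half * (0# - f h)) (0<half* (<⇒0<- fh<0)) in
          δ , 0<δ , λ y y∼h → 0<⇒< (≤⇒0≤- (proj₂ (near y y∼h)) ≤⊞ 0<half* (<⇒0<- fh<0))
            (trans (solve 3 (λ y h p → (p :- (y :- h)) :+ p :=
                  (p :+ p) :- (y :- h)) refl (f y) (f h) (half * (0# - f h)))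
              (trans (+-congʳ (halve (0# - f h))) (solve 2 (λ y h → (:0 :- h) :- (y :- h) :=
                    :0 :- y) refl (f y) (f h))))

        Positive-a : Positive a
        Positive-a = ≤-refl , λ s a≤s s≤a → <-respʳ-≈ (f-cong (≤-antisym a≤s s≤a)) 0<fa

        Positive-bounded : UpperBound Positive b
        Positive-bounded t (a≤t , 0<f) with ≤-or-> t b
        ... | inj₁ t≤b = t≤b
        ... | inj₂ b<t = ⊥-elim (<⇒≱ (0<f b a≤b (<⇒≤ b<t)) fb≤0)

      -- The zero is the supremum of those `t` up to which `f` is positive. By continuity `f h > 0`
      -- would extend this range, and `f h < 0` would force a negative value at `h - δ` or at `a`.
      first-zero : ∃[ h ] FirstZero f a h × h ≤ b
      first-zero = h , (a<h , fh≈0 , 0<f-below) , h-least b Positive-bounded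
        where
        sup : ∃[ h ] UpperBound Positive h × (∀ u → UpperBound Positive u → h ≤ u)
        sup = supremum Positive (a , Positive-a) (b , Positive-bounded)
        h : ℝ
        h = proj₁ sup
        h-bound : UpperBound Positive h
        h-bound = proj₁ (proj₂ sup)
        h-least : ∀ u → UpperBound Positive u → h ≤ u
        h-least = proj₂ (proj₂ sup)
        a≤h : a ≤ h
        a≤h = h-bound a Positive-a
        0<f-below : ∀ t → a ≤ t → t < h → 0# < f t
        0<f-below t a≤t t<h with em {∃[ u ] Positive u × t < u}
        ... | yes (u , (_ , 0<f) , t<u) = 0<f t a≤t (<⇒≤ t<u)
        ... | no none = ⊥-elim (<⇒≱ t<h (h-least t λ u pos → ≮⇒≥ λ t<u → none (u , pos , t<u)))
        ¬0<fh : ¬ 0# < f h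
        ¬0<fh 0<fh = beyond (near-positive 0<fh)
          where
          beyond : ¬ (∃[ δ ] 0# < δ × (∀ y → ∣ y - h ∣≤ δ → 0# < f y))
          beyond (δ , 0<δ , 0<f-near) = <⇒≱ (0<⇒< 0<δ (solve 2 (λ h δ → δ := (h :+ δ) :- h) refl h δ))
            (h-bound (h + δ) (≤-trans a≤h (0≤⇒≤ (<⇒≤ 0<δ) (solve 2 (λ h δ → δ :=
                  (h :+ δ) :- h) refl h δ)) , 0<f))
            where
            0<f : ∀ s → a ≤ s → s ≤ h + δ → 0# < f s
            0<f s a≤s s≤h+δ with ≤-or-> h s
            ... | inj₂ s<h = 0<f-below s a≤s s<h
            ... | inj₁ h≤s = 0<f-near s (0≤⇒∣∣ (≤⇒0≤- h≤s)
                  (0≤⇒≤ (≤⇒0≤- s≤h+δ) (solve 3 (λ h δ s → (h :+ δ) :- s := δ :- (s :- h)) refl h δ s)))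
        ¬fh<0 : ¬ f h < 0#
        ¬fh<0 fh<0 = before (near-negative fh<0)
          where
          before : ¬ (∃[ δ ] 0# < δ × (∀ y → ∣ y - h ∣≤ δ → f y < 0#))
          before (δ , 0<δ , f<0-near) with ≤-or-> a (h - δ)
          ... | inj₁ a≤h-δ = <⇒≱
            (0<f-below (h - δ) a≤h-δ (0<⇒< 0<δ (solve 2 (λ h δ → δ := h :- (h :- δ)) refl h δ)))
            (<⇒≤ (f<0-near (h - δ) (∣∣-cong (solve 2 (λ h δ → :- δ := (h :- δ) :- h) refl h δ) refl
              (∣∣-neg (0≤⇒∣∣ (<⇒≤ 0<δ) ≤-refl)))))
          ... | inj₂ h-δ<a = <⇒≱ 0<fa
            (<⇒≤ (f<0-near a (∣∣-cong (solve 2 (λ a h → :- (h :- a) := a :- h) refl a h) refl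
              (∣∣-neg (0≤⇒∣∣ (≤⇒0≤- a≤h)
                (0≤⇒≤ (<⇒≤ (<⇒0<- h-δ<a)) (solve 3 (λ a h δ → a :- (h :- δ) := δ :- (h :- a)) refl a h δ)))))))
        fh≈0 : f h ≈ 0#
        fh≈0 = ≤-antisym (≮⇒≥ ¬0<fh) (≮⇒≥ ¬fh<0)
        a<h : a < h
        a<h with a≤h
        ... | inj₁ a<h = a<h
        ... | inj₂ a≈h = ⊥-elim (>⇒≉ 0<fa (trans (f-cong a≈h) fh≈0))

  opaque
    sq⇒∣∣ : ∀ {z b} → 0# ≤ b → z * z ≤ b * b → ∣ z ∣≤ b
    sq⇒∣∣ {z} {b} 0≤b z²≤b² = bounds (≤-or-> (- b) z) (≤-or-> z b)
      where
      bounds : - b ≤ z ⊎ z < - b → z ≤ b ⊎ b < z → ∣ z ∣≤ b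
      bounds (inj₁ -b≤z) (inj₁ z≤b) = -b≤z , z≤b
      bounds (inj₂ z<-b) _ = ⊥-elim (<⇒≱ (0<⇒< ((<⇒0<- z<-b) ⊠< (0≤b ⊞ 0≤b ≤⊞ <⇒0<- z<-b))
        (solve 2 (λ z b → (:- b :- z) :* (b :+ b :+ (:- b :- z)) := z :* z :- b :* b) refl z b)) z²≤b²)
      bounds _ (inj₂ b<z) = ⊥-elim (<⇒≱ (0<⇒< ((<⇒0<- b<z) ⊠< (0≤b ⊞ 0≤b ≤⊞ <⇒0<- b<z))
        (solve 2 (λ z b → (z :- b) :* (b :+ b :+ (z :- b)) := z :* z :- b :* b) refl z b)) z²≤b²)

    +≈⇒≈- : ∀ {x y z} → x + y ≈ z → x ≈ z - y
    +≈⇒≈- {x} {y} x+y≈z = trans (solve 2 (λ x y → x := (x :+ y) :- y) refl x y) (+-congʳ x+y≈z)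

    cos-neg : ∀ x → cos (- x) ≈ cos x
    cos-neg x = trans (+≈⇒≈- (begin
      cos (- x) + cos x            ≈⟨ +-comm _ _ ⟩
      cos x + cos (- x)            ≈⟨ +-cong (cos-cong (+-identityˡ x)) (cos-cong (+-identityˡ (- x))) ⟨
      cos (0# + x) + cos (0# - x)  ≈⟨ cos-dAlembert 0# x ⟩
      two * (cos 0# * cos x)       ≈⟨ *-congˡ (trans (*-congʳ cos-0) (*-identityˡ _)) ⟩
      two * cos x                  ∎))
      (solve 1 (λ c → :2 :* c :- c := c) refl (cos x))

    cos-double : ∀ x → cos (x + x) ≈ two * (cos x * cos x) - 1#
    cos-double x = +≈⇒≈- (trans (+-congˡ (sym (trans (cos-cong (-‿inverseʳ x)) cos-0))) (cos-dAlembert x x))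

    cos-half : ∀ x → cos x ≈ two * (cos (half * x) * cos (half * x)) - 1#
    cos-half x = trans (cos-cong (sym (halve x))) (cos-double (half * x))

    -- Half of d'Alembert's equation at `x + y` and `x - y`, whose sum and difference are `x + x`
    -- and `y + y`.
    cos-product : ∀ x y → cos (x + y) * cos (x - y) ≈ cos x * cos x + cos y * cos y - 1#
    cos-product x y = begin
      P                   ≈⟨ trans (*-congʳ half*two) (*-identityˡ P) ⟨
      half * two * P      ≈⟨ *-assoc _ _ _ ⟩
      half * (two * P)    ≈⟨ *-congˡ (cos-dAlembert (x + y) (x - y)) ⟨
      half * (cos (x + y + (x - y)) + cos (x + y - (x - y)))
        ≈⟨ *-congˡ (+-cong
             (trans (cos-cong (solve 2 (λ x y → x :+ y :+ (x :- y) := x :+ x) refl x y)) (cos-double x))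
             (trans (cos-cong (solve 2 (λ x y → x :+ y :- (x :- y) := y :+ y) refl x y)) (cos-double y))) ⟩
      half * ((two * (cos x * cos x) - 1#) + (two * (cos y * cos y) - 1#))
        ≈⟨ solve 3 (λ h a b → h :* ((:2 :* a :- :1) :+ (:2 :* b :- :1)) :=
             (h :* :2) :* (a :+ b :- :1)) refl half (cos x * cos x) (cos y * cos y) ⟩
      half * two * (cos x * cos x + cos y * cos y - 1#)
        ≈⟨ trans (*-congʳ half*two) (*-identityˡ _) ⟩
      cos x * cos x + cos y * cos y - 1#  ∎
      where
      P : ℝ
      P = cos (x + y) * cos (x - y)
      half*two : half * two ≈ 1#
      half*two = trans (*-comm _ _) two*half

    -- The square of `2 sin x sin y`, computed as `(p + q)² - 4 p q` so that only cosines occur.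
    cos-difference : ∀ x y → (cos (x - y) - cos (x + y)) * (cos (x - y) - cos (x + y)) ≈
                             four * ((1# - cos x * cos x) * (1# - cos y * cos y))
    cos-difference x y = begin
      (q - p) * (q - p)            ≈⟨ solve 2 (λ p q → (q :- p) :* (q :- p) :=
                                        (p :+ q) :* (p :+ q) :- :2 :* :2 :* (p :* q)) refl p q ⟩
      (p + q) * (p + q) - four * (p * q)
        ≈⟨ +-cong (*-cong (cos-dAlembert x y) (cos-dAlembert x y)) (-‿cong (*-congˡ (cos-product x y))) ⟩
      two * (cos x * cos y) * (two * (cos x * cos y)) - four * (cos x * cos x + cos y * cos y - 1#)
        ≈⟨ solve 2 (λ a b → :2 :* (a :* b) :* (:2 :* (a :* b))
               :- :2 :* :2 :* (a :* a :+ b :* b :- :1) :=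
             :2 :* :2 :* ((:1 :- a :* a) :* (:1 :- b :* b))) refl (cos x) (cos y) ⟩
      four * ((1# - cos x * cos x) * (1# - cos y * cos y))  ∎
      where
      p q : ℝ
      p = cos (x + y)
      q = cos (x - y)

  opaque
    midpoint-+ : ∀ a b → half * (a + b) + half * (b - a) ≈ b
    midpoint-+ a b = trans (solve 3 (λ h a b → h :* (a :+ b) :+ h :* (b :- a) := (h :+ h) :* b) refl half a b)
      (trans (*-congʳ half+half) (*-identityˡ b))

    midpoint-- : ∀ a b → half * (a + b) - half * (b - a) ≈ a
    midpoint-- a b = trans (solve 3 (λ h a b → h :* (a :+ b) :- h :* (b :- a) := (h :+ h) :* a) refl half a b)
      (trans (*-congʳ half+half) (*-identityˡ a))

    cos-difference′ : ∀ a b → (cos a - cos b) * (cos a - cos b) ≈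
      four * ((1# - cos (half * (a + b)) * cos (half * (a + b))) * (1# - cos (half * (b - a)) * cos (half * (b - a))))
    cos-difference′ a b = trans (*-cong shift shift) (cos-difference (half * (a + b)) (half * (b - a)))
      where
      shift : cos a - cos b ≈ cos (half * (a + b) - half * (b - a)) - cos (half * (a + b) + half * (b - a))
      shift = +-cong (cos-cong (sym (midpoint-- a b))) (-‿cong (cos-cong (sym (midpoint-+ a b))))

    cos-bounds : ∀ {x} → ∣ x ∣≤ 1# → cos x ≤ 1# × 1# - cos x ≤ x * x
    cos-bounds {x} (l , u) with compare 0# x
    ... | tri< 0<x _ _ = <⇒≤ (cos<1 0<x u) , 1-cos≤ (<⇒≤ 0<x) u
    ... | tri≈ _ 0≈x _ = ≤-reflexive (trans (cos-cong (sym 0≈x)) cos-0) , 1-cos≤ (≤-reflexive 0≈x) u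
    ... | tri> _ _ x<0 = ≤-respˡ-≈ (cos-neg x) (<⇒≤ (cos<1 0<-x -x≤1)) ,
          ≤-respˡ-≈ (+-congˡ (-‿cong (cos-neg x)))
            (≤-respʳ-≈ (solve 1 (λ x → :- x :* :- x := x :* x) refl x) (1-cos≤ (<⇒≤ 0<-x) -x≤1))
      where
      0<-x : 0# < - x
      0<-x = <-respʳ-≈ (+-identityˡ (- x)) (<⇒0<- x<0)
      -x≤1 : - x ≤ 1#
      -x≤1 = 0≤⇒≤ (≤⇒0≤- l) (solve 1 (λ x → x :- :- :1 := :1 :- :- x) refl x)

    four*quarter* : ∀ x → four * (quarter * x) ≈ x
    four*quarter* x = trans (sym (*-assoc _ _ _)) (trans (*-congʳ four*quarter) (*-identityˡ x))

    small-radius : ∀ {ε} → 0# < ε → ∃[ δ ] 0# < δ × δ ≤ 1# × four * δ ≤ ε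
    small-radius {ε} 0<ε with ≤-or-> (quarter * ε) 1#
    ... | inj₁ ≤1 = quarter * ε , 0<quarter ⊠< 0<ε , ≤1 , ≤-reflexive (four*quarter* ε)
    ... | inj₂ 1< = 1# , 0<1 , ≤-refl ,
          ≤-trans (*-monoˡ-≤ (<⇒≤ (*-pos 0<two 0<two)) (<⇒≤ 1<)) (≤-reflexive (four*quarter* ε))

    -- In `cos-difference′` the first factor in parentheses is at most one, and the second,
    -- `1 - cos² h` with `h` half the difference of the arguments, is at most `2 h²`.
    cos-continuous : Continuous cos
    cos-continuous x ε 0<ε = let δ , 0<δ , δ≤1 , 4δ≤ε = small-radius 0<ε in
      δ , 0<δ , λ y y∼x → ∣∣-cong (solve 2 (λ a b → :- (a :- b) := b :- a) refl (cos x) (cos y)) refl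
        (∣∣-neg (sq⇒∣∣ (<⇒≤ 0<ε) (bound 0<δ δ≤1 4δ≤ε
          (∣∣-≤ (<⇒≤ (half*< 0<δ)) (∣∣-* (0≤⇒∣∣ (<⇒≤ 0<half) ≤-refl) y∼x)))))
      where
      bound : ∀ {δ y} → 0# < δ → δ ≤ 1# → four * δ ≤ ε → ∣ half * (y - x) ∣≤ δ →
              (cos x - cos y) * (cos x - cos y) ≤ ε * ε
      bound {δ} {y} 0<δ δ≤1 4δ≤ε h≤δ = ≤-respˡ-≈ (sym (cos-difference′ x y)) (≤-trans step₁ (≤-trans step₂ step₃))
        where
        h A c s : ℝ
        h = half * (y - x)
        A = cos (half * (x + y)) * cos (half * (x + y))
        c = cos h
        s = 1# - c * c
        c≤1 : c ≤ 1#
        c≤1 = proj₁ (cos-bounds (∣∣-≤ δ≤1 h≤δ))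
        1-c≤h² : 1# - c ≤ h * h
        1-c≤h² = proj₂ (cos-bounds (∣∣-≤ δ≤1 h≤δ))
        h²≤δ² : h * h ≤ δ * δ
        h²≤δ² = proj₂ (∣∣-* h≤δ h≤δ)
        δ²≤1 : δ * δ ≤ 1#
        δ²≤1 = 0≤⇒≤ (≤⇒0≤- δ≤1 ⊠ (0≤1 ⊞ <⇒≤ 0<δ)) (solve 1 (λ δ → (:1 :- δ) :* (:1 :+ δ) :=
              :1 :- δ :* δ) refl δ)
        0≤c : 0# ≤ c
        0≤c = 0≤⇒≤ (≤⇒0≤- (≤-trans 1-c≤h² (≤-trans h²≤δ² δ²≤1))) (solve 1 (λ c → :1 :- (:1 :- c) :=
              c :- :0) refl c)
        0≤s : 0# ≤ s
        0≤s = ≤-respʳ-≈ (solve 1 (λ c → (:1 :- c) :* (:1 :+ c) :=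
              :1 :- c :* c) refl c) (≤⇒0≤- c≤1 ⊠ (0≤1 ⊞ 0≤c))
        0≤four : 0# ≤ four
        0≤four = <⇒≤ (*-pos 0<two 0<two)
        step₁ : four * ((1# - A) * s) ≤ four * (two * (h * h))
        step₁ = *-monoˡ-≤ 0≤four (0≤⇒≤
          ((<⇒≤ 0<two ⊠ ≤⇒0≤- 1-c≤h²) ⊞ 0≤x² (1# - c) ⊞ (0≤x² _ ⊠ 0≤s))
          (solve 3 (λ h c A → :2 :* (h :* h :- (:1 :- c)) :+ (:1 :- c) :* (:1 :- c) :+ A :* (:1 :- c :* c) :=
            :2 :* (h :* h) :- (:1 :- A) :* (:1 :- c :* c)) refl h c A))
        step₂ : four * (two * (h * h)) ≤ (four * δ) * (four * δ)
        step₂ = ≤-trans (*-monoˡ-≤ 0≤four (≤-trans (*-monoˡ-≤ (<⇒≤ 0<two) h²≤δ²)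
          (0≤⇒≤ (<⇒≤ 0<two ⊠ 0≤x² δ) (solve 1 (λ δ → :2 :* (δ :* δ) :=
            :2 :* :2 :* (δ :* δ) :- :2 :* (δ :* δ)) refl δ))))
          (≤-reflexive (solve 2 (λ f δ → f :* (f :* (δ :* δ)) := (f :* δ) :* (f :* δ)) refl four δ))
        step₃ : (four * δ) * (four * δ) ≤ ε * ε
        step₃ = 0≤⇒≤ (≤⇒0≤- 4δ≤ε ⊠ (<⇒≤ 0<ε ⊞ (0≤four ⊠ <⇒≤ 0<δ)))
          (solve 2 (λ ε d → (ε :- d) :* (ε :+ d) := ε :* ε :- d :* d) refl ε (four * δ))

  doubling : ℕ → ℝ
  doubling zero    = 1#
  doubling (suc n) = doubling n + doubling n

  opaque
    0<doubling : ∀ n → 0# < doubling n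
    0<doubling zero    = 0<1
    0<doubling (suc n) = 0<doubling n ⊞≤ <⇒≤ (0<doubling n)

    -- While `cos x` is positive, `1 - cos 2x = 2 (1 - cos x) (1 + cos x)` is at least twice
    -- `1 - cos x`. The linear growth derived from this already contradicts `1 - cos x < 1`, so
    -- cosine cannot stay positive.
    1-cos-doubling : (∀ n → 0# < cos (doubling n)) →
      ∀ n → fromℕ (suc n) * (1# - cos 1#) ≤ 1# - cos (doubling n)
    1-cos-doubling 0<cos zero    = ≤-reflexive (solve 1 (λ k → (:1 :+ :0) :* k := k) refl _)
    1-cos-doubling 0<cos (suc n) = 0≤⇒≤
      ((<⇒≤ 0<two ⊠ ≤⇒0≤- (1-cos-doubling 0<cos n)) ⊞ (0≤fromℕ n ⊠ 0≤k)
        ⊞ (<⇒≤ 0<two ⊠ (<⇒≤ (0<cos n) ⊠ ≤-trans (0≤fromℕ (suc n) ⊠ 0≤k) (1-cos-doubling 0<cos n))))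
      (trans (solve 3 (λ n k c → :2 :* ((:1 :- c) :- (:1 :+ n) :* k) :+ n :* k :+ :2 :* (c :* (:1 :- c)) :=
          (:1 :- (:2 :* (c :* c) :- :1)) :- (:1 :+ (:1 :+ n)) :* k) refl (fromℕ n) k (cos (doubling n)))
        (+-congʳ (+-congˡ (-‿cong (sym (cos-double (doubling n)))))))
      where
      k : ℝ
      k = 1# - cos 1#
      0≤k : 0# ≤ k
      0≤k = ≤⇒0≤- (<⇒≤ (cos<1 0<1 ≤-refl))

  opaque
    cos-nonpositive : ∃[ n ] cos (doubling n) ≤ 0#
    cos-nonpositive with em {∃[ n ] cos (doubling n) ≤ 0#}
    ... | yes found = found
    ... | no none = ⊥-elim (beyond (archimedean (k ⁻¹)))
      where
      k : ℝ
      k = 1# - cos 1#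
      0<k : 0# < k
      0<k = <⇒0<- (cos<1 0<1 ≤-refl)
      0<cos : ∀ n → 0# < cos (doubling n)
      0<cos n = ≰⇒> λ ≤0 → none (n , ≤0)
      beyond : ¬ (∃[ n ] k ⁻¹ < fromℕ n)
      beyond (n , k⁻¹<n) = <⇒≱ (<-respˡ-≈ (⁻¹-inverse k (>⇒≉ 0<k)) (*-monoˡ-< 0<k k⁻¹<n))
        (0≤⇒≤ ((≤⇒0≤- (1-cos-doubling 0<cos n)) ⊞ <⇒≤ (0<cos n) ⊞ <⇒≤ 0<k)
          (solve 3 (λ n k c → ((:1 :- c) :- (:1 :+ n) :* k) :+ c :+ k :=
                :1 :- k :* n) refl (fromℕ n) k (cos (doubling n))))

    least-zero : ∃[ h ] FirstZero cos 0# h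
    least-zero = let n , cos≤0 = cos-nonpositive
                     h , zero-h , _ = first-zero cos-continuous (<-respʳ-≈ (sym cos-0) 0<1) (<⇒≤ (0<doubling n)) cos≤0 cos-cong
                 in h , zero-h

  IsHalfPi : ℝ → Set
  IsHalfPi h = 0# < h × cos h ≈ 0# × (∀ t → 0# < t → t < h → ¬ cos t ≈ 0#)

  opaque
    half-pi : IsHalfPi π/2
    half-pi = the-satisfies IsHalfPi (let h , 0<h , cos-h , 0<cos = least-zero in
      h , 0<h , cos-h , λ t 0<t t<h → >⇒≉ (0<cos t (<⇒≤ 0<t) t<h))

  opaque
    0<π/2 : 0# < π/2
    0<π/2 = proj₁ half-pi

    cos-π/2 : cos π/2 ≈ 0#
    cos-π/2 = proj₁ (proj₂ half-pi)

    -- Cosine is positive before the zero found by `first-zero`, and that zero cannot precede `π/2`,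
    -- the least positive one.
    cos-positive : ∀ t → 0# ≤ t → t < π/2 → 0# < cos t
    cos-positive t 0≤t t<π/2 = let h , 0<h , cos-h , 0<cos = least-zero in 0<cos t 0≤t
      (<-≤-trans t<π/2 (≮⇒≥ λ h<π/2 → proj₂ (proj₂ half-pi) h 0<h h<π/2 cos-h))

    0<π : 0# < π
    0<π = 0<π/2 ⊞≤ <⇒≤ 0<π/2

    cos-π : cos π ≈ - 1#
    cos-π = trans (cos-double π/2) (trans (+-congʳ (*-congˡ (*-cong cos-π/2 cos-π/2)))
      (solve 1 (λ a → :2 :* (:0 :* :0) :- :1 := :- :1) refl 1#))

  opaque
    halfπ≈π/2 : half * π ≈ π/2
    halfπ≈π/2 = trans (solve 2 (λ h p → h :* (p :+ p) := (h :+ h) :* p) refl half π/2)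
      (trans (*-congʳ half+half) (*-identityˡ π/2))

    half<π/2 : ∀ {x} → x < π → half * x < π/2
    half<π/2 x<π = <-respʳ-≈ halfπ≈π/2 (*-monoˡ-< 0<half x<π)

    -- The series gives `cos x < 1` for `0 < x ≤ 1`. Repeated halving reaches this range, and
    -- `1 - cos x = 2 (1 - c) (1 + c)` with `c = cos (half * x)` leads back, `c` being positive in
    -- the first quadrant.
    cos<1-halving : ∀ n {x} → 0# < x → x < π/2 → x * half ^ n ≤ 1# → cos x < 1#
    cos<1-halving zero    0<x _ x≤1 = cos<1 0<x (≤-respˡ-≈ (*-identityʳ _) x≤1)
    cos<1-halving (suc n) {x} 0<x x<π/2 small = 0<⇒<
      (0<two ⊠< (<⇒0<- c<1 ⊠< (0<1 ⊞≤ <⇒≤ 0<c)))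
      (trans (solve 1 (λ c → :2 :* ((:1 :- c) :* (:1 :+ c)) := :1 :- (:2 :* (c :* c) :- :1)) refl c)
        (+-congˡ (-‿cong (sym (cos-half x)))))
      where
      c : ℝ
      c = cos (half * x)
      x/2<π/2 : half * x < π/2
      x/2<π/2 = <-trans (half*< 0<x) x<π/2
      0<c : 0# < c
      0<c = cos-positive (half * x) (<⇒≤ (0<half* 0<x)) x/2<π/2
      c<1 : c < 1#
      c<1 = cos<1-halving n (0<half* 0<x) x/2<π/2
        (≤-respˡ-≈ (solve 3 (λ x h p → x :* (h :* p) := (h :* x) :* p) refl x half (half ^ n)) small)

    cos<1-first-quadrant : ∀ {x} → 0# < x → x < π/2 → cos x < 1#
    cos<1-first-quadrant {x} 0<x x<π/2 = let N , small = half^-small x 0<1 in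
      cos<1-halving N 0<x x<π/2 (<⇒≤ (small N (ℕ.≤-refl)))

    ∣cos∣<1 : ∀ {x} → 0# < x → x < π → - 1# < cos x × cos x < 1#
    ∣cos∣<1 {x} 0<x x<π =
      0<⇒< (0<two ⊠< (0<c ⊠< 0<c))
        (trans (solve 1 (λ c → :2 :* (c :* c) := (:2 :* (c :* c) :- :1) :- :- :1) refl c)
          (+-congʳ (sym (cos-half x)))) ,
      0<⇒< (0<two ⊠< (<⇒0<- c<1 ⊠< (0<1 ⊞≤ <⇒≤ 0<c)))
        (trans (solve 1 (λ c → :2 :* ((:1 :- c) :* (:1 :+ c)) := :1 :- (:2 :* (c :* c) :- :1)) refl c)
          (+-congˡ (-‿cong (sym (cos-half x)))))
      where
      c : ℝ
      c = cos (half * x)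
      0<c : 0# < c
      0<c = cos-positive (half * x) (<⇒≤ (0<half* 0<x)) (half<π/2 x<π)
      c<1 : c < 1#
      c<1 = cos<1-first-quadrant (0<half* 0<x) (half<π/2 x<π)

    0<1-cos² : ∀ {x} → 0# < x → x < π → 0# < 1# - cos x * cos x
    0<1-cos² {x} 0<x x<π = let -1<c , c<1 = ∣cos∣<1 0<x x<π in
      <-respʳ-≈ (solve 1 (λ c → (:1 :- c) :* (c :- :- :1) :=
            :1 :- c :* c) refl (cos x)) (<⇒0<- c<1 ⊠< <⇒0<- -1<c)

    -- Midpoint and half difference of `a` and `b` lie strictly between 0 and `π`, so no factor in
    -- `cos-difference′` vanishes.
    cos-injective : ∀ {a b} → 0# ≤ a → a < b → b ≤ π → ¬ cos a ≈ cos b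
    cos-injective {a} {b} 0≤a a<b b≤π cos≈ = >⇒≉
      ((*-pos 0<two 0<two) ⊠< (0<1-cos² 0<x x<π ⊠< 0<1-cos² 0<y y<π))
      (trans (sym (cos-difference′ a b)) (trans (*-congʳ (trans (+-congʳ cos≈) (-‿inverseʳ _))) (zeroˡ _)))
      where
      0<b : 0# < b
      0<b = ≤-<-trans 0≤a a<b
      0<x : 0# < half * (a + b)
      0<x = 0<half* (0≤a ≤⊞ 0<b)
      x<π : half * (a + b) < π
      x<π = 0<⇒< (0<half* (<⇒0<- (<-≤-trans a<b b≤π) ⊞≤ ≤⇒0≤- b≤π))
        (trans (solve 4 (λ h a b p → h :* ((p :- a) :+ (p :- b)) :=
              (h :* p :+ h :* p) :- h :* (a :+ b)) refl half a b π)
          (+-congʳ (halve π)))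
      0<y : 0# < half * (b - a)
      0<y = 0<half* (<⇒0<- a<b)
      y<π : half * (b - a) < π
      y<π = 0<⇒< (0<half* (0<π ⊞≤ (≤⇒0≤- b≤π ⊞ 0≤a)))
        (trans (solve 4 (λ h a b p → h :* (p :+ ((p :- b) :+ a)) :=
              (h :* p :+ h :* p) :- h :* (b :- a)) refl half a b π)
          (+-congʳ (halve π)))

    cos<1-upto-π : ∀ {x} → 0# < x → x ≤ π → cos x < 1#
    cos<1-upto-π 0<x (inj₁ x<π) = proj₂ (∣cos∣<1 0<x x<π)
    cos<1-upto-π 0<x (inj₂ x≈π) = <-respˡ-≈ (sym (trans (cos-cong x≈π) cos-π))
      (0<⇒< (0<1 ⊞≤ 0≤1) (solve 1 (λ a → :1 :+ :1 := :1 :- :- :1) refl 1#))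

    -1≤cos : ∀ {x} → 0# ≤ x → x ≤ π → - 1# ≤ cos x
    -1≤cos (inj₁ 0<x) (inj₁ x<π) = <⇒≤ (proj₁ (∣cos∣<1 0<x x<π))
    -1≤cos _ (inj₂ x≈π) = ≤-reflexive (sym (trans (cos-cong x≈π) cos-π))
    -1≤cos (inj₂ 0≈x) _ = ≤-respʳ-≈ (trans (sym cos-0) (cos-cong 0≈x))
      (0≤⇒≤ (<⇒≤ 0<two) (solve 1 (λ a → :1 :+ :1 := :1 :- :- :1) refl 1#))

    cos-value : ∀ {u b} → u < 1# → 0# ≤ b → cos b ≤ u → ∃[ t ] 0# < t × t ≤ b × cos t ≈ u
    cos-value {u} {b} u<1 0≤b cosb≤u =
      let h , (0<h , zero-h , _) , h≤b = first-zero {λ t → cos t - u} continuous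
            (<-respʳ-≈ (+-congʳ (sym cos-0)) (<⇒0<- u<1)) 0≤b
            (0≤⇒≤ (≤⇒0≤- cosb≤u) (solve 2 (λ c u → u :- c := :0 :- (c :- u)) refl (cos b) u))
            (λ x≈y → +-congʳ (cos-cong x≈y))
      in h , 0<h , h≤b , x-y≈0⇒x≈y zero-h
      where
      continuous : Continuous (λ t → cos t - u)
      continuous x ε 0<ε = let δ , 0<δ , near = cos-continuous x ε 0<ε in
        δ , 0<δ , λ y y∼x → ∣∣-cong (solve 3 (λ a b u → b :- a :=
              (b :- u) :- (a :- u)) refl (cos x) (cos y) u) refl
          (near y y∼x)

    -- If `cos a ≤ cos b`, then cosine, starting from 1 at 0, takes the value `cos b` at some
    -- `h ≤ a`, against injectivity.
    cos-decreasing : ∀ {a b} → 0# ≤ a → a < b → b ≤ π → cos b < cos a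
    cos-decreasing {a} {b} 0≤a a<b b≤π = ≰⇒> λ cosa≤cosb →
      let h , 0<h , h≤a , cosh≈cosb = cos-value (cos<1-upto-π (≤-<-trans 0≤a a<b) b≤π) 0≤a cosa≤cosb
      in cos-injective (<⇒≤ 0<h) (≤-<-trans h≤a a<b) b≤π cosh≈cosb

    cos-cancel-< : ∀ {a b} → 0# ≤ b → a ≤ π → cos b < cos a → a < b
    cos-cancel-< {a} {b} 0≤b a≤π cosb<cosa = ≰⇒> λ where
      (inj₁ b<a) → <⇒≱ cosb<cosa (<⇒≤ (cos-decreasing 0≤b b<a a≤π))
      (inj₂ b≈a) → <⇒≉ cosb<cosa (cos-cong b≈a)

  IsArccos : ℝ → ℝ → Set
  IsArccos u t = 0# ≤ t × t ≤ π × cos t ≈ u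

  opaque
    arccos-correct : ∀ {u} → - 1# ≤ u → u ≤ 1# → IsArccos u (arccos u)
    arccos-correct {u} -1≤u u≤1 = the-satisfies (IsArccos u) (exists u≤1)
      where
      exists : u ≤ 1# → ∃ (IsArccos u)
      exists (inj₂ u≈1) = 0# , ≤-refl , <⇒≤ 0<π , trans cos-0 (sym u≈1)
      exists (inj₁ u<1) = let t , 0<t , t≤π , cost≈u = cos-value u<1 (<⇒≤ 0<π) (≤-respˡ-≈ (sym cos-π) -1≤u)
                          in t , <⇒≤ 0<t , t≤π , cost≈u

  -- This is `2 sin (t / 2)`, the chord of the angle `t` in the unit circle, with the sine written
  -- as the cosine of the complement.
  chord : ℝ → ℝ
  chord t = two * cos (π/2 - half * t)

  opaque
    -- As `cos π/2` is zero, d'Alembert's equation gives `p + s = 0` and `cos-product` gives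
    -- `p s = cos² x - 1`, whence `s² = - p s = 1 - cos² x`.
    cos²+cos²-complement : ∀ x → cos x * cos x + cos (π/2 - x) * cos (π/2 - x) ≈ 1#
    cos²+cos²-complement x = begin
      a + s * s
        ≈⟨ solve 3 (λ a s p → a :+ s :* s := (p :+ s) :* s :+ (a :- p :* s)) refl a s p ⟩
      (p + s) * s + (a - p * s)
        ≈⟨ +-cong (*-congʳ (trans (cos-dAlembert π/2 x) (*-congˡ (trans (*-congʳ cos-π/2) (zeroˡ _)))))
                  (+-congˡ (-‿cong (trans (cos-product π/2 x) (+-congʳ (+-congʳ (*-cong cos-π/2 cos-π/2)))))) ⟩
      two * 0# * s + (a - (0# * 0# + a - 1#))
        ≈⟨ solve 3 (λ t s a → t :* :0 :* s :+ (a :- (:0 :* :0 :+ a :- :1)) := :1) refl two s a ⟩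
      1#  ∎
      where
      a s p : ℝ
      a = cos x * cos x
      s = cos (π/2 - x)
      p = cos (π/2 + x)

    chord² : ∀ t → chord t * chord t ≈ two * (1# - cos t)
    chord² t = begin
      (two * s) * (two * s)  ≈⟨ solve 3 (λ t s a → (t :* s) :* (t :* s) :=
            t :* (t :* (a :+ s :* s) :- t :* a)) refl two s a ⟩
      two * (two * (a + s * s) - two * a)
        ≈⟨ *-congˡ (+-congʳ (*-congˡ (cos²+cos²-complement (half * t)))) ⟩
      two * (two * 1# - two * a)
        ≈⟨ *-congˡ (solve 1 (λ a → :2 :* :1 :- :2 :* a := :1 :- (:2 :* a :- :1)) refl a) ⟩
      two * (1# - (two * a - 1#))  ≈⟨ *-congˡ (+-congˡ (-‿cong (cos-half t))) ⟨
      two * (1# - cos t)  ∎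
      where
      a s : ℝ
      a = cos (half * t) * cos (half * t)
      s = cos (π/2 - half * t)

    0<chord : ∀ {t} → 0# < t → t ≤ π → 0# < chord t
    0<chord {t} 0<t t≤π = 0<two ⊠< cos-positive (π/2 - half * t)
      (≤⇒0≤- (≤-respʳ-≈ halfπ≈π/2 (*-monoˡ-≤ (<⇒≤ 0<half) t≤π)))
      (0<⇒< (0<half* 0<t) (solve 2 (λ p h → h := p :- (p :- h)) refl π/2 (half * t)))

    chord-increasing : ∀ {s t} → 0# < s → s < t → t ≤ π → chord s < chord t
    chord-increasing {s} {t} 0<s s<t t≤π = sq-cancel-< (<⇒≤ (0<chord (<-trans 0<s s<t) t≤π))
      (<-respˡ-≈ (sym (chord² s)) (<-respʳ-≈ (sym (chord² t)) (*-monoˡ-< 0<two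
        (0<⇒< (<⇒0<- (cos-decreasing (<⇒≤ 0<s) s<t t≤π))
          (solve 2 (λ a b → a :- b := (:1 :- b) :- (:1 :- a)) refl (cos s) (cos t))))))

    chord≤2 : ∀ {t} → 0# ≤ t → t ≤ π → chord t ≤ two
    chord≤2 {t} 0≤t t≤π = proj₂ (sq⇒∣∣ (<⇒≤ 0<two) (≤-respˡ-≈ (sym (chord² t))
      (0≤⇒≤ (<⇒≤ 0<two ⊠ ≤⇒0≤- (-1≤cos 0≤t t≤π))
        (solve 1 (λ c → :2 :* (c :- :- :1) := :2 :* :2 :- :2 :* (:1 :- c)) refl (cos t)))))

-- From g.e.c. graphs to models of a geometry.

module GeometricGraphs (em : ExcludedMiddle 0ℓ) (R : RealField) where
  open Trigonometry em R public
  open Graphs em R public using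
    (RawMetricSpace; Graph; IsGEC; graphStructure; IsCommonTheory)
  open Comparison em public
  open FewNeighbours em using (Edge)

  module _ (𝕏 : RawMetricSpace) (G : Geometry) where
    open RawMetricSpace 𝕏
    open Geometry G

    -- The last hypothesis carries density over: points of `𝕏` sufficiently close to a suitable `p`
    -- have positions near the given `x`.
    gec-model : ∀ (Γ : Graph 𝕏) → IsGEC 𝕏 Γ →
      ∀ {_∼_ : Rel X 0ℓ} (position : Point → X) →
      (∀ {u v} → d u v < 1# → position u ∼ position v) →
      (∀ {u v} → position u ∼ position v → d u v < 1#) →
      (∀ x → Σ Point λ p → ∃[ δ ] 0# < δ × (∀ q → d p q < δ → Near x (position q))) →
      Model G _∼_ (graphStructure 𝕏 Γ)
    gec-model Γ gec {_∼_} position d<1⇒∼ ∼⇒d<1 approach = record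
      { position  = λ v → position (proj₁ v)
      ; geometric = λ e → d<1⇒∼ (geometric e)
      ; dense     = λ x → let p , δ , 0<δ , near = approach x
                              q , q∈V , pq<δ = dense p δ 0<δ
                          in (q , q∈V) , near q pq<δ
      ; extension = extend
      }
      where
      open IsGEC gec
      open Graph Γ
      extend : ∀ s (A : List (Σ Point Vertex)) → All (λ a → position (proj₁ s) ∼ position (proj₁ a)) A →
               ∃[ v ] All (Edge (graphStructure 𝕏 Γ) v) A
      -- What is wanted of the new vertex is its adjacency to `A`, so any positive distance from `s`
      -- may be prescribed; it is `1#`.
      extend s A s∼A = let v , v∈V , _ , _ , adjacent , _ = extension (proj₁ s) (List.map proj₁ A) [] 1# (proj₂ s)
                             (All.map⁺ (All.universal proj₂ A)) [] (All.universal (λ _ → []) _)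
                             (All.map⁺ (All.map ∼⇒d<1 s∼A)) [] 0<1
                       in (v , v∈V) , All.map⁻ adjacent

  module _ {𝕏₁ 𝕏₂ : RawMetricSpace} {𝒫₁ 𝒫₂} {T₁ T₂}
           (common₁ : IsCommonTheory 𝕏₁ 𝒫₁ T₁) (common₂ : IsCommonTheory 𝕏₂ 𝒫₂ T₂) (G : Geometry) where
    open Geometry G
    private
      module C₁ = IsCommonTheory common₁
      module C₂ = IsCommonTheory common₂

    -- Equal common theories would carry every sentence from a graph of the first kind to one of the
    -- second, which `distinguished` refutes.
    distinct-theories : ∀ {_∼₁_ _∼₂_ : Rel X 0ℓ} →
      (∀ {x y} → x ∼₁ y → Ball 0 x y) → (∀ {x y} → Ball 7 x y → x ∼₂ y) →
      (∀ Γ → IsGEC 𝕏₁ Γ → Model G _∼₁_ (graphStructure 𝕏₁ Γ)) →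
      (∀ Γ → IsGEC 𝕏₂ Γ → Model G _∼₂_ (graphStructure 𝕏₂ Γ)) →
      ¬ (T₁ ≐ T₂)
    distinct-theories ∼₁⇒Ball₀ Ball₇⇒∼₂ model₁ model₂ T₁≐T₂ =
      let Γ₁ , gec₁ , P₁ = C₁.inhabited
          Γ₂ , gec₂ , P₂ = C₂.inhabited
      in distinguished G ∼₁⇒Ball₀ Ball₇⇒∼₂ (model₁ Γ₁ gec₁) (model₂ Γ₂ gec₂)
           (λ φ φ∈Th₁ → proj₁ (C₂.common Γ₂ gec₂ P₂) {φ} (proj₁ T₁≐T₂ {φ}
             (proj₂ (C₁.common Γ₁ gec₁ P₁) {φ} φ∈Th₁)))

  infix 4 ∣_∣<_
  ∣_∣<_ : ℝ → ℝ → Set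
  ∣ z ∣< b = - b < z × z < b

  opaque
    ∣∣<-cong : ∀ {z z′ b b′} → z ≈ z′ → b ≈ b′ → ∣ z ∣< b → ∣ z′ ∣< b′
    ∣∣<-cong z≈ b≈ (l , u) = <-respˡ-≈ (-‿cong b≈) (<-respʳ-≈ z≈ l) , <-respˡ-≈ z≈ (<-respʳ-≈ b≈ u)

    ∣∣<-≤ : ∀ {z b c} → b ≤ c → ∣ z ∣< b → ∣ z ∣< c
    ∣∣<-≤ {b = b} {c} b≤c (l , u) =
      ≤-<-trans (0≤⇒≤ (≤⇒0≤- b≤c) (solve 2 (λ b c → c :- b := :- b :- :- c) refl b c)) l , <-≤-trans u b≤c

    ∣∣<-neg : ∀ {z b} → ∣ z ∣< b → ∣ - z ∣< b
    ∣∣<-neg {z} {b} (l , u) =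
      0<⇒< (<⇒0<- u) (solve 2 (λ z b → b :- z := :- z :- :- b) refl z b) ,
      0<⇒< (<⇒0<- l) (solve 2 (λ z b → z :- :- b := b :- :- z) refl z b)

    ∣∣<-+ : ∀ {z w b c} → ∣ z ∣< b → ∣ w ∣< c → ∣ z + w ∣< b + c
    ∣∣<-+ {z} {w} {b} {c} (l , u) (l′ , u′) =
      0<⇒< (<⇒0<- l ⊞≤ <⇒≤ (<⇒0<- l′))
        (solve 4 (λ z w b c → (z :- :- b) :+ (w :- :- c) := (z :+ w) :- :- (b :+ c)) refl z w b c) ,
      0<⇒< (<⇒0<- u ⊞≤ <⇒≤ (<⇒0<- u′))
        (solve 4 (λ z w b c → (b :- z) :+ (c :- w) := (b :+ c) :- (z :+ w)) refl z w b c)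

    0≤⇒∣∣< : ∀ {z b} → 0# ≤ z → z < b → ∣ z ∣< b
    0≤⇒∣∣< {z} {b} 0≤z z<b =
      0<⇒< (0≤z ≤⊞ ≤-<-trans 0≤z z<b) (solve 2 (λ z b → z :+ b := z :- :- b) refl z b) , z<b

    ∣∣<-scale : ∀ {z b c} → 0# < c → ∣ z ∣< b → ∣ c * z ∣< c * b
    ∣∣<-scale {z} {b} {c} 0<c (l , u) =
      <-respˡ-≈ (solve 2 (λ b c → c :* :- b := :- (c :* b)) refl b c) (*-monoˡ-< 0<c l) , *-monoˡ-< 0<c u

    ∣∣≤⇒∣∣< : ∀ {z b c} → b < c → ∣ z ∣≤ b → ∣ z ∣< c
    ∣∣≤⇒∣∣< {z} {b} {c} b<c (l , u) =
      <-≤-trans (0<⇒< (<⇒0<- b<c) (solve 2 (λ b c → c :- b := :- b :- :- c) refl b c)) l , ≤-<-trans u b<c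

    abs<⇒∣∣< : ∀ {z b} → abs z < b → ∣ z ∣< b
    abs<⇒∣∣< {z} {b} abs<b with z <? 0#
    ... | yes z<0 = ∣∣<-cong (solve 1 (λ z → :- :- z := z) refl z) refl (∣∣<-neg
          (0≤⇒∣∣< (≤-respʳ-≈ (+-identityˡ (- z)) (≤⇒0≤- (<⇒≤ z<0))) abs<b))
    ... | no z≮0  = 0≤⇒∣∣< (≮⇒≥ z≮0) abs<b

    ∣∣<⇒abs< : ∀ {z b} → ∣ z ∣< b → abs z < b
    ∣∣<⇒abs< {z} {b} z<b with z <? 0#
    ... | yes _ = proj₂ (∣∣<-neg z<b)
    ... | no _  = proj₂ z<b

    interval-net : ∀ a b ε → 0# < ε → ∃[ gs ] (∀ x → a ≤ x → x ≤ b → Any (λ g → ∣ x - g ∣≤ ε) gs)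
    interval-net a b ε 0<ε = let n , b-a<n = archimedean ((b - a) * ε ⁻¹) in
      steps a n , λ x a≤x x≤b → covered n a x a≤x (≤-trans x≤b (<⇒≤ (0<⇒< (0<ε ⊠< <⇒0<- b-a<n)
        (trans (solve 5 (λ a b ε i n → ε :* (n :- (b :- a) :* i) :=
              a :+ n :* ε :- (a :+ (b :- a) :* (ε :* i))) refl
                  a b ε (ε ⁻¹) (fromℕ n))
          (+-congˡ (-‿cong (trans (+-congˡ (trans (*-congˡ (⁻¹-inverse ε (>⇒≉ 0<ε))) (*-identityʳ _)))
            (solve 2 (λ a b → a :+ (b :- a) := b) refl a b))))))))
      where
      steps : ℝ → ℕ → List ℝ
      steps a zero    = a ∷ []
      steps a (suc n) = a ∷ steps (a + ε) n
      near : ∀ {a x} → a ≤ x → x ≤ a + ε → ∣ x - a ∣≤ ε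
      near {a} {x} a≤x x≤a+ε = 0≤⇒∣∣ (≤⇒0≤- a≤x)
        (0≤⇒≤ (≤⇒0≤- x≤a+ε) (solve 3 (λ a x ε → (a :+ ε) :- x := ε :- (x :- a)) refl a x ε))
      covered : ∀ n a x → a ≤ x → x ≤ a + fromℕ n * ε → Any (λ g → ∣ x - g ∣≤ ε) (steps a n)
      covered zero a x a≤x x≤a = here (near a≤x (≤-trans x≤a
        (0≤⇒≤ (<⇒≤ 0<ε) (solve 2 (λ a ε → ε := (a :+ ε) :- (a :+ :0 :* ε)) refl a ε))))
      covered (suc n) a x a≤x x≤ with ≤-or-> x (a + ε)
      ... | inj₁ x≤a+ε = here (near a≤x x≤a+ε)
      ... | inj₂ a+ε<x = there (covered n (a + ε) x (<⇒≤ a+ε<x)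
            (≤-respʳ-≈ (solve 3 (λ a ε n → a :+ (:1 :+ n) :* ε := (a :+ ε) :+ n :* ε) refl a ε (fromℕ n)) x≤))

    -- Seven is the largest index of `Ball` in the comparison: `Ball 0` gets the radius `θ₁` and
    -- `Ball 7` the radius `θ₂`.
    step : ∀ {θ₁ θ₂} → θ₁ < θ₂ → ∃[ ε ] 0# < ε × θ₁ + fromℕ 7 * ε ≈ θ₂
    step {θ₁} {θ₂} θ₁<θ₂ = (θ₂ - θ₁) * fromℕ 7 ⁻¹ , <⇒0<- θ₁<θ₂ ⊠< ⁻¹-pos (0<fromℕ-suc 6) ,
      trans (+-congˡ (trans (solve 3 (λ s d i → s :* (d :* i) :=
            d :* (s :* i)) refl (fromℕ 7) (θ₂ - θ₁) (fromℕ 7 ⁻¹))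
              (trans (*-congˡ (suc-inverse 6)) (*-identityʳ _))))
        (solve 2 (λ a b → a :+ (b :- a) := b) refl θ₁ θ₂)

    radius-≤ : ∀ {θ ε} m {n} → 0# ≤ ε → m ℕ.≤ n → θ + fromℕ m * ε ≤ θ + fromℕ n * ε
    radius-≤ {θ} {ε} m {n} 0≤ε m≤n = 0≤⇒≤ (≤⇒0≤- (fromℕ-mono m≤n) ⊠ 0≤ε)
      (solve 4 (λ θ ε m n → (n :- m) :* ε := (θ :+ n :* ε) :- (θ :+ m :* ε)) refl θ ε (fromℕ m) (fromℕ n))

-- Circles, rescaled to ℝ/ℤ.

module Circles (em : ExcludedMiddle 0ℓ) (R : RealField) where
  open import Data.Integer.Base using (+_)
  open GeometricGraphs em R public
  open Graphs em R using (_≈modL_; rep; circle; IsCircleTheory)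

  opaque
    fromℤ≈embed : ∀ i → fromℤ i ≈ embed i
    fromℤ≈embed (+ n)    = Mult.×ᵤ≈× semiring n 1#
    fromℤ≈embed -[1+ n ] = -‿cong (Mult.×ᵤ≈× semiring (suc n) 1#)

    fromℤ-+ : ∀ i j → fromℤ (i ℤ.+ j) ≈ fromℤ i + fromℤ j
    fromℤ-+ i j = trans (fromℤ≈embed (i ℤ.+ j))
      (trans (embed-+ i j) (sym (+-cong (fromℤ≈embed i) (fromℤ≈embed j))))

    fromℤ-neg : ∀ i → fromℤ (ℤ.- i) ≈ - fromℤ i
    fromℤ-neg i = trans (fromℤ≈embed (ℤ.- i)) (trans (embed-neg i) (-‿cong (sym (fromℤ≈embed i))))

    fromℤ-- : ∀ i j → fromℤ (i ℤ.- j) ≈ fromℤ i - fromℤ j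
    fromℤ-- i j = trans (fromℤ-+ i (ℤ.- j)) (+-congˡ (fromℤ-neg j))

    -- `go` subtracts ones from a nonnegative number; a general `x` is first shifted by a natural
    -- number.
    floor : ∀ x → ∃[ k ] 0# ≤ x - fromℤ k × x - fromℤ k < 1#
    floor x = let N , -x<N = archimedean (- x)
                  M , x+N<M = archimedean (x + fromℕ N)
                  k , 0≤ , <1 = go M (x + fromℕ N)
                    (0≤⇒≤ (<⇒≤ (<⇒0<- -x<N)) (solve 2 (λ x n → n :- :- x :=
                          (x :+ n) :- :0) refl x (fromℕ N))) x+N<M
                  shift = trans (solve 3 (λ x n k → (x :+ n) :- k := x :- (k :- n)) refl x (fromℕ N) (fromℕ k))
                            (+-congˡ (-‿cong (sym (fromℤ-- (+ k) (+ N)))))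
              in (+ k) ℤ.- (+ N) , ≤-respʳ-≈ shift 0≤ , <-respˡ-≈ shift <1
      where
      go : ∀ M x → 0# ≤ x → x < fromℕ M → ∃[ k ] 0# ≤ x - fromℕ k × x - fromℕ k < 1#
      go zero    x 0≤x x<0 = ⊥-elim (<⇒≱ x<0 0≤x)
      go (suc M) x 0≤x x<M with ≤-or-> 1# x
      ... | inj₂ x<1 = 0 , ≤-respʳ-≈ (solve 1 (λ x → x := x :- :0) refl x) 0≤x ,
            <-respˡ-≈ (solve 1 (λ x → x := x :- :0) refl x) x<1
      ... | inj₁ 1≤x = let k , 0≤ , <1 = go M (x - 1#) (≤⇒0≤- 1≤x)
                             (0<⇒< (<⇒0<- x<M) (solve 2 (λ x m → (:1 :+ m) :- x :=
                                   m :- (x :- :1)) refl x (fromℕ M)))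
                           shift = solve 2 (λ x k → (x :- :1) :- k := x :- (:1 :+ k)) refl x (fromℕ k)
                       in suc k , ≤-respʳ-≈ shift 0≤ , <-respˡ-≈ shift <1

  -- Distance less than `t` in ℝ/ℤ, the circle of length one to which all circles are rescaled.
  Cyclic : ℝ → ℝ → ℝ → Set
  Cyclic t x y = ∃[ k ] ∣ x - y - fromℤ k ∣< t

  opaque
    Cyclic-refl : ∀ {t x} → 0# < t → Cyclic t x x
    Cyclic-refl {t} {x} 0<t = + 0 , ∣∣<-cong (solve 1 (λ x → :0 :=
          x :- x :- :0) refl x) refl (0≤⇒∣∣< ≤-refl 0<t)

    Cyclic-sym : ∀ {t x y} → Cyclic t x y → Cyclic t y x
    Cyclic-sym {t} {x} {y} (k , near) = ℤ.- k , ∣∣<-cong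
      (trans (solve 3 (λ x y k → :- (x :- y :- k) := y :- x :- :- k) refl x y (fromℤ k))
        (+-congˡ (-‿cong (sym (fromℤ-neg k))))) refl (∣∣<-neg near)

    Cyclic-trans : ∀ {s t x y z} → Cyclic s x y → Cyclic t y z → Cyclic (s + t) x z
    Cyclic-trans {s} {t} {x} {y} {z} (k , near) (l , near′) = k ℤ.+ l , ∣∣<-cong
      (trans (solve 5 (λ x y z k l → (x :- y :- k) :+ (y :- z :- l) :=
            x :- z :- (k :+ l)) refl x y z (fromℤ k) (fromℤ l))
        (+-congˡ (-‿cong (sym (fromℤ-+ k l))))) refl (∣∣<-+ near near′)

    Cyclic-≤ : ∀ {s t x y} → s ≤ t → Cyclic s x y → Cyclic t x y
    Cyclic-≤ s≤t (k , near) = k , ∣∣<-≤ s≤t near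

    -- A translation by `k ≥ 0` does not shorten the difference `- t`, and one by `k < 0` leaves at
    -- least `1 - t`, which is no less than `t` because `t ≤ half`.
    ¬Cyclic : ∀ {t x} → 0# ≤ t → t ≤ half → ¬ Cyclic t x (x + t)
    ¬Cyclic {t} {x} 0≤t t≤½ (k , l , u) = case k l u
      where
      case : ∀ k → - t < x - (x + t) - fromℤ k → ¬ (x - (x + t) - fromℤ k < t)
      case (+ n) l u = <⇒≱ l (0≤⇒≤ (0≤fromℕ n)
        (solve 3 (λ x t n → n := :- t :- (x :- (x :+ t) :- n)) refl x t (fromℕ n)))
      case -[1+ n ] l u = <⇒≱ u (0≤⇒≤ (≤⇒0≤- t≤½ ⊞ ≤⇒0≤- t≤½ ⊞ 0≤fromℕ n)
        (trans (solve 3 (λ t h n → (h :- t) :+ (h :- t) :+ n := (h :+ h) :+ n :- t :- t) refl t half (fromℕ n))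
          (trans (+-congʳ (+-congʳ (+-congʳ half+half)))
            (solve 3 (λ x t n → :1 :+ n :- t :- t :=
                  (x :- (x :+ t) :- :- (:1 :+ n)) :- t) refl x t (fromℕ n)))))

  -- The number `half` is the diameter of ℝ/ℤ, so the last hypothesis lets `shell` find a point at
  -- distance exactly `θ + 4 ε`.
  circleGeometry : ∀ θ ε → 0# < θ → 0# < ε → θ + fromℕ 4 * ε ≤ half → Geometry
  circleGeometry θ ε 0<θ 0<ε small = record
    { X         = ℝ
    ; Near      = Cyclic ε
    ; Ball      = λ k → Cyclic (θ + fromℕ k * ε)
    ; centre    = 0#
    ; Near-refl = Cyclic-refl 0<ε
    ; Near-sym  = Cyclic-sym
    ; Ball-sym  = Cyclic-sym
    ; Ball-Near = λ {k} b n → Cyclic-≤ (≤-reflexive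
        (solve 3 (λ θ ε k → (θ :+ k :* ε) :+ ε := θ :+ (:1 :+ k) :* ε) refl θ ε (fromℕ k))) (Cyclic-trans b n)
    ; net       = net′
    ; move      = move′
    ; shell     = λ x → x + s , inside x , ¬Cyclic 0≤s small
    }
    where
    s : ℝ
    s = θ + fromℕ 4 * ε
    0≤s : 0# ≤ s
    0≤s = <⇒≤ 0<θ ⊞ (0≤fromℕ 4 ⊠ <⇒≤ 0<ε)
    inside : ∀ x → Cyclic (θ + fromℕ 5 * ε) x (x + s)
    inside x = + 0 , ∣∣<-cong (solve 2 (λ x s → :- s := x :- (x :+ s) :- :0) refl x s) refl
      (∣∣<-neg (0≤⇒∣∣< 0≤s (0<⇒< 0<ε
        (solve 3 (λ θ ε n → ε := (θ :+ (:1 :+ n) :* ε) :- (θ :+ n :* ε)) refl θ ε (fromℕ 4)))))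
    net′ : ∃[ ys ] (∀ x → Any (Cyclic ε x) ys)
    net′ = let gs , covered = interval-net 0# 1# (half * ε) (0<half* 0<ε) in
      gs , λ x → let k , 0≤ , <1 = floor x in
        Any.map (λ {g} near → k , ∣∣<-cong (solve 3 (λ x k g → (x :- k) :- g :=
              x :- g :- k) refl x (fromℤ k) g) refl
          (∣∣≤⇒∣∣< (half*< 0<ε) near)) (covered (x - fromℤ k) 0≤ (<⇒≤ <1))
    move′ : ∀ x y → Σ (ℝ → ℝ) λ g → Σ (ℝ → ℝ) λ h → (∀ u w → Cyclic ε (h w) u → Cyclic ε w (g u)) ×
              (∀ k w → Cyclic (θ + fromℕ k * ε) x w → Cyclic (θ + fromℕ k * ε) y (h w))
    move′ x y = (λ u → u + (x - y)) , (λ w → w - (x - y)) ,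
      (λ { u w (k , near) → k , ∣∣<-cong
        (solve 5 (λ x y u w k → (w :- (x :- y)) :- u :- k :=
              w :- (u :+ (x :- y)) :- k) refl x y u w (fromℤ k)) refl near }) ,
      (λ { _ w (k , near) → k , ∣∣<-cong
        (solve 4 (λ x y w k → x :- w :- k := y :- (w :- (x :- y)) :- k) refl x y w (fromℤ k)) refl near })

  module _ {L} (2<L : two < L) where
    open RawMetricSpace (circle L)

    opaque
      0<L : 0# < L
      0<L = <-trans 0<two 2<L

      L*L⁻¹ : L * L ⁻¹ ≈ 1#
      L*L⁻¹ = ⁻¹-inverse L (>⇒≉ 0<L)

      rep-correct : ∀ a → 0# ≤ rep L a × rep L a < L × _≈modL_ L (rep L a) a
      rep-correct a = the-satisfies (λ x → 0# ≤ x × x < L × _≈modL_ L x a) (let k , 0≤ , <1 = floor (a * L ⁻¹) in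
        a - fromℤ k * L ,
        ≤-respʳ-≈ (unscale k) (<⇒≤ 0<L ⊠ 0≤) ,
        <-respˡ-≈ (unscale k) (<-respʳ-≈ (*-identityʳ L) (*-monoˡ-< 0<L <1)) ,
        ℤ.- k , trans (solve 3 (λ a k L → a :- k :* L := a :+ (:- k) :* L) refl a (fromℤ k) L)
                  (+-congˡ (*-congʳ (sym (fromℤ-neg k)))))
        where
        unscale : ∀ k → L * (a * L ⁻¹ - fromℤ k) ≈ a - fromℤ k * L
        unscale k = trans (solve 4 (λ L a i k → L :* (a :* i :- k) :=
              a :* (L :* i) :- k :* L) refl L a (L ⁻¹) (fromℤ k))
          (+-congʳ (trans (*-congˡ L*L⁻¹) (*-identityʳ a)))

    -- A form of `d a b < t` free of representatives and of `min`; division by `L` turns it into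
    -- `Cyclic`.
    Wrapped : ℝ → ℝ → ℝ → Set
    Wrapped t a b = ∃[ k ] ∣ a - b - fromℤ k * L ∣< t

    opaque
      min<⇒ : ∀ {x y z} → min x y < z → x < z ⊎ y < z
      min<⇒ {x} {y} min<z with x <? y
      ... | yes _ = inj₁ min<z
      ... | no _  = inj₂ min<z

      ⇒min< : ∀ {x y z} → x < z ⊎ y < z → min x y < z
      ⇒min< {x} {y} (inj₁ x<z) with x <? y
      ... | yes _  = x<z
      ... | no x≮y = ≤-<-trans (≮⇒≥ x≮y) x<z
      ⇒min< {x} {y} (inj₂ y<z) with x <? y
      ... | yes x<y = <-trans x<y y<z
      ... | no _    = y<z

      abs-nonneg : ∀ {z} → 0# ≤ z → abs z ≈ z
      abs-nonneg {z} 0≤z with z <? 0#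
      ... | yes z<0 = ⊥-elim (<⇒≱ z<0 0≤z)
      ... | no _    = refl

      abs-neg : ∀ {z} → z < 0# → abs z ≈ - z
      abs-neg {z} z<0 with z <? 0#
      ... | yes _  = refl
      ... | no z≮0 = ⊥-elim (z≮0 z<0)

      difference-bounds : ∀ {x y} → 0# ≤ x → x < L → 0# ≤ y → y < L → ∣ x - y ∣< L
      difference-bounds {x} {y} 0≤x x<L 0≤y y<L =
        0<⇒< (0≤x ≤⊞ <⇒0<- y<L) (solve 3 (λ x y L → x :+ (L :- y) := (x :- y) :- :- L) refl x y L) ,
        0<⇒< (<⇒0<- x<L ⊞≤ 0≤y) (solve 3 (λ x y L → (L :- x) :+ y := L :- (x :- y)) refl x y L)

      wrapped-difference : ∀ {t D} → ∣ D ∣< L → abs D < t ⊎ L - abs D < t → ∃[ k ] ∣ D - fromℤ k * L ∣< t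
      wrapped-difference {t} {D} D<L (inj₁ abs<t) = + 0 ,
        ∣∣<-cong (solve 2 (λ D L → D := D :- :0 :* L) refl D L) refl (abs<⇒∣∣< abs<t)
      wrapped-difference {t} {D} D<L (inj₂ L-abs<t) with ≤-or-> 0# D
      ... | inj₁ 0≤D = + 1 , ∣∣<-cong (solve 2 (λ D L → :- (L :- D) := D :- (:1 :+ :0) :* L) refl D L) refl
            (∣∣<-neg (0≤⇒∣∣< (≤⇒0≤- (<⇒≤ (proj₂ D<L))) (<-respˡ-≈ (+-congˡ (-‿cong (abs-nonneg 0≤D))) L-abs<t)))
      ... | inj₂ D<0 = -[1+ 0 ] , ∣∣<-cong (solve 2 (λ D L → L :- :- D :=
            D :- (:- (:1 :+ :0)) :* L) refl D L) refl
            (0≤⇒∣∣< (≤-respʳ-≈ (solve 2 (λ D L → D :- :- L := L :- :- D) refl D L) (≤⇒0≤- (<⇒≤ (proj₁ D<L))))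
              (<-respˡ-≈ (+-congˡ (-‿cong (abs-neg D<0))) L-abs<t))

      -- As `D` lies between `- L` and `L` and `L` exceeds 2, at most the multiples -1, 0 and 1 of
      -- `L` come within 1 of `D`. The multiples 1 and -1 moreover determine the sign of `D` and
      -- hence `abs D`.
      difference-wrapped : ∀ {D} → ∣ D ∣< L → ∀ k → ∣ D - fromℤ k * L ∣< 1# → abs D < 1# ⊎ L - abs D < 1#
      difference-wrapped {D} D<L (+ zero) (l , u) =
        inj₁ (∣∣<⇒abs< (∣∣<-cong (solve 2 (λ D L → D :- :0 :* L := D) refl D L) refl (l , u)))
      difference-wrapped {D} D<L (+ suc zero) (l , u) = inj₂ (<-respˡ-≈ (+-congˡ (-‿cong (sym (abs-nonneg 0≤D))))
        (0<⇒< (<⇒0<- l) (solve 2 (λ D L → (D :- (:1 :+ :0) :* L) :- :- :1 := :1 :- (L :- D)) refl D L)))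
        where
        0≤D : 0# ≤ D
        0≤D = 0≤⇒≤ (<⇒≤ (<⇒0<- l) ⊞ <⇒≤ (<⇒0<- 2<L) ⊞ 0≤1)
          (solve 2 (λ D L → (D :- (:1 :+ :0) :* L) :- :- :1 :+ (L :- :2) :+ :1 := D :- :0) refl D L)
      difference-wrapped {D} D<L (+ suc (suc n)) (l , u) = ⊥-elim (<⇒≱ l (0≤⇒≤
        (<⇒≤ (<⇒0<- (proj₂ D<L)) ⊞ (0≤fromℕ n ⊠ <⇒≤ 0<L) ⊞ <⇒≤ (<⇒0<- 2<L) ⊞ 0≤1)
        (solve 3 (λ D L n → (L :- D) :+ n :* L :+ (L :- :2) :+ :1 := :- :1 :- (D :- (:1 :+ (:1 :+ n)) :* L))
          refl D L (fromℕ n))))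
      difference-wrapped {D} D<L -[1+ zero ] (l , u) = inj₂ (<-respˡ-≈ (+-congˡ (-‿cong (sym (abs-neg D<0))))
        (0<⇒< (<⇒0<- u) (solve 2 (λ D L → :1 :- (D :- (:- (:1 :+ :0)) :* L) := :1 :- (L :- :- D)) refl D L)))
        where
        D<0 : D < 0#
        D<0 = 0<⇒< (<⇒0<- u ⊞≤ <⇒≤ (<⇒0<- 2<L) ⊞≤ 0≤1)
          (solve 2 (λ D L → :1 :- (D :- (:- (:1 :+ :0)) :* L) :+ (L :- :2) :+ :1 := :0 :- D) refl D L)
      difference-wrapped {D} D<L -[1+ suc n ] (l , u) = ⊥-elim (<⇒≱ u (0≤⇒≤
        (<⇒≤ (<⇒0<- (proj₁ D<L)) ⊞ (0≤fromℕ n ⊠ <⇒≤ 0<L) ⊞ <⇒≤ (<⇒0<- 2<L) ⊞ 0≤1)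
        (solve 3 (λ D L n → (D :- :- L) :+ n :* L :+ (L :- :2) :+ :1 :=
              (D :- (:- (:1 :+ (:1 :+ n))) :* L) :- :1)
          refl D L (fromℕ n))))

      rep-difference : ∀ {a b k l} → rep L a ≈ a + fromℤ k * L → rep L b ≈ b + fromℤ l * L → ∀ m →
        rep L a - rep L b - fromℤ m * L ≈ a - b - fromℤ (m ℤ.- (k ℤ.- l)) * L
      rep-difference {a} {b} {k} {l} ra rb m = trans (+-congʳ (+-cong ra (-‿cong rb)))
        (trans (solve 6 (λ a b k l m L → ((a :+ k :* L) :- (b :+ l :* L)) :- m :* L :=
              a :- b :- (m :- (k :- l)) :* L)
                 refl a b (fromℤ k) (fromℤ l) (fromℤ m) L)
          (+-congˡ (-‿cong (*-congʳ (sym (trans (fromℤ-- m (k ℤ.- l)) (+-congˡ (-‿cong (fromℤ-- k l)))))))))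

      rep-bounds : ∀ a b → ∣ rep L a - rep L b ∣< L
      rep-bounds a b = let 0≤ra , ra<L , _ = rep-correct a
                           0≤rb , rb<L , _ = rep-correct b
                       in difference-bounds 0≤ra ra<L 0≤rb rb<L

      d<⇒Wrapped : ∀ {t a b} → d a b < t → Wrapped t a b
      d<⇒Wrapped {t} {a} {b} d<t =
        let _ , _ , k , ra = rep-correct a
            _ , _ , l , rb = rep-correct b
            m , near = wrapped-difference (rep-bounds a b) (min<⇒ d<t)
        in m ℤ.- (k ℤ.- l) , ∣∣<-cong (rep-difference {k = k} {l} ra rb m) refl near

      Wrapped⇒d<1 : ∀ {a b} → Wrapped 1# a b → d a b < 1#
      Wrapped⇒d<1 {a} {b} (m , near) =
        let _ , _ , k , ra = rep-correct a
            _ , _ , l , rb = rep-correct b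
        in ⇒min< (difference-wrapped (rep-bounds a b) (m ℤ.+ (k ℤ.- l)) (∣∣<-cong
             (trans (+-congˡ (-‿cong (*-congʳ (sym (m-[k-l] k l)))))
               (sym (rep-difference {k = k} {l} ra rb (m ℤ.+ (k ℤ.- l))))) refl near))
        where
        m-[k-l] : ∀ k l → fromℤ (m ℤ.+ (k ℤ.- l) ℤ.- (k ℤ.- l)) ≈ fromℤ m
        m-[k-l] k l = trans (fromℤ-- (m ℤ.+ (k ℤ.- l)) (k ℤ.- l))
          (trans (+-congʳ (fromℤ-+ m (k ℤ.- l)))
            (solve 2 (λ m j → (m :+ j) :- j := m) refl (fromℤ m) (fromℤ (k ℤ.- l))))

      scale-difference : ∀ a b k → L ⁻¹ * (a - b - fromℤ k * L) ≈ a * L ⁻¹ - b * L ⁻¹ - fromℤ k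
      scale-difference a b k =
        trans (solve 5 (λ a b k L i → i :* (a :- b :- k :* L) := a :* i :- b :* i :- k :* (L :* i)) refl
                a b (fromℤ k) L (L ⁻¹))
          (+-congˡ (-‿cong (trans (*-congˡ L*L⁻¹) (*-identityʳ _))))

      Wrapped⇒Cyclic : ∀ {t a b} → Wrapped t a b → Cyclic (L ⁻¹ * t) (a * L ⁻¹) (b * L ⁻¹)
      Wrapped⇒Cyclic {t} {a} {b} (k , near) =
        k , ∣∣<-cong (scale-difference a b k) refl (∣∣<-scale (⁻¹-pos 0<L) near)

      Cyclic⇒Wrapped : ∀ {t a b} → Cyclic (L ⁻¹ * t) (a * L ⁻¹) (b * L ⁻¹) → Wrapped t a b
      Cyclic⇒Wrapped {t} {a} {b} (k , near) =
        k , ∣∣<-cong (trans (*-congˡ (sym (scale-difference a b k))) (cancel _)) (cancel t) (∣∣<-scale 0<L near)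
        where
        cancel : ∀ z → L * (L ⁻¹ * z) ≈ z
        cancel z = trans (sym (*-assoc _ _ _)) (trans (*-congʳ L*L⁻¹) (*-identityˡ z))

    circle-model : ∀ {θ ε} (0<θ : 0# < θ) (0<ε : 0# < ε) (small : θ + fromℕ 4 * ε ≤ half) →
      ∀ Γ → IsGEC (circle L) Γ →
      Model (circleGeometry θ ε 0<θ 0<ε small) (Cyclic (L ⁻¹ * 1#)) (graphStructure (circle L) Γ)
    circle-model {θ} {ε} 0<θ 0<ε small Γ gec = gec-model (circle L) (circleGeometry θ ε 0<θ 0<ε small) Γ gec
      (_* L ⁻¹) (λ d<1 → Wrapped⇒Cyclic (d<⇒Wrapped d<1)) (λ near → Wrapped⇒d<1 (Cyclic⇒Wrapped near)) approach
      where
      approach : ∀ x → Σ ℝ λ p → ∃[ δ ] 0# < δ × (∀ q → d p q < δ → Cyclic ε x (q * L ⁻¹))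
      approach x = x * L , L * ε , 0<L ⊠< 0<ε , λ q near →
        let k , near′ = Wrapped⇒Cyclic (d<⇒Wrapped near)
        in k , ∣∣<-cong
          (+-congʳ (+-congʳ (trans (*-assoc _ _ _) (trans (*-congˡ L*L⁻¹) (*-identityʳ x)))))
          (trans (solve 3 (λ L i ε → i :* (L :* ε) := (L :* i) :* ε) refl L (L ⁻¹) ε)
            (trans (*-congʳ L*L⁻¹) (*-identityˡ ε)))
          near′

  circle-theories-differ : ∀ {L₁ L₂} → two < L₁ → two < L₂ → L₂ < L₁ → ∀ {T₁ T₂} →
    IsCircleTheory L₁ T₁ → IsCircleTheory L₂ T₂ → ¬ (T₁ ≐ T₂)
  circle-theories-differ {L₁} {L₂} 2<L₁ 2<L₂ L₂<L₁ common₁ common₂ =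
    distinct-theories common₁ common₂ (circleGeometry θ₁ ε 0<θ₁ 0<ε small)
      (Cyclic-≤ (≤-reflexive (solve 2 (λ θ ε → θ := θ :+ :0 :* ε) refl θ₁ ε)))
      (Cyclic-≤ (≤-reflexive θ₁+7ε≈θ₂))
      (circle-model 2<L₁ 0<θ₁ 0<ε small) (circle-model 2<L₂ 0<θ₁ 0<ε small)
    where
    θ₁ θ₂ ε : ℝ
    θ₁ = L₁ ⁻¹ * 1#
    θ₂ = L₂ ⁻¹ * 1#
    0<θ₁ : 0# < θ₁
    0<θ₁ = ⁻¹-pos (<-trans 0<two 2<L₁) ⊠< 0<1
    ⁻¹-anti : ∀ {x y} → 0# < x → x < y → y ⁻¹ * 1# < x ⁻¹ * 1#
    ⁻¹-anti {x} {y} 0<x x<y = *-cancelˡ-< (0<x ⊠< <-trans 0<x x<y) (<-respˡ-≈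
      (trans (sym (trans (*-congˡ (⁻¹-inverse y (>⇒≉ (<-trans 0<x x<y)))) (*-identityʳ x)))
        (solve 3 (λ x y i → x :* (y :* i) := x :* y :* (i :* :1)) refl x y (y ⁻¹)))
      (<-respʳ-≈
        (trans (sym (trans (*-congˡ (⁻¹-inverse x (>⇒≉ 0<x))) (*-identityʳ y)))
          (solve 3 (λ x y i → y :* (x :* i) := x :* y :* (i :* :1)) refl x y (x ⁻¹))) x<y))
    θ₁<θ₂ : θ₁ < θ₂
    θ₁<θ₂ = ⁻¹-anti (<-trans 0<two 2<L₂) L₂<L₁
    ε-exists : ∃[ ε ] 0# < ε × θ₁ + fromℕ 7 * ε ≈ θ₂
    ε-exists = step θ₁<θ₂
    ε = proj₁ ε-exists
    0<ε : 0# < ε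
    0<ε = proj₁ (proj₂ ε-exists)
    θ₁+7ε≈θ₂ : θ₁ + fromℕ 7 * ε ≈ θ₂
    θ₁+7ε≈θ₂ = proj₂ (proj₂ ε-exists)
    -- `θ₁ + 4 ε ≤ θ₁ + 7 ε = θ₂ = 1 / L₂`, and this is below one half because `L₂ > 2`.
    small : θ₁ + fromℕ 4 * ε ≤ half
    small = ≤-trans (radius-≤ 4 (<⇒≤ 0<ε) (ℕ.m≤m+n 4 3)) (≤-trans (≤-reflexive θ₁+7ε≈θ₂)
      (≤-respʳ-≈ (*-identityʳ half) (<⇒≤ (⁻¹-anti 0<two 2<L₂))))

-- Spheres, rescaled to the unit sphere with chord distance.

module Spheres (em : ExcludedMiddle 0ℓ) (R : RealField) where
  open GeometricGraphs em R public
  open Graphs em R using (dot; sphere; SpherePoint; _,_; IsSphereTheory)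
  open SpherePoint

  ℝ³ : Set
  ℝ³ = Vec ℝ 3

  -- The vector `x - k y`: for `k = 1` a chord, for `k` a suitable multiple of an inner product the
  -- image of `x` under a reflection.
  shear : ℝ³ → ℝ → ℝ³ → ℝ³
  shear (x₁ ∷ x₂ ∷ x₃ ∷ []) k (y₁ ∷ y₂ ∷ y₃ ∷ []) = (x₁ - k * y₁) ∷ (x₂ - k * y₂) ∷ (x₃ - k * y₃) ∷ []

  scale : ℝ → ℝ³ → ℝ³
  scale k (x₁ ∷ x₂ ∷ x₃ ∷ []) = (k * x₁) ∷ (k * x₂) ∷ (k * x₃) ∷ []

  opaque
    dot-comm : ∀ x y → dot x y ≈ dot y x
    dot-comm (x₁ ∷ x₂ ∷ x₃ ∷ []) (y₁ ∷ y₂ ∷ y₃ ∷ []) = +-cong (+-cong (*-comm _ _) (*-comm _ _)) (*-comm _ _)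

    dot-shear : ∀ x k y z → dot (shear x k y) z ≈ dot x z - k * dot y z
    dot-shear (x₁ ∷ x₂ ∷ x₃ ∷ []) k (y₁ ∷ y₂ ∷ y₃ ∷ []) (z₁ ∷ z₂ ∷ z₃ ∷ []) = trans
      (+-cong (+-cong (coordinate x₁ y₁ z₁) (coordinate x₂ y₂ z₂)) (coordinate x₃ y₃ z₃))
      (solve 7 (λ a b c k x y z → (a :- k :* x) :+ (b :- k :* y) :+ (c :- k :* z) :=
            (a :+ b :+ c) :- k :* (x :+ y :+ z))
        refl (x₁ * z₁) (x₂ * z₂) (x₃ * z₃) k (y₁ * z₁) (y₂ * z₂) (y₃ * z₃))
      where
      coordinate : ∀ x y z → (x - k * y) * z ≈ x * z - k * (y * z)
      coordinate x y z = solve 4 (λ x k y z → (x :- k :* y) :* z := x :* z :- k :* (y :* z)) refl x k y z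

    dot-scale : ∀ k x y → dot (scale k x) y ≈ k * dot x y
    dot-scale k (x₁ ∷ x₂ ∷ x₃ ∷ []) (y₁ ∷ y₂ ∷ y₃ ∷ []) =
      solve 7 (λ k a b c x y z → k :* a :* x :+ k :* b :* y :+ k :* c :* z := k :* (a :* x :+ b :* y :+ c :* z))
        refl k x₁ x₂ x₃ y₁ y₂ y₃

    0≤dot : ∀ x → 0# ≤ dot x x
    0≤dot (x₁ ∷ x₂ ∷ x₃ ∷ []) = 0≤x² x₁ ⊞ 0≤x² x₂ ⊞ 0≤x² x₃

    -- Lagrange's identity: the difference of the two sides is the squared length of the cross
    -- product.
    cauchy-schwarz : ∀ x y → dot x y * dot x y ≤ dot x x * dot y y
    cauchy-schwarz (x₁ ∷ x₂ ∷ x₃ ∷ []) (y₁ ∷ y₂ ∷ y₃ ∷ []) = 0≤⇒≤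
      (0≤x² (x₁ * y₂ - x₂ * y₁) ⊞ 0≤x² (x₁ * y₃ - x₃ * y₁) ⊞ 0≤x² (x₂ * y₃ - x₃ * y₂))
      (solve 6 (λ a b c x y z →
        (a :* y :- b :* x) :* (a :* y :- b :* x) :+ (a :* z :- c :* x) :* (a :* z :- c :* x)
          :+ (b :* z :- c :* y) :* (b :* z :- c :* y) :=
        (a :* a :+ b :* b :+ c :* c) :* (x :* x :+ y :* y :+ z :* z)
          :- (a :* x :+ b :* y :+ c :* z) :* (a :* x :+ b :* y :+ c :* z)) refl x₁ x₂ x₃ y₁ y₂ y₃)

    dot-shearʳ : ∀ x k y z → dot z (shear x k y) ≈ dot z x - k * dot z y
    dot-shearʳ x k y z = trans (dot-comm z (shear x k y))
      (trans (dot-shear x k y z) (+-cong (dot-comm x z) (-‿cong (*-congˡ (dot-comm y z)))))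

    dot-scaleʳ : ∀ k x y → dot x (scale k y) ≈ k * dot x y
    dot-scaleʳ k x y = trans (dot-comm x (scale k y)) (trans (dot-scale k y x) (*-congˡ (dot-comm y x)))

  Unit : Set
  Unit = Σ ℝ³ λ v → dot v v ≈ 1#

  infix 9 _∙_
  _∙_ : Unit → Unit → ℝ
  u ∙ v = dot (proj₁ u) (proj₁ v)

  -- For unit vectors, two - two * u ∙ v is the squared length of the chord from u to v.
  Close : ℝ → Unit → Unit → Set
  Close t u v = two - two * u ∙ v < t * t

  opaque
    dot-differences : ∀ (u v w z : Unit) → dot (shear (proj₁ u) 1# (proj₁ v)) (shear (proj₁ w) 1# (proj₁ z)) ≈
                      u ∙ w - u ∙ z - (v ∙ w - v ∙ z)
    dot-differences (u , _) (v , _) (w , _) (z , _) = trans (dot-shear u 1# v _)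
      (trans (+-cong (dot-shearʳ w 1# z u) (-‿cong (*-congˡ (dot-shearʳ w 1# z v))))
        (solve 4 (λ a b c d → (a :- :1 :* b) :- :1 :* (c :- :1 :* d) := a :- b :- (c :- d)) refl _ _ _ _))

    chord²≈ : ∀ u v → dot (shear (proj₁ u) 1# (proj₁ v)) (shear (proj₁ u) 1# (proj₁ v)) ≈ two - two * u ∙ v
    chord²≈ u v = trans (dot-differences u v u v)
      (trans (+-cong (+-congʳ (proj₂ u)) (-‿cong (+-cong (dot-comm (proj₁ v) (proj₁ u)) (-‿cong (proj₂ v)))))
        (solve 1 (λ a → :1 :- a :- (a :- :1) := :2 :- :2 :* a) refl (u ∙ v)))

    0≤chord² : ∀ u v → 0# ≤ two - two * u ∙ v
    0≤chord² u v = ≤-respʳ-≈ (chord²≈ u v) (0≤dot (shear (proj₁ u) 1# (proj₁ v)))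

    Close-refl : ∀ {t u} → 0# < t → Close t u u
    Close-refl {t} {u} 0<t = <-respˡ-≈ (sym (trans (+-congˡ (-‿cong (*-congˡ (proj₂ u))))
      (solve 1 (λ t → t :- t :* :1 := :0) refl two))) (0<t ⊠< 0<t)

    Close-sym : ∀ {t u v} → Close t u v → Close t v u
    Close-sym {t} {u} {v} = <-respˡ-≈ (+-congˡ (-‿cong (*-congˡ (dot-comm (proj₁ u) (proj₁ v)))))

    Close-cong : ∀ {t u v u′ v′} → u ∙ v ≈ u′ ∙ v′ → Close t u v → Close t u′ v′
    Close-cong eq = <-respˡ-≈ (+-congˡ (-‿cong (*-congˡ eq)))

    sq-mono-≤ : ∀ {s t} → 0# ≤ s → s ≤ t → s * s ≤ t * t
    sq-mono-≤ {s} {t} 0≤s s≤t = 0≤⇒≤ (≤⇒0≤- s≤t ⊠ (≤-trans 0≤s s≤t ⊞ 0≤s))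
      (solve 2 (λ s t → (t :- s) :* (t :+ s) := t :* t :- s :* s) refl s t)

    Close-≤ : ∀ {s t u v} → 0# ≤ s → s ≤ t → Close s u v → Close t u v
    Close-≤ 0≤s s≤t close = <-≤-trans close (sq-mono-≤ 0≤s s≤t)

    -- The squared triangle inequality: for `p = u - v` and `q = v - w` the squared length of
    -- `p + q` is `P + Q + 2 (dot p q)`, and Cauchy-Schwarz gives `dot p q < s * t`.
    Close-trans : ∀ {s t u v w} → 0# < s → 0# < t → Close s u v → Close t v w → Close (s + t) u w
    Close-trans {s} {t} {u} {v} {w} 0<s 0<t u∼v v∼w = 0<⇒<
      (<⇒0<- u∼v ⊞≤ <⇒≤ (<⇒0<- v∼w) ⊞≤ (<⇒≤ 0<two ⊠ <⇒≤ (<⇒0<- pq<st)))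
      (trans (+-congˡ (*-congˡ (+-congˡ (-‿cong pq≈))))
        (solve 6 (λ s t a b c d → (s :* s :- (:2 :- :2 :* a)) :+ (t :* t :- (:2 :- :2 :* b))
            :+ :2 :* (s :* t :- (a :- c :- (:1 :- b))) :=
          (s :+ t) :* (s :+ t) :- (:2 :- :2 :* c)) refl s t (u ∙ v) (v ∙ w) (u ∙ w) 1#))
      where
      p q : ℝ³
      p = shear (proj₁ u) 1# (proj₁ v)
      q = shear (proj₁ v) 1# (proj₁ w)
      pq≈ : dot p q ≈ u ∙ v - u ∙ w - (1# - v ∙ w)
      pq≈ = trans (dot-differences u v v w) (+-congˡ (-‿cong (+-congʳ (proj₂ v))))
      P Q : ℝ
      P = two - two * u ∙ v
      Q = two - two * v ∙ w
      PQ<s²t² : P * Q < (s * t) * (s * t)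
      PQ<s²t² = 0<⇒< ((<⇒0<- u∼v ⊠< (0<t ⊠< 0<t)) ⊞≤ (0≤chord² u v ⊠ <⇒≤ (<⇒0<- v∼w)))
        (solve 4 (λ s t P Q → (s :* s :- P) :* (t :* t) :+ P :* (t :* t :- Q) := (s :* t) :* (s :* t) :- P :* Q)
          refl s t P Q)
      pq<st : dot p q < s * t
      pq<st = sq-cancel-< (<⇒≤ (0<s ⊠< 0<t)) (≤-<-trans (cauchy-schwarz p q)
        (<-respˡ-≈ (sym (*-cong (chord²≈ u v) (chord²≈ v w))) PQ<s²t²))

  -- Isometries taking x to y are only needed through their effect on inner products.
  Moves : Unit → Unit → (Unit → Unit) → Set
  Moves x y f = (∀ u w → f u ∙ w ≈ u ∙ f w) × (∀ w → y ∙ f w ≈ x ∙ w)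

  opaque
    -- When `n = x - y` has length zero, a reflection along it is undefined; but then, by
    -- Cauchy-Schwarz, `n` is orthogonal to every `w`, so the identity will do.
    ≈0-moves : ∀ {x y} → two - two * x ∙ y ≈ 0# → Moves x y (λ u → u)
    ≈0-moves {x} {y} x≈y = (λ _ _ → refl) , λ w → sym (x-y≈0⇒x≈y (trans (sym (n∙ w))
      (x²≈0⇒x≈0 (≤-antisym (n∙w²≤0 w) (0≤x² _)))))
      where
      n : ℝ³
      n = shear (proj₁ x) 1# (proj₁ y)
      n∙ : ∀ (w : Unit) → dot n (proj₁ w) ≈ x ∙ w - y ∙ w
      n∙ w = trans (dot-shear (proj₁ x) 1# (proj₁ y) (proj₁ w)) (+-congˡ (-‿cong (*-identityˡ _)))
      n∙w²≤0 : ∀ (w : Unit) → dot n (proj₁ w) * dot n (proj₁ w) ≤ 0#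
      n∙w²≤0 w = ≤-respʳ-≈ (trans (*-congʳ (trans (chord²≈ x y) x≈y)) (zeroˡ _)) (cauchy-schwarz n (proj₁ w))

    -- The reflection in the plane orthogonal to `n = x - y` exchanges `x` and `y`. Being its own
    -- adjoint, it can later serve in both directions of `move`.
    reflection-moves : ∀ {x y} → ¬ two - two * x ∙ y ≈ 0# → ∃[ f ] Moves x y f
    reflection-moves {x} {y} x≉y = f , f-self-adjoint , f-moves
      where
      n : ℝ³
      n = shear (proj₁ x) 1# (proj₁ y)
      N c : ℝ
      N = two - two * x ∙ y
      c = two * N ⁻¹
      cN≈2 : c * N ≈ two
      cN≈2 = trans (solve 3 (λ t N i → (t :* i) :* N := t :* (N :* i)) refl two N (N ⁻¹))
        (trans (*-congˡ (⁻¹-inverse N x≉y)) (*-identityʳ two))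
      reflect : ℝ³ → ℝ³
      reflect v = shear v (c * dot v n) n
      adjoint : ∀ v w → dot (reflect v) w ≈ dot v (reflect w)
      adjoint v w = trans (dot-shear v _ n w) (trans (+-congˡ (-‿cong (trans (*-congˡ (dot-comm n w))
        (solve 3 (λ c a b → c :* a :* b :=
              c :* b :* a) refl c (dot v n) (dot w n))))) (sym (dot-shearʳ w _ n v)))
      reflect-n : ∀ w → dot (reflect w) n ≈ - dot w n
      reflect-n w = trans (dot-shear w _ n n) (trans (+-congˡ (-‿cong (trans (*-congˡ (chord²≈ x y))
        (trans (solve 3 (λ c a N → c :* a :* N := c :* N :* a) refl c (dot w n) N) (*-congʳ cN≈2)))))
        (solve 1 (λ a → a :- :2 :* a := :- a) refl (dot w n)))
      isometry : ∀ v w → dot (reflect v) (reflect w) ≈ dot v w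
      isometry v w = trans (dot-shearʳ w _ n (reflect v))
        (trans (+-cong (dot-shear v _ n w) (-‿cong (*-congˡ (reflect-n v))))
          (trans (+-congʳ (+-congˡ (-‿cong (*-congˡ (dot-comm n w)))))
            (solve 4 (λ s c a b → (s :- c :* a :* b) :- c :* b :* :- a :=
                  s) refl (dot v w) c (dot v n) (dot w n))))
      f : Unit → Unit
      f (v , v∙v) = reflect v , trans (isometry v v) v∙v
      f-self-adjoint : ∀ u w → f u ∙ w ≈ u ∙ f w
      f-self-adjoint (u , _) (w , _) = adjoint u w
      y∙n : dot (proj₁ y) n ≈ x ∙ y - 1#
      y∙n = trans (dot-shearʳ (proj₁ x) 1# (proj₁ y) (proj₁ y)) (+-cong (dot-comm (proj₁ y) (proj₁ x))
        (-‿cong (trans (*-identityˡ _) (proj₂ y))))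
      -- The squared length `2 - 2 x ∙ y` of `n` is `-2` times the inner product of `y` and `n`, so
      -- `y` is reflected to `y + n = x`.
      c-y∙n : c * dot (proj₁ y) n ≈ - 1#
      c-y∙n = trans (*-congˡ y∙n) (trans
        (solve 3 (λ c a h → c :* (a :- :1) :=
            :- (h :* (c :* (:2 :- :2 :* a))) :+ (h :* :2 :- :1) :* (c :* (:1 :- a)))
          refl c (x ∙ y) half)
        (trans (+-cong (-‿cong (trans (*-congˡ cN≈2) half*two))
          (trans (*-congʳ (trans (+-congʳ half*two) (-‿inverseʳ 1#))) (zeroˡ _)))
          (+-identityʳ _)))
        where
        half*two : half * two ≈ 1#
        half*two = trans (*-comm _ _) two*half
      f-moves : ∀ w → y ∙ f w ≈ x ∙ w
      f-moves (w , w∙w) = trans (sym (adjoint (proj₁ y) w)) (trans (dot-shear (proj₁ y) _ n w)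
        (trans (+-congˡ (-‿cong (*-cong c-y∙n (dot-shear (proj₁ x) 1# (proj₁ y) w))))
          (solve 2 (λ a b → b :- (:- :1) :* (a :- :1 :* b) := a) refl (dot (proj₁ x) w) (dot (proj₁ y) w))))

    moves : ∀ x y → ∃[ f ] Moves x y f
    moves x y with two - two * x ∙ y ≟ 0#
    ... | yes x≈y = (λ u → u) , ≈0-moves {x} {y} x≈y
    ... | no x≉y  = reflection-moves {x} {y} x≉y

    -- Grid points need not lie on the sphere, so each is replaced by a point of the sphere in its
    -- cell, if there is one.
    represent : ∀ {A G : Set} (R : A → G → Set) gs →
      ∃[ ys ] (∀ x → Any (R x) gs → Any (λ y → ∃[ g ] R x g × R y g) ys)
    represent R []       = [] , λ _ ()
    represent R (g ∷ gs) with em {∃[ y ] R y g} | represent R gs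
    ... | yes (y , Ryg) | ys , covered = y ∷ ys , λ where
          x (here Rxg)  → here (g , Rxg , Ryg)
          x (there any) → there (covered x any)
    ... | no none | ys , covered = ys , λ where
          x (here Rxg)  → ⊥-elim (none (x , Rxg))
          x (there any) → covered x any

  Within : ℝ → ℝ³ → ℝ × ℝ × ℝ → Set
  Within δ (x₁ ∷ x₂ ∷ x₃ ∷ []) (g₁ , g₂ , g₃) = ∣ x₁ - g₁ ∣≤ δ × ∣ x₂ - g₂ ∣≤ δ × ∣ x₃ - g₃ ∣≤ δ

  opaque
    grid : ∀ δ → 0# < δ → ∃[ gs ] (∀ (u : Unit) → Any (Within δ (proj₁ u)) gs)
    grid δ 0<δ = let gs , covered = interval-net (- 1#) 1# δ 0<δ in
      List.cartesianProduct gs (List.cartesianProduct gs gs) , cover gs covered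
      where
      coordinate : ∀ {x y z} → x * x + y * y + z * z ≈ 1# → ∣ x ∣≤ 1#
      coordinate {x} {y} {z} eq = sq⇒∣∣ 0≤1 (≤-respʳ-≈ (trans eq (sym (*-identityˡ 1#)))
        (0≤⇒≤ (0≤x² y ⊞ 0≤x² z) (solve 3 (λ x y z → y :+ z :=
              (x :+ y :+ z) :- x) refl (x * x) (y * y) (z * z))))
      cover : ∀ gs → (∀ x → - 1# ≤ x → x ≤ 1# → Any (λ g → ∣ x - g ∣≤ δ) gs) →
              ∀ (u : Unit) → Any (Within δ (proj₁ u)) (List.cartesianProduct gs (List.cartesianProduct gs gs))
      cover gs covered (x ∷ y ∷ z ∷ [] , eq) =
        let l₁ , u₁ = coordinate {x} {y} {z} eq
            l₂ , u₂ = coordinate {y} {z} {x} (trans (solve 3 (λ x y z → y :+ z :+ x :=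
                  x :+ y :+ z) refl _ _ _) eq)
            l₃ , u₃ = coordinate {z} {x} {y} (trans (solve 3 (λ x y z → z :+ x :+ y :=
                  x :+ y :+ z) refl _ _ _) eq)
            g₁ , g₁∈ , near₁ = find (covered x l₁ u₁)
            g₂ , g₂∈ , near₂ = find (covered y l₂ u₂)
            g₃ , g₃∈ , near₃ = find (covered z l₃ u₃)
        in lose (∈-cartesianProduct⁺ g₁∈ (∈-cartesianProduct⁺ g₂∈ g₃∈)) (near₁ , near₂ , near₃)

    -- Coordinates in a common cell differ by at most `2 δ`, so the squared chord is at most
    -- `12 δ²`, which is less than `(4 δ)²`.
    Within⇒Close : ∀ {ε δ} → 0# < δ → four * δ ≤ ε → ∀ (u v : Unit) g →
      Within δ (proj₁ u) g → Within δ (proj₁ v) g → Close ε u v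
    Within⇒Close {ε} {δ} 0<δ 4δ≤ε u@(x₁ ∷ x₂ ∷ x₃ ∷ [] , _) v@(y₁ ∷ y₂ ∷ y₃ ∷ [] , _) (g₁ , g₂ , g₃)
                 (a₁ , a₂ , a₃) (b₁ , b₂ , b₃) =
      <-≤-trans (≤-<-trans (≤-respˡ-≈ (chord²≈ u v) (0≤⇒≤
          (≤⇒0≤- (difference² a₁ b₁) ⊞ ≤⇒0≤- (difference² a₂ b₂) ⊞ ≤⇒0≤- (difference² a₃ b₃))
          (solve 4 (λ e x y z → (e :- x) :+ (e :- y) :+ (e :- z) := (e :+ e :+ e) :- (x :+ y :+ z)) refl
            ((δ + δ) * (δ + δ)) _ _ _)))
        (0<⇒< ((0<δ ⊞≤ <⇒≤ 0<δ) ⊠< (0<δ ⊞≤ <⇒≤ 0<δ))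
          (solve 1 (λ δ → (δ :+ δ) :* (δ :+ δ) := (:2 :* :2 :* δ) :* (:2 :* :2 :* δ)
             :- ((δ :+ δ) :* (δ :+ δ) :+ (δ :+ δ) :* (δ :+ δ) :+ (δ :+ δ) :* (δ :+ δ))) refl δ)))
        (sq-mono-≤ (<⇒≤ ((0<two ⊠< 0<two) ⊠< 0<δ)) 4δ≤ε)
      where
      difference² : ∀ {x y g} → ∣ x - g ∣≤ δ → ∣ y - g ∣≤ δ → (x - 1# * y) * (x - 1# * y) ≤ (δ + δ) * (δ + δ)
      difference² {x} {y} {g} a b = proj₂ (∣∣-* near near)
        where
        near : ∣ x - 1# * y ∣≤ δ + δ
        near = ∣∣-cong (solve 3 (λ x y g → (x :- g) :+ :- (y :- g) :=
              x :- :1 :* y) refl x y g) refl (∣∣-+ a (∣∣-neg b))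

  north : Unit
  north = (1# ∷ 0# ∷ 0# ∷ []) , solve 0 (:1 :* :1 :+ :0 :* :0 :+ :0 :* :0 := :1) refl

  opaque
    -- The point (cos t , sin t , 0), with sin t = cos (π/2 - t).
    latitude : ∀ t → Σ Unit λ w → north ∙ w ≈ cos t
    latitude t = (cos t ∷ cos (π/2 - t) ∷ 0# ∷ [] ,
        trans (solve 2 (λ a b → a :+ b :+ :0 :* :0 := a :+ b) refl _ _) (cos²+cos²-complement t)) ,
      solve 2 (λ a b → :1 :* a :+ :0 :* b :+ :0 :* :0 := a) refl (cos t) (cos (π/2 - t))

    -- A chord of length `s` subtends the angle with cosine `1 - s² / 2`, which is at least -1 for
    -- `s ≤ 2`. A point at this angle from `north` is moved along with `north` to `x`.
    at-distance : ∀ {s} → 0# ≤ s → s ≤ two → ∀ x → ∃[ w ] two - two * x ∙ w ≈ s * s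
    at-distance {s} 0≤s s≤2 x =
      let f , _ , f-moves = moves north x
          w , north∙w = latitude (arccos c)
          _ , _ , cos≈c = arccos-correct -1≤c c≤1
      in f w , trans (+-congˡ (-‿cong (*-congˡ (trans (f-moves w) (trans north∙w cos≈c))))) value
      where
      c : ℝ
      c = 1# - half * (s * s)
      value : two - two * c ≈ s * s
      value = trans (solve 2 (λ h a → :2 :- :2 :* (:1 :- h :* a) :=
            h :* a :+ h :* a) refl half (s * s)) (halve (s * s))
      -1≤c : - 1# ≤ c
      -1≤c = *-cancelˡ-≤ 0<two (0≤⇒≤ (≤⇒0≤- (sq-mono-≤ 0≤s s≤2))
        (trans (+-congˡ (-‿cong (sym value)))
          (solve 1 (λ c → :2 :* :2 :- (:2 :- :2 :* c) :=
             :2 :* c :- :2 :* :- :1) refl c)))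
      c≤1 : c ≤ 1#
      c≤1 = 0≤⇒≤ (<⇒≤ 0<half ⊠ 0≤x² s) (solve 1 (λ a → a := :1 :- (:1 :- a)) refl (half * (s * s)))

  -- The bound `two` is the longest chord, and plays the part that `half` has for circles.
  sphereGeometry : ∀ θ ε → 0# < θ → 0# < ε → θ + fromℕ 4 * ε ≤ two → Geometry
  sphereGeometry θ ε 0<θ 0<ε small = record
    { X         = Unit
    ; Near      = Close ε
    ; Ball      = λ k → Close (ballRadius k)
    ; centre    = north
    ; Near-refl = λ {u} → Close-refl {u = u} 0<ε
    ; Near-sym  = λ {u} {v} → Close-sym {u = u} {v}
    ; Ball-sym  = λ {_} {u} {v} → Close-sym {u = u} {v}
    ; Ball-Near = λ {k} {u} {v} {w} b n → Close-≤ {u = u} {w} (<⇒≤ (0<ballRadius k ⊞≤ <⇒≤ 0<ε)) (≤-reflexive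
        (solve 3 (λ θ ε k → (θ :+ k :* ε) :+ ε := θ :+ (:1 :+ k) :* ε) refl θ ε (fromℕ k)))
        (Close-trans {u = u} {v} {w} (0<ballRadius k) 0<ε b n)
    ; net       = let gs , covered = grid δ 0<δ
                      ys , represented = represent (λ u → Within δ (proj₁ u)) gs
                  in ys , λ x → Any.map (λ {y} (g , near , near′) →
                       Within⇒Close 0<δ (≤-reflexive (four*quarter* ε)) x y g near near′) (represented x (covered x))
    ; move      = λ x y → let f , adjoint , f-moves = moves x y in f , f ,
                    (λ u w → Close-cong {u = f w} {u} {w} {f u} (adjoint w u)) ,
                    (λ k w → Close-cong {u = x} {w} {y} {f w} (sym (f-moves w)))
    ; shell     = λ x → let w , distance = at-distance (<⇒≤ (0<ballRadius 4)) small x in w ,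
                    <-respˡ-≈ (sym distance) (sq-< (<⇒≤ (0<ballRadius 4)) ball₄<ball₅) ,
                    λ close → <-irrefl distance close
    }
    where
    ballRadius : ℕ → ℝ
    ballRadius k = θ + fromℕ k * ε
    0<ballRadius : ∀ k → 0# < ballRadius k
    0<ballRadius k = 0<θ ⊞≤ (0≤fromℕ k ⊠ <⇒≤ 0<ε)
    δ : ℝ
    δ = quarter * ε
    0<δ : 0# < δ
    0<δ = 0<quarter ⊠< 0<ε
    ball₄<ball₅ : ballRadius 4 < ballRadius 5
    ball₄<ball₅ = 0<⇒< 0<ε (solve 3 (λ θ ε n → ε := (θ :+ (:1 :+ n) :* ε) :- (θ :+ n :* ε)) refl θ ε (fromℕ 4))
    sq-< : ∀ {s t} → 0# ≤ s → s < t → s * s < t * t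
    sq-< {s} {t} 0≤s s<t = 0<⇒< (<⇒0<- s<t ⊠< (≤-<-trans 0≤s s<t ⊞≤ 0≤s))
      (solve 2 (λ s t → (t :- s) :* (t :+ s) := t :* t :- s :* s) refl s t)

  module _ {r} (π⁻¹<r : π ⁻¹ < r) where
    open RawMetricSpace (sphere r)

    opaque
      0<r : 0# < r
      0<r = <-trans (⁻¹-pos 0<π) π⁻¹<r

      r*r⁻¹ : r * r ⁻¹ ≈ 1#
      r*r⁻¹ = ⁻¹-inverse r (>⇒≉ 0<r)

      0<r⁻¹ : 0# < r ⁻¹
      0<r⁻¹ = ⁻¹-pos 0<r

      -- This places the angle `1 / r` of a unit ball where cosine is strictly decreasing, so that
      -- balls can be compared through cosines.
      r⁻¹<π : r ⁻¹ < π
      r⁻¹<π = *-cancelˡ-< (0<r ⊠< ⁻¹-pos 0<π) (<-respˡ-≈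
        (trans (sym (trans (*-congˡ r*r⁻¹) (*-identityʳ _)))
          (solve 3 (λ r i p → p :* (r :* i) := r :* p :* i) refl r (r ⁻¹) (π ⁻¹)))
        (<-respʳ-≈ (trans (sym (trans (*-congˡ (⁻¹-inverse π (>⇒≉ 0<π))) (*-identityʳ r)))
          (solve 3 (λ r p i → r :* (p :* i) := r :* i :* p) refl r π (π ⁻¹))) π⁻¹<r))

      r⁻²≈ : r ⁻¹ * r ⁻¹ ≈ (r * r) ⁻¹
      r⁻²≈ = trans (trans (sym (*-identityʳ _)) (*-congˡ (sym (⁻¹-inverse (r * r) (>⇒≉ (0<r ⊠< 0<r))))))
        (trans (solve 3 (λ r i j → (i :* i) :* ((r :* r) :* j) :=
              (r :* i) :* (r :* i) :* j) refl r (r ⁻¹) ((r * r) ⁻¹))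
          (trans (*-congʳ (trans (*-cong r*r⁻¹ r*r⁻¹) (*-identityˡ 1#))) (*-identityˡ _)))

    direction : SpherePoint r → Unit
    direction p = scale (r ⁻¹) (coords p) , trans (dot-scale (r ⁻¹) (coords p) _)
      (trans (*-congˡ (trans (dot-scaleʳ (r ⁻¹) (coords p) (coords p)) (*-congˡ (onSphere p))))
        (trans (solve 2 (λ r i → i :* (i :* (r :* r)) := (r :* i) :* (r :* i)) refl r (r ⁻¹))
          (trans (*-cong r*r⁻¹ r*r⁻¹) (*-identityˡ 1#))))

    toward : Unit → SpherePoint r
    toward (v , v∙v) = scale r v , trans (dot-scale r v _) (trans (*-congˡ (trans (dot-scaleʳ r v v) (*-congˡ v∙v)))
      (solve 1 (λ r → r :* (r :* :1) := r :* r) refl r))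

    cosine-of-angle : SpherePoint r → SpherePoint r → ℝ
    cosine-of-angle p q = dot (coords p) (coords q) * (r * r) ⁻¹

    opaque
      direction-∙ : ∀ p q → direction p ∙ direction q ≈ cosine-of-angle p q
      direction-∙ p q = trans (dot-scale (r ⁻¹) (coords p) _) (trans (*-congˡ (dot-scaleʳ (r ⁻¹) (coords p) (coords q)))
        (trans (solve 2 (λ i a → i :* (i :* a) := a :* (i :* i)) refl (r ⁻¹) _) (*-congˡ r⁻²≈)))

      toward-∙ : ∀ x q → direction (toward x) ∙ direction q ≈ x ∙ direction q
      toward-∙ (v , _) q = trans (dot-scale (r ⁻¹) (scale r v) _) (trans (*-congˡ (dot-scale r v _))
        (trans (solve 3 (λ r i a → i :* (r :* a) :=
              (r :* i) :* a) refl r (r ⁻¹) _) (trans (*-congʳ r*r⁻¹) (*-identityˡ _))))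

      angle : ∀ p q → IsArccos (cosine-of-angle p q) (arccos (cosine-of-angle p q))
      angle p q = let l , u = bounds in
        arccos-correct (≤-respʳ-≈ (direction-∙ p q) l) (≤-respˡ-≈ (direction-∙ p q) u)
        where
        bounds : ∣ direction p ∙ direction q ∣≤ 1#
        bounds = sq⇒∣∣ 0≤1 (≤-respʳ-≈ (*-cong (proj₂ (direction p)) (proj₂ (direction q)))
          (cauchy-schwarz (proj₁ (direction p)) (proj₁ (direction q))))

      cos-angle : ∀ p q → direction p ∙ direction q ≈ cos (arccos (cosine-of-angle p q))
      cos-angle p q = trans (direction-∙ p q) (sym (proj₂ (proj₂ (angle p q))))

      r*-cancel : ∀ {α t} → r * α < t → α < r ⁻¹ * t
      r*-cancel {α} {t} rα<t = <-respˡ-≈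
        (trans (solve 3 (λ r i α → i :* (r :* α) :=
              (r :* i) :* α) refl r (r ⁻¹) α) (trans (*-congʳ r*r⁻¹) (*-identityˡ α)))
        (*-monoˡ-< 0<r⁻¹ rα<t)

      -- Distance below one means an angle below `1 / r`, hence a cosine above `cos (1 / r)`;
      -- `chord²` translates this into chords.
      d<1⇒Close : ∀ {p q} → d p q < 1# → Close (chord (r ⁻¹)) (direction p) (direction q)
      d<1⇒Close {p} {q} d<1 = <-respʳ-≈ (sym (chord² (r ⁻¹))) (0<⇒< (0<two ⊠< <⇒0<- cos<)
        (trans (solve 2 (λ a c → :2 :* (a :- c) := :2 :* (:1 :- c) :- (:2 :- :2 :* a))
                 refl _ (cos (r ⁻¹)))
          (+-congˡ (-‿cong (+-congˡ (-‿cong (*-congˡ (sym (cos-angle p q)))))))))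
        where
        cos< : cos (r ⁻¹) < cos (arccos (cosine-of-angle p q))
        cos< = cos-decreasing (proj₁ (angle p q)) (<-respʳ-≈ (*-identityʳ _) (r*-cancel d<1)) (<⇒≤ r⁻¹<π)

      Close⇒d<1 : ∀ {p q} → Close (chord (r ⁻¹)) (direction p) (direction q) → d p q < 1#
      Close⇒d<1 {p} {q} close = <-respʳ-≈ r*r⁻¹ (*-monoˡ-< 0<r
        (cos-cancel-< (<⇒≤ 0<r⁻¹) (proj₁ (proj₂ (angle p q))) (<-respʳ-≈ (cos-angle p q)
          (*-cancelˡ-< 0<two (0<⇒< (<⇒0<- (<-respʳ-≈ (chord² (r ⁻¹)) close))
            (solve 2 (λ a c → :2 :* (:1 :- c) :- (:2 :- :2 :* a) :=
              :2 :* a :- :2 :* c) refl (direction p ∙ direction q) (cos (r ⁻¹))))))))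

      approach-direction : ∀ {ε} → 0# < ε → ∀ x → Σ (SpherePoint r) λ p → ∃[ δ ] 0# < δ ×
                           (∀ q → d p q < δ → Close ε x (direction q))
      approach-direction {ε} 0<ε x = let δ , 0<δ , δ≤1 , 4δ≤ε = small-radius 0<ε in
        toward x , r * δ , 0<r ⊠< 0<δ , λ q near →
          Close-cong {u = direction (toward x)} {direction q} {x} {direction q} (toward-∙ x q)
            (close 0<δ δ≤1 4δ≤ε (toward x) q near)
        where
        close : ∀ {δ} → 0# < δ → δ ≤ 1# → four * δ ≤ ε → ∀ p q → d p q < r * δ → Close ε (direction p) (direction q)
        close {δ} 0<δ δ≤1 4δ≤ε p q near = <-≤-trans (≤-<-trans
          (≤-respˡ-≈ (+-congˡ (-‿cong (*-congˡ (sym (cos-angle p q)))))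
            (0≤⇒≤ (<⇒≤ 0<two ⊠ ≤⇒0≤- (≤-trans (proj₂ (cos-bounds (0≤⇒∣∣ 0≤α (≤-trans α≤δ δ≤1)))) (sq-mono-≤ 0≤α α≤δ)))
              (solve 2 (λ c e → :2 :* (e :- (:1 :- c)) := :2 :* e :- (:2 :- :2 :* c))
                refl (cos α) (δ * δ))))
          -- The squared chord is at most `2 α² ≤ 2 δ²`, which `(4 δ)²` exceeds by `14 δ²`.
          (0<⇒< ((((0<two ⊠< 0<two) ⊠< 0<two) ⊞≤ ((<⇒≤ 0<two ⊠ <⇒≤ 0<two) ⊞ <⇒≤ 0<two)) ⊠< (0<δ ⊠< 0<δ))
            (solve 1 (λ e → (:2 :* :2 :* :2 :+ (:2 :* :2 :+ :2)) :* (e :* e) :=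
               (:2 :* :2 :* e) :* (:2 :* :2 :* e) :- :2 :* (e :* e)) refl δ)))
          (sq-mono-≤ (<⇒≤ ((0<two ⊠< 0<two) ⊠< 0<δ)) 4δ≤ε)
          where
          α : ℝ
          α = arccos (cosine-of-angle p q)
          0≤α : 0# ≤ α
          0≤α = proj₁ (angle p q)
          α≤δ : α ≤ δ
          α≤δ = <⇒≤ (<-respʳ-≈ (trans (solve 3 (λ r i e → i :* (r :* e) := (r :* i) :* e) refl r (r ⁻¹) δ)
            (trans (*-congʳ r*r⁻¹) (*-identityˡ δ))) (r*-cancel near))

    sphere-model : ∀ {θ ε} (0<θ : 0# < θ) (0<ε : 0# < ε) (small : θ + fromℕ 4 * ε ≤ two) →
      ∀ Γ → IsGEC (sphere r) Γ →
      Model (sphereGeometry θ ε 0<θ 0<ε small) (Close (chord (r ⁻¹))) (graphStructure (sphere r) Γ)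
    sphere-model {θ} {ε} 0<θ 0<ε small Γ gec = gec-model (sphere r) (sphereGeometry θ ε 0<θ 0<ε small) Γ gec
      direction (λ {p} {q} → d<1⇒Close {p} {q}) (λ {p} {q} → Close⇒d<1 {p} {q}) (approach-direction 0<ε)

  sphere-theories-differ : ∀ {r₁ r₂} → π ⁻¹ < r₁ → π ⁻¹ < r₂ → r₂ < r₁ → ∀ {T₁ T₂} →
    IsSphereTheory r₁ T₁ → IsSphereTheory r₂ T₂ → ¬ (T₁ ≐ T₂)
  sphere-theories-differ {r₁} {r₂} π⁻¹<r₁ π⁻¹<r₂ r₂<r₁ common₁ common₂ =
    distinct-theories common₁ common₂ (sphereGeometry θ₁ ε 0<θ₁ 0<ε small)
      (λ {x} {y} → Close-≤ {u = x} {y} (<⇒≤ 0<θ₁) (≤-reflexive (solve 2 (λ θ ε → θ := θ :+ :0 :* ε) refl θ₁ ε)))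
      (λ {x} {y} → Close-≤ {u = x} {y} (<⇒≤ (0<θ₁ ⊞≤ (0≤fromℕ 7 ⊠ <⇒≤ 0<ε))) (≤-reflexive θ₁+7ε≈θ₂))
      (sphere-model π⁻¹<r₁ 0<θ₁ 0<ε small) (sphere-model π⁻¹<r₂ 0<θ₁ 0<ε small)
    where
    θ₁ θ₂ ε : ℝ
    θ₁ = chord (r₁ ⁻¹)
    θ₂ = chord (r₂ ⁻¹)
    0<r₁⁻¹ : 0# < r₁ ⁻¹
    0<r₁⁻¹ = 0<r⁻¹ π⁻¹<r₁
    0<θ₁ : 0# < θ₁
    0<θ₁ = 0<chord 0<r₁⁻¹ (<⇒≤ (r⁻¹<π π⁻¹<r₁))
    r₁⁻¹<r₂⁻¹ : r₁ ⁻¹ < r₂ ⁻¹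
    r₁⁻¹<r₂⁻¹ = *-cancelˡ-< (0<r π⁻¹<r₁ ⊠< 0<r π⁻¹<r₂) (<-respˡ-≈
      (trans (sym (trans (*-congˡ (r*r⁻¹ π⁻¹<r₁)) (*-identityʳ _)))
        (solve 3 (λ x y i → y :* (x :* i) := x :* y :* i) refl r₁ r₂ (r₁ ⁻¹)))
      (<-respʳ-≈ (trans (sym (trans (*-congˡ (r*r⁻¹ π⁻¹<r₂)) (*-identityʳ _)))
        (solve 3 (λ x y i → x :* (y :* i) := x :* y :* i) refl r₁ r₂ (r₂ ⁻¹))) r₂<r₁))
    ε-exists : ∃[ ε ] 0# < ε × θ₁ + fromℕ 7 * ε ≈ θ₂
    ε-exists = step (chord-increasing 0<r₁⁻¹ r₁⁻¹<r₂⁻¹ (<⇒≤ (r⁻¹<π π⁻¹<r₂)))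
    ε = proj₁ ε-exists
    0<ε : 0# < ε
    0<ε = proj₁ (proj₂ ε-exists)
    θ₁+7ε≈θ₂ : θ₁ + fromℕ 7 * ε ≈ θ₂
    θ₁+7ε≈θ₂ = proj₂ (proj₂ ε-exists)
    small : θ₁ + fromℕ 4 * ε ≤ two
    small = ≤-trans (radius-≤ 4 (<⇒≤ 0<ε) (ℕ.m≤m+n 4 3)) (≤-trans (≤-reflexive θ₁+7ε≈θ₂)
      (chord≤2 (<⇒≤ (0<r⁻¹ π⁻¹<r₂)) (<⇒≤ (r⁻¹<π π⁻¹<r₂))))

corollary4p10 : (em : ExcludedMiddle 0ℓ) (R : RealField) →
    let open Graphs em R in
    ((L₁ L₂ : ℝ) → 2# < L₁ → 2# < L₂ → ¬ (L₁ ≈ L₂) →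
    (T₁ T₂ : Pred GraphSentence 0ℓ) →
    IsCircleTheory L₁ T₁ → IsCircleTheory L₂ T₂ → ¬ (T₁ ≐ T₂))
    ×
    ((r₁ r₂ : ℝ) → π ⁻¹ < r₁ → π ⁻¹ < r₂ → ¬ (r₁ ≈ r₂) →
    (T₁ T₂ : Pred GraphSentence 0ℓ) →
    IsSphereTheory r₁ T₁ → IsSphereTheory r₂ T₂ → ¬ (T₁ ≐ T₂))
corollary4p10 em R = circles , spheres
  where
  open OrderedField R using (compare)
  open Graphs em R using (ℝ; _<_; _≈_; 2#; π; _⁻¹; IsCircleTheory; IsSphereTheory)

  circles : (L₁ L₂ : ℝ) → 2# < L₁ → 2# < L₂ → ¬ (L₁ ≈ L₂) → (T₁ T₂ : Pred GraphSentence 0ℓ) →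
            IsCircleTheory L₁ T₁ → IsCircleTheory L₂ T₂ → ¬ (T₁ ≐ T₂)
  circles L₁ L₂ 2<L₁ 2<L₂ L₁≉L₂ T₁ T₂ common₁ common₂ (T₁⊆T₂ , T₂⊆T₁) with compare L₁ L₂
  -- The larger circle comes first, because the first graph must be the one with the smaller
  -- `θ = 1 / L`.
  ... | tri> _ _ L₂<L₁ = Circles.circle-theories-differ em R 2<L₁ 2<L₂ L₂<L₁ common₁ common₂ (T₁⊆T₂ , T₂⊆T₁)
  ... | tri≈ _ L₁≈L₂ _ = L₁≉L₂ L₁≈L₂
  ... | tri< L₁<L₂ _ _ = Circles.circle-theories-differ em R 2<L₂ 2<L₁ L₁<L₂ common₂ common₁ (T₂⊆T₁ , T₁⊆T₂)

  spheres : (r₁ r₂ : ℝ) → π ⁻¹ < r₁ → π ⁻¹ < r₂ → ¬ (r₁ ≈ r₂) → (T₁ T₂ : Pred GraphSentence 0ℓ) →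
            IsSphereTheory r₁ T₁ → IsSphereTheory r₂ T₂ → ¬ (T₁ ≐ T₂)
  spheres r₁ r₂ π⁻¹<r₁ π⁻¹<r₂ r₁≉r₂ T₁ T₂ common₁ common₂ (T₁⊆T₂ , T₂⊆T₁) with compare r₁ r₂
  -- Likewise the larger sphere has the smaller angle `1 / r`, and so the smaller chord.
  ... | tri> _ _ r₂<r₁ = Spheres.sphere-theories-differ em R π⁻¹<r₁ π⁻¹<r₂ r₂<r₁ common₁ common₂ (T₁⊆T₂ , T₂⊆T₁)
  ... | tri≈ _ r₁≈r₂ _ = r₁≉r₂ r₁≈r₂
  ... | tri< r₁<r₂ _ _ = Spheres.sphere-theories-differ em R π⁻¹<r₂ π⁻¹<r₁ r₁<r₂ common₂ common₁ (T₂⊆T₁ , T₁⊆T₂)
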